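{- Every $n$-vertex $d$-regular graph with $d\ge \frac{n-1}{2}$ is ideal. This is tight in the sense that there exist non-ideal $d$-regular $n$-vertex graphs when $d$ is the largest even integer less than $\frac{n-1}{2}$.
   Context: All graphs are finite and simple. A graph $G$ is $H$-covered if every vertex of $G$ lies in a (not necessarily induced) subgraph of $G$ isomorphic to $H$. An $N$-vertex $H$-covered graph is edge-minimal if it has the minimum number of edges among all $N$-vertex $H$-covered graphs. Let $H$ be a graph with $n$ vertices and $0\le r<n$. Define $\mathcal{L}_{n+r}^H$ to be the collection of graphs $G$ on a vertex set $V\sqcup V_1\sqcup V_2$ (disjoint union) with $|V|=n-r$, $|V_1|=|V_2|=r$, such that: there are no edges between $V_1$ and $V_2$; the set $V$ induces a subgraph of $H$ with $n-r$ vertices which has the maximum possible number of edges; and $V_1\sqcup V$ and $V_2\sqcup V$ both induce $H$. $H$ is ideal in remainder class $r$ if for all $N=qn+r$ with $q$ a positive integer, a graph $G$ is edge-minimal among $N$-vertex $H$-covered graphs if and only if $G$ consists of a graph in $\mathcal{L}_{n+r}^H$ together with the disjoint union of $q-1$ copies of $H$. $H$ is ideal if it is ideal in remainder class $r$ for every $r\in\{0,1,\dots,n-1\}$.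
   Formalization: The tightness claim is stated for every n except when d = 0 or n = 2d+2, since in those cases every d-regular n-vertex graph is in fact ideal and no non-ideal example exists. -}

module Defs where

open import Data.Bool.Base using (Bool; true; false; _∧_; if_then_else_)
open import Data.Fin.Base using (Fin)
open import Data.Fin.Properties using (_≟_; _<?_)
open import Data.Nat.Base using (ℕ; _+_; _*_; _∸_; _≤_; _<_)
open import Data.Nat.Divisibility using (_∣_)
open import Data.Nat.Properties using (+-0-commutativeMonoid)
open import Data.Product using (Σ-syntax; ∃-syntax; _×_; _,_)
open import Data.Sum.Base using (_⊎_; inj₁; inj₂)
open import Function.Base using (_∘_)
open import Function.Bundles using (_↣_; _↔_; _⇔_; Injection; Inverse)
open import Relation.Binary.PropositionalEquality
  using (_≡_; refl; sym; cong₂)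
open import Relation.Nullary using (does; yes; no; contradiction)
open import Algebra.Properties.CommutativeMonoid.Sum +-0-commutativeMonoid
  using (sum-syntax)

private
  variable
    A B : Set
    m n : ℕ

-- Simple graphs with vertex type A. All vertex types used below are finite:
-- Fin n, or sums and products of such types.
record Graph (A : Set) : Set where
  field
    adj        : A → A → Bool
    adj-sym    : ∀ u v → adj u v ≡ adj v u
    adj-irrefl : ∀ v → adj v v ≡ false

open Graph public

[_]ᵇ : Bool → ℕ
[ b ]ᵇ = if b then 1 else 0

-- Each edge is counted once, at its ordered pair u < v.
edges : Graph (Fin n) → ℕ
edges {n} G = ∑[ u < n ] ∑[ v < n ] [ does (u <? v) ∧ adj G u v ]ᵇ

degree : Graph (Fin n) → Fin n → ℕ
degree {n} G v = ∑[ w < n ] [ adj G v w ]ᵇ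

Regular : ℕ → Graph (Fin n) → Set
Regular d G = ∀ v → degree G v ≡ d

-- A copy of H as a not necessarily induced subgraph of G.
record _↪_ (H : Graph A) (G : Graph B) : Set where
  field
    embed    : A ↣ B
    edge-map : ∀ u v → adj H u v ≡ true →
               adj G (Injection.to embed u) (Injection.to embed v) ≡ true

record _≅_ (G : Graph A) (H : Graph B) : Set where
  field
    bij     : A ↔ B
    adj-map : ∀ u v →
              adj H (Inverse.to bij u) (Inverse.to bij v) ≡ adj G u v

-- The subgraph of G induced on the image of f, when f is injective.
pullback : (A → B) → Graph B → Graph A
pullback f G = record
  { adj        = λ u v → adj G (f u) (f v)
  ; adj-sym    = λ u v → adj-sym G (f u) (f v)
  ; adj-irrefl = λ v → adj-irrefl G (f v)
  }

infixr 5 _⊔ᴳ_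
_⊔ᴳ_ : Graph A → Graph B → Graph (A ⊎ B)
_⊔ᴳ_ {A} {B} G H = record { adj = a ; adj-sym = s ; adj-irrefl = i }
  where
  a : A ⊎ B → A ⊎ B → Bool
  a (inj₁ u) (inj₁ v) = adj G u v
  a (inj₂ u) (inj₂ v) = adj H u v
  a (inj₁ _) (inj₂ _) = false
  a (inj₂ _) (inj₁ _) = false

  s : ∀ u v → a u v ≡ a v u
  s (inj₁ u) (inj₁ v) = adj-sym G u v
  s (inj₂ u) (inj₂ v) = adj-sym H u v
  s (inj₁ _) (inj₂ _) = refl
  s (inj₂ _) (inj₁ _) = refl

  i : ∀ v → a v v ≡ false
  i (inj₁ v) = adj-irrefl G v
  i (inj₂ v) = adj-irrefl H v

-- The disjoint union of k copies of H.
copies : (k : ℕ) → Graph A → Graph (Fin k × A)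
copies {A} k H = record { adj = a ; adj-sym = s ; adj-irrefl = i }
  where
  a : Fin k × A → Fin k × A → Bool
  a (i , u) (j , v) = does (i ≟ j) ∧ adj H u v

  does-sym : (i j : Fin k) → does (i ≟ j) ≡ does (j ≟ i)
  does-sym i j with i ≟ j | j ≟ i
  ... | yes _ | yes _ = refl
  ... | no  _ | no  _ = refl
  ... | yes p | no ¬q = contradiction (sym p) ¬q
  ... | no ¬p | yes q = contradiction (sym q) ¬p

  s : ∀ x y → a x y ≡ a y x
  s (i , u) (j , v) = cong₂ _∧_ (does-sym i j) (adj-sym H u v)

  i : ∀ x → a x x ≡ false
  i (j , v) with does (j ≟ j)
  ... | true  = adj-irrefl H v
  ... | false = refl

Covered : Graph A → Graph B → Set
Covered H G = ∀ v → Σ[ φ ∈ H ↪ G ] ∃[ u ] Injection.to (_↪_.embed φ) u ≡ v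

EdgeMinimal : Graph A → Graph (Fin n) → Set
EdgeMinimal {n = n} H G =
  Covered H G × ((G′ : Graph (Fin n)) → Covered H G′ → edges G ≤ edges G′)

MaxSubgraph : Graph (Fin n) → Graph (Fin m) → Set
MaxSubgraph {m = m} H X =
  X ↪ H × ((Y : Graph (Fin m)) → Y ↪ H → edges Y ≤ edges X)

-- The vertex set V ⊔ V₁ ⊔ V₂, with |V| = n ∸ r (used only for r < n) and
-- |V₁| = |V₂| = r.
LVertex : ℕ → ℕ → Set
LVertex n r = Fin (n ∸ r) ⊎ Fin r ⊎ Fin r

inV : ∀ {n} r → Fin (n ∸ r) → LVertex n r
inV r = inj₁

inV₁ inV₂ : ∀ {n} r → Fin r → LVertex n r
inV₁ r = inj₂ ∘ inj₁
inV₂ r = inj₂ ∘ inj₂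

V∪V₁ V∪V₂ : ∀ {n} r → Fin (n ∸ r) ⊎ Fin r → LVertex n r
V∪V₁     r (inj₁ x) = inj₁ x
V∪V₁ {n} r (inj₂ y) = inV₁ {n} r y
V∪V₂     r (inj₁ x) = inj₁ x
V∪V₂ {n} r (inj₂ y) = inV₂ {n} r y

-- Membership in the collection 𝓛 of H with parameter r.
record In𝓛 (H : Graph (Fin n)) (r : ℕ) (G : Graph (LVertex n r)) : Set where
  field
    no-V₁V₂-edge : ∀ x y → adj G (inV₁ {n} r x) (inV₂ {n} r y) ≡ false
    V-max        : MaxSubgraph H (pullback (inV {n} r) G)
    V∪V₁-copy    : pullback (V∪V₁ {n} r) G ≅ H
    V∪V₂-copy    : pullback (V∪V₂ {n} r) G ≅ H

IdealInClass : Graph (Fin n) → ℕ → Set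
IdealInClass {n} H r =
  ∀ N q → 1 ≤ q → N ≡ q * n + r → (G : Graph (Fin N)) →
  EdgeMinimal H G ⇔
  (Σ[ L ∈ Graph (LVertex n r) ] In𝓛 H r L × G ≅ (L ⊔ᴳ copies (q ∸ 1) H))

Ideal : Graph (Fin n) → Set
Ideal {n} H = ∀ r → r < n → IdealInClass H r

-- d is the largest even number less than (n - 1) / 2, where d < (n - 1) / 2
-- is written without division or truncated subtraction.
LargestEvenBelowHalf : ℕ → ℕ → Set
LargestEvenBelowHalf n d =
  2 ∣ d × 2 * d + 1 < n × (∀ e → 2 ∣ e → 2 * e + 1 < n → e ≤ d)

{-# OPTIONS --safe #-}
module Submission where

-- Let cut(A) be the number of edges of H leaving A. Add copies of H one at a
-- time until they cover G. If a new copy contributes exactly the vertices K of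
-- H, the sum of the degrees grows by at least d|K| + cut(K). The key fact is
-- that, for n ≤ 2d + 1, cuts are strictly subadditive: if A and B are proper
-- and nonempty, some C with |C| ≡ |A| + |B| (mod n) has
-- cut(C) < cut(A) + cut(B). For |B| ≤ |A| ≤ n - |B| one takes C = A ∪ X where
-- the |B|-set X outside A has 2 e(X,A) greater than the number of ordered
-- nonadjacent pairs in X, as a random X has on average. So the degrees of
-- an H-covered graph on qn + r vertices sum to at least d(qn + r) + min cut(C)
-- over |C| = r, the members of 𝓛 together with copies of H attain this, and in
-- an edge-minimal graph at most one copy is partially new.
-- For the tightness, H = F ⊔ K_{d+1}, where no vertex of F has a clique as its
-- neighbourhood, fails in remainder class 0.

open import Defs
open import Data.Bool.Base using (Bool; true; false; _∧_; _∨_; not)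
open import Data.Bool.ListAction using (any)
import Data.Bool.Properties as Bool
open import Data.Bool.Properties using (not-involutive; ∧-zeroʳ; ∨-comm)
open import Data.Fin.Base using (Fin; zero; suc; toℕ; fromℕ<; splitAt; join; remQuot; quotRem)
open import Data.Fin.Properties using (_≟_; any?; all?)
import Data.Fin.Properties as F
open import Data.List.Base using (List; []; _∷_)
open import Data.Nat.Base
open import Data.Nat.Divisibility using (divides; ∣m∣n⇒∣m+n; ∣-refl)
open import Data.Nat.Properties hiding (_≟_)
import Data.Nat.Properties as ℕ
open import Data.Nat.Tactic.RingSolver using (solve-∀)
open import Data.Product using (Σ-syntax; ∃-syntax; _×_; _,_; proj₁; proj₂; swap; map₂)
open import Data.Sum.Base using (_⊎_; inj₁; inj₂; [_,_]′; map₁)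
open import Data.Sum.Function.Propositional using (_⊎-↔_)
open import Function.Base using (_∘_; id)
open import Function.Bundles using (Equivalence; Injection; Inverse; _↔_; mk⇔; mk↔ₛ′; mk↣)
open import Function.Construct.Composition using (_↣-∘_)
open import Function.Definitions using (Injective)
open import Function.Properties.Inverse using (↔⇒↣; ↔-sym; ↔-trans; ↔-refl)
open import Relation.Binary.Definitions using (tri<; tri≈; tri>)
open import Relation.Binary.PropositionalEquality
open import Relation.Nullary using (¬_; Dec; does; yes; no; contradiction)
open import Relation.Nullary.Decidable using (dec-true; dec-false; _×-dec_; ¬?; decidable-stable; True; toWitness)
open import Algebra.Properties.Semiring.Sum +-*-semiring
  using (sum; sum-cong-≗; ∑-distrib-+; ∑-comm; sum-permute; *-distribˡ-sum; *-distribʳ-sum)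

open Inverse using (to; from; strictlyInverseˡ; strictlyInverseʳ)

-- Regularity makes `vol H P + cut H P` equal to `d * card P`, so a subgraph of H on n - r vertices
-- with most edges is the complement of an r-set of least cut; this is how `In𝓛` meets the lower
-- bound. Counting ordered pairs as well gives cut(P) = |P|(d + 1 - |P|) + (nonadjacent pairs in P).
-- Hence B enters the key fact only through its size, and the edges from X to A have to outweigh the
-- nonadjacent pairs inside X. The hypothesis n ≤ 2d + 1 is used twice: one of P and its complement
-- has at most d vertices, which makes cuts positive, and cut(A) is large as soon as the complement
-- of A has more than d + 1 vertices. The obstacle is uniqueness. Strict subadditivity says nothing
-- about an empty or full set, so a partially new copy is contradictory only once a nonempty proper
-- remainder set is on record. The structure proof therefore starts from two overlapping copies,
-- which exist when r is nonzero; for r = 0 the least degree sum is dN, and any positive cut exceeds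
-- it.

private
  variable
    m n N : ℕ
    𝒜 ℬ 𝒞 : Set

-- Sums over Fin n

sum-mono : {f g : Fin n → ℕ} → (∀ i → f i ≤ g i) → sum f ≤ sum g
sum-mono {zero}  f≤g = z≤n
sum-mono {suc n} f≤g = +-mono-≤ (f≤g zero) (sum-mono (f≤g ∘ suc))

sum-mono-< : {f g : Fin n → ℕ} → (∀ i → f i ≤ g i) → ∀ i → f i < g i → sum f < sum g
sum-mono-< f≤g zero    lt = +-mono-<-≤ lt (sum-mono (f≤g ∘ suc))
sum-mono-< f≤g (suc i) lt = +-mono-≤-< (f≤g zero) (sum-mono-< (f≤g ∘ suc) i lt)

sum-0 : {f : Fin n → ℕ} → (∀ i → f i ≡ 0) → sum f ≡ 0
sum-0 {zero}  f≡0 = refl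
sum-0 {suc n} f≡0 = cong₂ _+_ (f≡0 zero) (sum-0 (f≡0 ∘ suc))

sum-const : ∀ n c → sum {n} (λ _ → c) ≡ n * c
sum-const zero    c = refl
sum-const (suc n) c = cong (c +_) (sum-const n c)

sum-ones : ∀ n → sum {n} (λ _ → 1) ≡ n
sum-ones n = trans (sum-const n 1) (*-identityʳ n)

term≤sum : (f : Fin n → ℕ) → ∀ i → f i ≤ sum f
term≤sum f zero    = m≤m+n _ _
term≤sum f (suc i) = ≤-trans (term≤sum (f ∘ suc) i) (m≤n+m _ _)

sum-<⇒∃< : {f g : Fin n → ℕ} → sum f < sum g → ∃[ i ] f i < g i
sum-<⇒∃< {f = f} {g} lt with any? (λ i → f i <? g i)
... | yes p = p
... | no ¬p = contradiction (sum-mono (λ i → ≮⇒≥ (λ q → ¬p (i , q)))) (<⇒≱ lt)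

sum-pos⇒∃ : {f : Fin n → ℕ} → 0 < sum f → ∃[ i ] 0 < f i
sum-pos⇒∃ {n} {f} p = sum-<⇒∃< {f = λ _ → 0} (subst (_< sum f) (sym (sum-0 {n} {λ _ → 0} λ _ → refl)) p)

δ : Fin n → Fin n → ℕ
δ i j = [ does (i ≟ j) ]ᵇ

δ-refl : (i : Fin n) → δ i i ≡ 1
δ-refl i = cong [_]ᵇ (dec-true (i ≟ i) refl)

δ-≢ : {i j : Fin n} → i ≢ j → δ i j ≡ 0
δ-≢ {i = i} {j} ≢ = cong [_]ᵇ (dec-false (i ≟ j) ≢)

sum-δ : (i : Fin n) (f : Fin n → ℕ) → sum (λ j → f j * δ i j) ≡ f i
sum-δ {suc n} zero    f = trans (cong₂ _+_ (*-identityʳ (f zero)) (sum-0 {n} λ j → *-zeroʳ (f (suc j)))) (+-identityʳ _)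
sum-δ {suc n} (suc i) f = trans (cong₂ _+_ (*-zeroʳ (f zero)) (sum-cong-≗ λ j → cong (f (suc j) *_) (δ-suc i j))) (sum-δ i (f ∘ suc))
  where
  δ-suc : (i j : Fin n) → δ (suc i) (suc j) ≡ δ i j
  δ-suc i j with i ≟ j
  ... | yes refl = refl
  ... | no  _    = refl

does-≟-comm : (i j : Fin n) → does (i ≟ j) ≡ does (j ≟ i)
does-≟-comm i j with i ≟ j | j ≟ i
... | yes _ | yes _ = refl
... | no  _ | no  _ = refl
... | yes p | no ¬q = contradiction (sym p) ¬q
... | no ¬p | yes q = contradiction (sym q) ¬p

sum-δˡ : (i : Fin n) (f : Fin n → ℕ) → sum (λ j → f j * δ j i) ≡ f i
sum-δˡ i f = trans (sum-cong-≗ λ j → cong (λ b → f j * [ b ]ᵇ) (does-≟-comm j i)) (sum-δ i f)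

total-δ : (i : Fin n) → sum (δ i) ≡ 1
total-δ i = trans (sum-cong-≗ λ j → sym (*-identityˡ (δ i j))) (sum-δ i (λ _ → 1))

Inj : {A B : Set} → (A → B) → Set
Inj = Injective _≡_ _≡_

-- Pushforward of a weight along `φ`. It turns a vertex set of H into a weight on the vertices of G,
-- so that edge counts in G pull back to H without inverting `φ`.
push : (Fin m → Fin n) → (Fin m → ℕ) → Fin n → ℕ
push φ w v = sum λ i → w i * δ (φ i) v

sum-push : (φ : Fin m → Fin n) (w : Fin m → ℕ) (g : Fin n → ℕ) →
           sum (λ v → push φ w v * g v) ≡ sum (λ i → w i * g (φ i))
sum-push φ w g = begin
  sum (λ v → push φ w v * g v)
    ≡⟨ sum-cong-≗ (λ v → *-distribʳ-sum (g v) (λ i → w i * δ (φ i) v)) ⟩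
  sum (λ v → sum (λ i → w i * δ (φ i) v * g v))
    ≡⟨ ∑-comm (λ v i → w i * δ (φ i) v * g v) ⟩
  sum (λ i → sum (λ v → w i * δ (φ i) v * g v))
    ≡⟨ sum-cong-≗ (λ i → sum-cong-≗ λ v → rearr (w i) (δ (φ i) v) (g v)) ⟩
  sum (λ i → sum (λ v → w i * g v * δ (φ i) v))
    ≡⟨ sum-cong-≗ (λ i → sum-δ (φ i) (λ v → w i * g v)) ⟩
  sum (λ i → w i * g (φ i)) ∎
  where
  open ≡-Reasoning
  rearr : ∀ a b c → a * b * c ≡ a * c * b
  rearr = solve-∀

push-image : {φ : Fin m → Fin n} → Inj φ → ∀ w i → push φ w (φ i) ≡ w i
push-image {φ = φ} inj w i = trans (sum-cong-≗ λ j → cong (w j *_) (δ-inj j)) (sum-δˡ i w)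
  where
  δ-inj : ∀ j → δ (φ j) (φ i) ≡ δ j i
  δ-inj j with j ≟ i
  ... | yes refl = δ-refl (φ j)
  ... | no  j≢i  = δ-≢ (j≢i ∘ inj)

push-∉ : (φ : Fin m → Fin n) → ∀ w {v} → (∀ i → φ i ≢ v) → push φ w v ≡ 0
push-∉ φ w v∉ = sum-0 λ i → trans (cong (w i *_) (δ-≢ (v∉ i))) (*-zeroʳ (w i))

image? : (φ : Fin m → Fin n) → ∀ v → Dec (∃[ i ] φ i ≡ v)
image? φ v = any? (λ i → φ i ≟ v)

sum-inj : {φ : Fin m → Fin n} → Inj φ → ∀ f → sum (f ∘ φ) ≤ sum f
sum-inj {φ = φ} inj f = begin
  sum (f ∘ φ)                          ≡⟨ sum-cong-≗ (λ i → *-identityˡ (f (φ i))) ⟨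
  sum (λ i → 1 * f (φ i))              ≡⟨ sum-push φ (λ _ → 1) f ⟨
  sum (λ v → push φ (λ _ → 1) v * f v) ≤⟨ sum-mono (λ v → ≤-trans (*-monoˡ-≤ (f v) (≤1 v)) (≤-reflexive (*-identityˡ (f v)))) ⟩
  sum f ∎
  where
  open ≤-Reasoning
  ≤1 : ∀ v → push φ (λ _ → 1) v ≤ 1
  ≤1 v with image? φ v
  ... | yes (i , refl) = ≤-reflexive (push-image inj (λ _ → 1) i)
  ... | no  v∉         = ≤-trans (≤-reflexive (push-∉ φ (λ _ → 1) λ i eq → v∉ (i , eq))) z≤n

-- Adjoining `x` to `φ` gives an injection on one more point, to which `sum-inj` applies.
sum-inj-extra : {φ : Fin m → Fin n} → Inj φ → ∀ f {x} → (∀ i → φ i ≢ x) → f x + sum (f ∘ φ) ≤ sum f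
sum-inj-extra {m} {n} {φ} inj f {x} x∉ = sum-inj inj′ f
  where
  φ′ : Fin (suc m) → Fin n
  φ′ zero    = x
  φ′ (suc i) = φ i
  inj′ : Inj φ′
  inj′ {zero}  {zero}  _  = refl
  inj′ {zero}  {suc j} eq = contradiction (sym eq) (x∉ j)
  inj′ {suc i} {zero}  eq = contradiction eq (x∉ i)
  inj′ {suc i} {suc j} eq = cong suc (inj eq)

-- Bilinear forms

abstract
  -- Weights rather than sets: indicators, point masses and pushforwards are all arguments, so one
  -- expansion of the quadratic form covers unions, deletions of a vertex and inserted copies.
  form : (Fin m → Fin n → ℕ) → (Fin m → ℕ) → (Fin n → ℕ) → ℕ
  form a f g = sum λ u → sum λ v → f u * g v * a u v

  form-sum : (a : Fin m → Fin n → ℕ) → ∀ f g → form a f g ≡ sum λ u → sum λ v → f u * g v * a u v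
  form-sum a f g = refl

  form-rows : (a : Fin m → Fin n → ℕ) → ∀ f g → form a f g ≡ sum λ u → f u * (sum λ v → g v * a u v)
  form-rows a f g = sum-cong-≗ λ u → trans (sum-cong-≗ λ v → *-assoc (f u) (g v) (a u v))
                                          (sym (*-distribˡ-sum (f u) (λ v → g v * a u v)))

  form-cong : {a : Fin m → Fin n → ℕ} {f f′ : Fin m → ℕ} {g g′ : Fin n → ℕ} →
              (∀ u → f u ≡ f′ u) → (∀ v → g v ≡ g′ v) → form a f g ≡ form a f′ g′
  form-cong {a = a} ff gg = sum-cong-≗ λ u → sum-cong-≗ λ v → cong₂ (λ x y → x * y * a u v) (ff u) (gg v)

  form-congʳ : (a : Fin m → Fin n → ℕ) (f : Fin m → ℕ) {g g′ : Fin n → ℕ} →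
               (∀ v → g v ≡ g′ v) → form a f g ≡ form a f g′
  form-congʳ a f gg = form-cong {a = a} {f} (λ _ → refl) gg

  form-congˡ : (a : Fin m → Fin n → ℕ) {f f′ : Fin m → ℕ} (g : Fin n → ℕ) →
               (∀ u → f u ≡ f′ u) → form a f g ≡ form a f′ g
  form-congˡ a g ff = form-cong {a = a} {g = g} ff (λ _ → refl)

  form-mono : {a b : Fin m → Fin n → ℕ} → (∀ u v → a u v ≤ b u v) → ∀ f g → form a f g ≤ form b f g
  form-mono a≤b f g = sum-mono λ u → sum-mono λ v → *-monoʳ-≤ (f u * g v) (a≤b u v)

  form-transpose : (a : Fin m → Fin n → ℕ) → ∀ f g → form a f g ≡ form (λ v u → a u v) g f
  form-transpose a f g = trans (∑-comm (λ u v → f u * g v * a u v))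
    (sum-cong-≗ λ v → sum-cong-≗ λ u → cong (_* a u v) (*-comm (f u) (g v)))

  form-+ˡ : (a : Fin m → Fin n → ℕ) → ∀ f f′ g → form a (λ u → f u + f′ u) g ≡ form a f g + form a f′ g
  form-+ˡ a f f′ g = begin
    form a (λ u → f u + f′ u) g
      ≡⟨ sum-cong-≗ (λ u → sum-cong-≗ λ v → distr (f u) (f′ u) (g v) (a u v)) ⟩
    sum (λ u → sum λ v → f u * g v * a u v + f′ u * g v * a u v)
      ≡⟨ sum-cong-≗ (λ u → ∑-distrib-+ (λ v → f u * g v * a u v) (λ v → f′ u * g v * a u v)) ⟩
    sum (λ u → sum (λ v → f u * g v * a u v) + sum (λ v → f′ u * g v * a u v))
      ≡⟨ ∑-distrib-+ (λ u → sum (λ v → f u * g v * a u v)) (λ u → sum (λ v → f′ u * g v * a u v)) ⟩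
    form a f g + form a f′ g ∎
    where
    open ≡-Reasoning
    distr : ∀ x y z w → (x + y) * z * w ≡ x * z * w + y * z * w
    distr = solve-∀

  form-+ʳ : (a : Fin m → Fin n → ℕ) → ∀ f g g′ → form a f (λ u → g u + g′ u) ≡ form a f g + form a f g′
  form-+ʳ a f g g′ = begin
    form a f (λ u → g u + g′ u)                                    ≡⟨ form-transpose a f _ ⟩
    form (λ v u → a u v) (λ u → g u + g′ u) f                      ≡⟨ form-+ˡ (λ v u → a u v) g g′ f ⟩
    form (λ v u → a u v) g f + form (λ v u → a u v) g′ f
      ≡⟨ cong₂ _+_ (form-transpose a f g) (form-transpose a f g′) ⟨
    form a f g + form a f g′ ∎
    where open ≡-Reasoning

  form-pushˡ : (a : Fin N → Fin n → ℕ) (φ : Fin m → Fin N) → ∀ w g →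
               form a (push φ w) g ≡ form (λ i v → a (φ i) v) w g
  form-pushˡ a φ w g = begin
    form a (push φ w) g                                       ≡⟨ form-rows a (push φ w) g ⟩
    sum (λ u → push φ w u * (sum λ v → g v * a u v))          ≡⟨ sum-push φ w (λ u → sum λ v → g v * a u v) ⟩
    sum (λ i → w i * (sum λ v → g v * a (φ i) v))             ≡⟨ form-rows _ w g ⟨
    form (λ i v → a (φ i) v) w g ∎
    where open ≡-Reasoning

  form-pushʳ : (a : Fin n → Fin N → ℕ) (φ : Fin m → Fin N) → ∀ f w →
               form a f (push φ w) ≡ form (λ u i → a u (φ i)) f w
  form-pushʳ a φ f w = begin
    form a f (push φ w)                      ≡⟨ form-transpose a f _ ⟩
    form (λ v u → a u v) (push φ w) f        ≡⟨ form-pushˡ _ φ w f ⟩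
    form (λ i u → a u (φ i)) w f             ≡⟨ form-transpose _ w f ⟩
    form (λ u i → a u (φ i)) f w ∎
    where open ≡-Reasoning

  form-mono-< : {a b : Fin m → Fin n → ℕ} → (∀ u v → a u v ≤ b u v) → ∀ f g u v →
                f u ≡ 1 → g v ≡ 1 → a u v < b u v → form a f g < form b f g
  form-mono-< {a = a} {b} a≤b f g u v fu gv lt =
    sum-mono-< (λ u → sum-mono λ v → *-monoʳ-≤ (f u * g v) (a≤b u v)) u
      (sum-mono-< (λ v → *-monoʳ-≤ (f u * g v) (a≤b u v)) v
        (subst (λ c → c * a u v < c * b u v) (sym (cong₂ _*_ fu gv)) (+-monoˡ-< 0 lt)))

  form-sym : {a : Fin n → Fin n → ℕ} → (∀ u v → a u v ≡ a v u) → ∀ f g → form a f g ≡ form a g f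
  form-sym {a = a} a-sym f g = trans (form-transpose a f g)
    (sum-cong-≗ λ v → sum-cong-≗ λ u → cong (g v * f u *_) (a-sym u v))

  form-+ : (a b : Fin m → Fin n → ℕ) → ∀ f g → form (λ u v → a u v + b u v) f g ≡ form a f g + form b f g
  form-+ a b f g = begin
    form (λ u v → a u v + b u v) f g
      ≡⟨ sum-cong-≗ (λ u → sum-cong-≗ λ v → *-distribˡ-+ (f u * g v) (a u v) (b u v)) ⟩
    sum (λ u → sum λ v → f u * g v * a u v + f u * g v * b u v)
      ≡⟨ sum-cong-≗ (λ u → ∑-distrib-+ (λ v → f u * g v * a u v) (λ v → f u * g v * b u v)) ⟩
    sum (λ u → sum (λ v → f u * g v * a u v) + sum (λ v → f u * g v * b u v))
      ≡⟨ ∑-distrib-+ (λ u → sum (λ v → f u * g v * a u v)) (λ u → sum (λ v → f u * g v * b u v)) ⟩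
    form a f g + form b f g ∎
    where open ≡-Reasoning

  form-zeroʳ : (a : Fin m → Fin n → ℕ) → ∀ f {g} → (∀ v → g v ≡ 0) → form a f g ≡ 0
  form-zeroʳ a f g≡0 = sum-0 λ u → sum-0 λ v →
    trans (cong (λ x → f u * x * a u v) (g≡0 v)) (cong (_* a u v) (*-zeroʳ (f u)))

-- Subsets as Boolean predicates

Sub : ℕ → Set
Sub n = Fin n → Bool

χ : Sub n → Fin n → ℕ
χ P v = [ P v ]ᵇ

∁ : Sub n → Sub n
∁ P v = not (P v)

∅ : Sub n
∅ _ = false

card : Sub n → ℕ
card P = sum (χ P)

χ+χ∁ : (P : Sub n) → ∀ v → χ P v + χ (∁ P) v ≡ 1
χ+χ∁ P v with P v
... | true  = refl
... | false = refl

card+card∁ : (P : Sub n) → card P + card (∁ P) ≡ n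
card+card∁ {n} P = begin
  card P + card (∁ P)                ≡⟨ ∑-distrib-+ (χ P) (χ (∁ P)) ⟨
  sum (λ v → χ P v + χ (∁ P) v)      ≡⟨ sum-cong-≗ (χ+χ∁ P) ⟩
  sum {n} (λ _ → 1)                  ≡⟨ sum-ones n ⟩
  n ∎
  where open ≡-Reasoning

card≤ : (P : Sub n) → card P ≤ n
card≤ P = ≤-trans (m≤m+n _ _) (≤-reflexive (card+card∁ P))

true⇒χ : {b : Bool} → b ≡ true → [ b ]ᵇ ≡ 1
true⇒χ refl = refl

false⇒χ : {b : Bool} → b ≡ false → [ b ]ᵇ ≡ 0
false⇒χ refl = refl

χ-pos⇒true : {b : Bool} → 0 < [ b ]ᵇ → b ≡ true
χ-pos⇒true {true} _ = refl

card-pos⇒∃ : {P : Sub n} → 0 < card P → ∃[ v ] P v ≡ true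
card-pos⇒∃ {P = P} p with sum-pos⇒∃ {f = χ P} p
... | v , q = v , χ-pos⇒true q

∃⇒card-pos : {P : Sub n} → ∀ v → P v ≡ true → 0 < card P
∃⇒card-pos {P = P} v eq = ≤-trans (≤-reflexive (sym (true⇒χ eq))) (term≤sum (χ P) v)

card≡0⇒false : {P : Sub n} → card P ≡ 0 → ∀ v → P v ≡ false
card≡0⇒false {P = P} eq v with P v in e
... | false = refl
... | true  = contradiction (subst (0 <_) eq (∃⇒card-pos {P = P} v e)) λ ()

card≡n⇒true : {P : Sub n} → card P ≡ n → ∀ v → P v ≡ true
card≡n⇒true {n} {P} eq v with P v in e | card≡0⇒false {P = ∁ P} c≡0 v
  where
  c≡0 : card (∁ P) ≡ 0
  c≡0 = +-cancelˡ-≡ (card P) _ _ (trans (card+card∁ P) (trans (sym eq) (sym (+-identityʳ _))))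
... | true  | _  = refl
... | false | ()

card-∅ : card {n} ∅ ≡ 0
card-∅ {n} = sum-0 {n} λ _ → refl

-- Edge counts between vertex weights

E : Graph (Fin n) → (Fin n → ℕ) → (Fin n → ℕ) → ℕ
E G = form λ u v → [ adj G u v ]ᵇ

-- Edges inside P are counted twice here, edges leaving P once in cut.
vol : Graph (Fin n) → Sub n → ℕ
vol G P = E G (χ P) (χ P)

cut : Graph (Fin n) → Sub n → ℕ
cut G P = E G (χ P) (χ (∁ P))

form-quad : {a : Fin n → Fin n → ℕ} → (∀ u v → a u v ≡ a v u) → ∀ f g →
            form a (λ v → f v + g v) (λ v → f v + g v) ≡ form a f f + 2 * form a f g + form a g g
form-quad {a = a} a-sym f g = begin
  form a (λ v → f v + g v) (λ v → f v + g v)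
    ≡⟨ form-+ˡ a f g _ ⟩
  form a f (λ v → f v + g v) + form a g (λ v → f v + g v)
    ≡⟨ cong₂ _+_ (form-+ʳ a f f g) (form-+ʳ a g f g) ⟩
  (form a f f + form a f g) + (form a g f + form a g g)
    ≡⟨ cong (λ x → (form a f f + form a f g) + (x + form a g g)) (form-sym a-sym g f) ⟩
  (form a f f + form a f g) + (form a f g + form a g g)
    ≡⟨ rearr (form a f f) (form a f g) (form a g g) ⟩
  form a f f + 2 * form a f g + form a g g ∎
  where
  open ≡-Reasoning
  rearr : ∀ x y z → (x + y) + (y + z) ≡ x + 2 * y + z
  rearr = solve-∀

form-δ : (a : Fin n → Fin n → ℕ) → ∀ x g → form a (δ x) g ≡ sum λ v → g v * a x v
form-δ a x g = begin
  form a (δ x) g                                      ≡⟨ form-rows a (δ x) g ⟩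
  sum (λ u → δ x u * (sum λ v → g v * a u v))         ≡⟨ sum-cong-≗ (λ u → *-comm (δ x u) _) ⟩
  sum (λ u → (sum λ v → g v * a u v) * δ x u)         ≡⟨ sum-δ x (λ u → sum λ v → g v * a u v) ⟩
  sum (λ v → g v * a x v) ∎
  where open ≡-Reasoning

χ-idem : (b : Bool) → [ b ]ᵇ * [ b ]ᵇ ≡ [ b ]ᵇ
χ-idem true  = refl
χ-idem false = refl

adjᵇ-sym : (G : Graph (Fin n)) → ∀ u v → [ adj G u v ]ᵇ ≡ [ adj G v u ]ᵇ
adjᵇ-sym G u v = cong [_]ᵇ (adj-sym G u v)

E-ones : (G : Graph (Fin n)) → ∀ f → E G f (λ _ → 1) ≡ sum λ u → f u * degree G u
E-ones {n} G f = trans (form-rows (λ u v → [ adj G u v ]ᵇ) f (λ _ → 1))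
  (sum-cong-≗ λ u → cong (f u *_) (sum-cong-≗ λ v → *-identityˡ [ adj G u v ]ᵇ))

cut-∁ : (G : Graph (Fin n)) → ∀ P → cut G (∁ P) ≡ cut G P
cut-∁ G P = trans (form-congʳ _ (χ (∁ P)) (λ v → cong [_]ᵇ (not-involutive (P v))))
  (form-sym (adjᵇ-sym G) (χ (∁ P)) (χ P))

cut-all : (G : Graph (Fin n)) → ∀ P → card P ≡ n → cut G P ≡ 0
cut-all G P full = form-zeroʳ _ (χ P) λ v → false⇒χ (cong not (card≡n⇒true {P = P} full v))

cut-none : (G : Graph (Fin n)) → ∀ P → card P ≡ 0 → cut G P ≡ 0
cut-none {n} G P empty = trans (sym (cut-∁ G P))
  (cut-all G (∁ P) (trans (cong (_+ card (∁ P)) (sym empty)) (card+card∁ P)))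

-- Nonadjacent pairs and cuts in regular graphs

non : Graph (Fin n) → Fin n → Fin n → ℕ
non G u v = [ not (does (u ≟ v) ∨ adj G u v) ]ᵇ

non-irrefl : (G : Graph (Fin n)) → ∀ v → non G v v ≡ 0
non-irrefl G v rewrite dec-true (v ≟ v) refl = refl

non-sym : (G : Graph (Fin n)) → ∀ u v → non G u v ≡ non G v u
non-sym G u v = cong₂ (λ b c → [ not (b ∨ c) ]ᵇ) (does-≟-comm u v) (adj-sym G u v)

adj+non+δ : (G : Graph (Fin n)) → ∀ u v → [ adj G u v ]ᵇ + non G u v + δ u v ≡ 1
adj+non+δ G u v with u ≟ v
... | yes refl rewrite adj-irrefl G v = refl
... | no _ with adj G u v
...   | true  = refl
...   | false = refl

nonvol : Graph (Fin n) → Sub n → ℕ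
nonvol G P = form (non G) (χ P) (χ P)

vol+nonvol : (G : Graph (Fin n)) → ∀ P → vol G P + nonvol G P + card P ≡ card P * card P
vol+nonvol {n} G P = begin
  vol G P + nonvol G P + card P
    ≡⟨ cong (vol G P + nonvol G P +_) δ-part ⟨
  vol G P + nonvol G P + form δ (χ P) (χ P)
    ≡⟨ cong (_+ form δ (χ P) (χ P)) (form-+ (λ u v → [ adj G u v ]ᵇ) (non G) (χ P) (χ P)) ⟨
  form (λ u v → [ adj G u v ]ᵇ + non G u v) (χ P) (χ P) + form δ (χ P) (χ P)
    ≡⟨ form-+ (λ u v → [ adj G u v ]ᵇ + non G u v) δ (χ P) (χ P) ⟨
  form (λ u v → [ adj G u v ]ᵇ + non G u v + δ u v) (χ P) (χ P)
    ≡⟨ form-sum _ (χ P) (χ P) ⟩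
  (sum λ u → sum λ v → χ P u * χ P v * ([ adj G u v ]ᵇ + non G u v + δ u v))
    ≡⟨ sum-cong-≗ (λ u → sum-cong-≗ λ v → trans (cong (χ P u * χ P v *_) (adj+non+δ G u v)) (*-identityʳ _)) ⟩
  sum (λ u → sum λ v → χ P u * χ P v)
    ≡⟨ sum-cong-≗ (λ u → *-distribˡ-sum (χ P u) (χ P)) ⟨
  sum (λ u → χ P u * card P)
    ≡⟨ *-distribʳ-sum (card P) (χ P) ⟨
  card P * card P ∎
  where
  open ≡-Reasoning
  δ-part : form δ (χ P) (χ P) ≡ card P
  δ-part = trans (form-sum δ (χ P) (χ P)) (sum-cong-≗ λ u → trans (sum-δ u (λ v → χ P u * χ P v)) (χ-idem (P u)))

module _ {n d : ℕ} (H : Graph (Fin n)) (reg : Regular d H) where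

  -- Both sides sum the degrees over P: every edge end in P belongs to an edge inside P or to one
  -- leaving it.
  vol+cut : ∀ P → vol H P + cut H P ≡ d * card P
  vol+cut P = begin
    vol H P + cut H P                             ≡⟨ form-+ʳ _ (χ P) (χ P) (χ (∁ P)) ⟨
    E H (χ P) (λ v → χ P v + χ (∁ P) v)
      ≡⟨ form-congʳ _ (χ P) (χ+χ∁ P) ⟩
    E H (χ P) (λ _ → 1)                           ≡⟨ E-ones H (χ P) ⟩
    sum (λ u → χ P u * degree H u)                ≡⟨ sum-cong-≗ (λ u → cong (χ P u *_) (reg u)) ⟩
    sum (λ u → χ P u * d)                         ≡⟨ *-distribʳ-sum d (χ P) ⟨
    card P * d                                    ≡⟨ *-comm (card P) d ⟩
    d * card P ∎
    where open ≡-Reasoning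

  -- Solved for the cut, this reads |P|(d + 1 - |P|) + `nonvol H P`; the square stays on the left to
  -- avoid truncated subtraction. Among sets of one size, cliques would have the least cut.
  cut+card² : ∀ P → cut H P + card P * card P ≡ suc d * card P + nonvol H P
  cut+card² P = begin
    cut H P + card P * card P                       ≡⟨ cong (cut H P +_) (vol+nonvol H P) ⟨
    cut H P + (vol H P + nonvol H P + card P)       ≡⟨ rearr (cut H P) (vol H P) _ _ ⟩
    (vol H P + cut H P) + card P + nonvol H P       ≡⟨ cong (λ x → x + card P + nonvol H P) (vol+cut P) ⟩
    d * card P + card P + nonvol H P                ≡⟨ cong (_+ nonvol H P) (+-comm (d * card P) (card P)) ⟩
    suc d * card P + nonvol H P ∎
    where
    open ≡-Reasoning
    rearr : ∀ c v m p → c + (v + m + p) ≡ (v + c) + p + m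
    rearr = solve-∀

-- Choosing a subset by successive deletions

_∖_ : Sub n → Fin n → Sub n
(X ∖ x) v = X v ∧ not (does (x ≟ v))

∖-⊆ : (X : Sub n) → ∀ x v → (X ∖ x) v ≡ true → X v ≡ true
∖-⊆ X x v with X v
... | true = λ _ → refl

χ-∖ : (X : Sub n) → ∀ x → X x ≡ true → ∀ v → χ X v ≡ χ (X ∖ x) v + δ x v
χ-∖ X x X∋x v with x ≟ v
... | yes refl rewrite X∋x = refl
... | no _ with X v
...   | true  = refl
...   | false = refl

module Prune {n} (G : Graph (Fin n)) (A : Sub n) where

  deg-A : Fin n → ℕ
  deg-A x = sum λ v → χ A v * [ adj G x v ]ᵇ

  D : Sub n → ℕ
  D X = E G (χ X) (χ A)

  D-∖ : ∀ X x → X x ≡ true → D X ≡ D (X ∖ x) + deg-A x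
  D-∖ X x X∋x = begin
    D X                                                    ≡⟨ form-congˡ _ (χ A) (χ-∖ X x X∋x) ⟩
    E G (λ v → χ (X ∖ x) v + δ x v) (χ A)                  ≡⟨ form-+ˡ _ (χ (X ∖ x)) (δ x) (χ A) ⟩
    D (X ∖ x) + E G (δ x) (χ A)                            ≡⟨ cong (D (X ∖ x) +_) (form-δ _ x (χ A)) ⟩
    D (X ∖ x) + deg-A x ∎
    where open ≡-Reasoning

  nondeg : Sub n → Fin n → ℕ
  nondeg X x = sum λ v → χ X v * non G x v

  nonvol-∖ : ∀ X x → X x ≡ true → nonvol G X ≡ nonvol G (X ∖ x) + 2 * nondeg X x
  nonvol-∖ X x X∋x = begin
    nonvol G X
      ≡⟨ form-cong {a = non G} (χ-∖ X x X∋x) (χ-∖ X x X∋x) ⟩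
    form (non G) (λ v → χ (X ∖ x) v + δ x v) (λ v → χ (X ∖ x) v + δ x v)
      ≡⟨ form-quad (non-sym G) (χ (X ∖ x)) (δ x) ⟩
    nonvol G (X ∖ x) + 2 * form (non G) (χ (X ∖ x)) (δ x) + form (non G) (δ x) (δ x)
      ≡⟨ cong₂ (λ p q → nonvol G (X ∖ x) + 2 * p + q) off diag ⟩
    nonvol G (X ∖ x) + 2 * nondeg X x + 0
      ≡⟨ +-identityʳ _ ⟩
    nonvol G (X ∖ x) + 2 * nondeg X x ∎
    where
    open ≡-Reasoning
    diag : form (non G) (δ x) (δ x) ≡ 0
    diag = trans (form-δ (non G) x (δ x))
      (trans (sum-cong-≗ λ v → *-comm (δ x v) (non G x v)) (trans (sum-δ x (non G x)) (non-irrefl G x)))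
    off : form (non G) (χ (X ∖ x)) (δ x) ≡ nondeg X x
    off = begin
      form (non G) (χ (X ∖ x)) (δ x)                                   ≡⟨ form-sym (non-sym G) (χ (X ∖ x)) (δ x) ⟩
      form (non G) (δ x) (χ (X ∖ x))                                   ≡⟨ +-identityʳ _ ⟨
      form (non G) (δ x) (χ (X ∖ x)) + 0                               ≡⟨ cong (form (non G) (δ x) (χ (X ∖ x)) +_) diag ⟨
      form (non G) (δ x) (χ (X ∖ x)) + form (non G) (δ x) (δ x)        ≡⟨ form-+ʳ (non G) (δ x) (χ (X ∖ x)) (δ x) ⟨
      form (non G) (δ x) (λ v → χ (X ∖ x) v + δ x v)                   ≡⟨ form-congʳ (non G) (δ x) (χ-∖ X x X∋x) ⟨
      form (non G) (δ x) (χ X)                                         ≡⟨ form-δ (non G) x (χ X) ⟩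
      nondeg X x ∎

  card-∖ : ∀ (X : Sub n) x → X x ≡ true → card X ≡ suc (card (X ∖ x))
  card-∖ X x X∋x = begin
    card X                                ≡⟨ sum-cong-≗ (χ-∖ X x X∋x) ⟩
    sum (λ v → χ (X ∖ x) v + δ x v)       ≡⟨ ∑-distrib-+ (χ (X ∖ x)) (δ x) ⟩
    card (X ∖ x) + sum (δ x)              ≡⟨ cong (card (X ∖ x) +_) (total-δ x) ⟩
    card (X ∖ x) + 1                      ≡⟨ +-comm _ 1 ⟩
    suc (card (X ∖ x)) ∎
    where open ≡-Reasoning

  sum-affine : ∀ (X : Sub n) c e (h : Fin n → ℕ) →
               sum (λ x → χ X x * (c + e * h x)) ≡ card X * c + e * sum (λ x → χ X x * h x)
  sum-affine X c e h = begin
    sum (λ x → χ X x * (c + e * h x))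
      ≡⟨ sum-cong-≗ (λ x → distr (χ X x) c e (h x)) ⟩
    sum (λ x → χ X x * c + e * (χ X x * h x))
      ≡⟨ ∑-distrib-+ (λ x → χ X x * c) (λ x → e * (χ X x * h x)) ⟩
    sum (λ x → χ X x * c) + sum (λ x → e * (χ X x * h x))
      ≡⟨ cong₂ _+_ (*-distribʳ-sum c (χ X)) (*-distribˡ-sum e (λ x → χ X x * h x)) ⟨
    card X * c + e * sum (λ x → χ X x * h x) ∎
    where
    open ≡-Reasoning
    distr : ∀ x c e h → x * (c + e * h) ≡ x * c + e * (x * h)
    distr = solve-∀

  -- Method of conditional expectations: averaged over x ∈ X,
  -- the two sides of the invariant for X ∖ x scale by the same factor.
  remove-one : ∀ β p X → card X ≡ 3 + p → β * nonvol G X < 2 * (2 + p) * D X →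
               ∃[ x ] X x ≡ true × β * nonvol G (X ∖ x) < 2 * (1 + p) * D (X ∖ x)
  remove-one β p X size lt =
    let x , lt′ = sum-<⇒∃< sums
        X∋x = χ-pos⇒true (factor-pos lt′)
    in x , X∋x , drop x X∋x (subst₂ _<_ (unit X∋x) (unit X∋x) lt′)
    where
    sumD : sum (λ x → χ X x * deg-A x) ≡ D X
    sumD = sym (form-rows (λ u v → [ adj G u v ]ᵇ) (χ X) (χ A))
    sumM : sum (λ x → χ X x * nondeg X x) ≡ nonvol G X
    sumM = sym (form-rows (non G) (χ X) (χ X))
    lhs : ∀ β p M D → (3 + p) * (β * M) + 2 * (1 + p) * D ≡ (1 + p) * (β * M) + (2 * β * M + 2 * (1 + p) * D)
    lhs = solve-∀
    rhs : ∀ β p M D → (3 + p) * (2 * (1 + p) * D) + 2 * β * M ≡ (1 + p) * (2 * (2 + p) * D) + (2 * β * M + 2 * (1 + p) * D)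
    rhs = solve-∀
    open ≤-Reasoning
    -- The inequality wanted after deleting x, summed over x in X, with the subtracted terms
    -- `deg-A x` and `nondeg X x` moved to the opposite sides.
    sums : sum (λ x → χ X x * (β * nonvol G X + 2 * (1 + p) * deg-A x)) <
           sum (λ x → χ X x * (2 * (1 + p) * D X + 2 * β * nondeg X x))
    sums = begin-strict
      sum (λ x → χ X x * (β * nonvol G X + 2 * (1 + p) * deg-A x))
        ≡⟨ sum-affine X (β * nonvol G X) (2 * (1 + p)) deg-A ⟩
      card X * (β * nonvol G X) + 2 * (1 + p) * sum (λ x → χ X x * deg-A x)
        ≡⟨ cong₂ (λ s t → s * (β * nonvol G X) + 2 * (1 + p) * t) size sumD ⟩
      (3 + p) * (β * nonvol G X) + 2 * (1 + p) * D X
        ≡⟨ lhs β p (nonvol G X) (D X) ⟩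
      (1 + p) * (β * nonvol G X) + (2 * β * nonvol G X + 2 * (1 + p) * D X)
        <⟨ +-monoˡ-< _ (*-monoʳ-< (1 + p) lt) ⟩
      (1 + p) * (2 * (2 + p) * D X) + (2 * β * nonvol G X + 2 * (1 + p) * D X)
        ≡⟨ rhs β p (nonvol G X) (D X) ⟨
      (3 + p) * (2 * (1 + p) * D X) + 2 * β * nonvol G X
        ≡⟨ cong₂ (λ s t → s * (2 * (1 + p) * D X) + 2 * β * t) size sumM ⟨
      card X * (2 * (1 + p) * D X) + 2 * β * sum (λ x → χ X x * nondeg X x)
        ≡⟨ sum-affine X (2 * (1 + p) * D X) (2 * β) (nondeg X) ⟨
      sum (λ x → χ X x * (2 * (1 + p) * D X + 2 * β * nondeg X x)) ∎
    factor-pos : ∀ {c e f} → c * e < c * f → 0 < c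
    factor-pos {suc c} _ = z<s
    unit : ∀ {b e} → b ≡ true → [ b ]ᵇ * e ≡ e
    unit refl = *-identityˡ _
    drop : ∀ x → X x ≡ true → β * nonvol G X + 2 * (1 + p) * deg-A x < 2 * (1 + p) * D X + 2 * β * nondeg X x →
           β * nonvol G (X ∖ x) < 2 * (1 + p) * D (X ∖ x)
    drop x X∋x lt′ = +-cancelʳ-< (2 * β * nondeg X x + 2 * (1 + p) * deg-A x) _ _ (begin-strict
      β * nonvol G (X ∖ x) + (2 * β * nondeg X x + 2 * (1 + p) * deg-A x)
        ≡⟨ lhs′ β p (nonvol G (X ∖ x)) (nondeg X x) (deg-A x) ⟩
      β * (nonvol G (X ∖ x) + 2 * nondeg X x) + 2 * (1 + p) * deg-A x
        ≡⟨ cong (λ z → β * z + 2 * (1 + p) * deg-A x) (nonvol-∖ X x X∋x) ⟨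
      β * nonvol G X + 2 * (1 + p) * deg-A x
        <⟨ lt′ ⟩
      2 * (1 + p) * D X + 2 * β * nondeg X x
        ≡⟨ cong (λ z → 2 * (1 + p) * z + 2 * β * nondeg X x) (D-∖ X x X∋x) ⟩
      2 * (1 + p) * (D (X ∖ x) + deg-A x) + 2 * β * nondeg X x
        ≡⟨ rhs′ β p (D (X ∖ x)) (nondeg X x) (deg-A x) ⟩
      2 * (1 + p) * D (X ∖ x) + (2 * β * nondeg X x + 2 * (1 + p) * deg-A x) ∎)
      where
      lhs′ : ∀ β p M ν δ → β * M + (2 * β * ν + 2 * (1 + p) * δ) ≡ β * (M + 2 * ν) + 2 * (1 + p) * δ
      lhs′ = solve-∀
      rhs′ : ∀ β p D ν δ → 2 * (1 + p) * (D + δ) + 2 * β * ν ≡ 2 * (1 + p) * D + (2 * β * ν + 2 * (1 + p) * δ)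
      rhs′ = solve-∀

  -- A random t-subset Y of a w-set X has expected `nonvol G Y` equal to t(t - 1)/(w(w - 1)) times
  -- that of X, and expected `D Y` equal to t/w times `D X`. With t = 2 + b, the hypothesis says
  -- that the conclusion holds on average. It is kept through p deletions, and at size t the factor
  -- t - 1 = 1 + b cancels.
  prune : ∀ b p X → card X ≡ 2 + (p + b) → (1 + b) * nonvol G X < 2 * (1 + (p + b)) * D X →
          ∃[ Y ] card Y ≡ 2 + b × (∀ v → Y v ≡ true → X v ≡ true) × nonvol G Y < 2 * D Y
  prune b zero X size lt = X , size , (λ _ → id) , *-cancelˡ-< (1 + b) _ _ (subst ((1 + b) * nonvol G X <_) (rearr b (D X)) lt)
    where
    rearr : ∀ b D → 2 * (1 + b) * D ≡ (1 + b) * (2 * D)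
    rearr = solve-∀
  prune b (suc p) X size lt =
    let x , X∋x , lt′ = remove-one (1 + b) (p + b) X size lt
        Y , sizeY , Y⊆ , ltY = prune b p (X ∖ x) (suc-injective (trans (sym (card-∖ X x X∋x)) size)) lt′
    in Y , sizeY , (λ v → ∖-⊆ X x v ∘ Y⊆ v) , ltY

_∪_ : Sub n → Sub n → Sub n
(P ∪ Q) v = P v ∨ Q v

χ-∪ : (P Q : Sub n) → (∀ v → Q v ≡ true → P v ≡ false) → ∀ v → χ (P ∪ Q) v ≡ χ P v + χ Q v
χ-∪ P Q disj v with P v in p | Q v in q
... | true  | true  = contradiction (trans (sym p) (disj v q)) λ ()
... | true  | false = refl
... | false | true  = refl
... | false | false = refl

card-∪ : (P Q : Sub n) → (∀ v → Q v ≡ true → P v ≡ false) → card (P ∪ Q) ≡ card P + card Q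
card-∪ P Q disj = trans (sum-cong-≗ (χ-∪ P Q disj)) (∑-distrib-+ (χ P) (χ Q))

vol-∪ : (G : Graph (Fin n)) → (P Q : Sub n) → (∀ v → Q v ≡ true → P v ≡ false) →
        vol G (P ∪ Q) ≡ vol G P + 2 * E G (χ P) (χ Q) + vol G Q
vol-∪ G P Q disj = trans (form-cong {a = λ u v → [ adj G u v ]ᵇ} (χ-∪ P Q disj) (χ-∪ P Q disj))
  (form-quad (adjᵇ-sym G) (χ P) (χ Q))

singleton : Fin n → Sub n
singleton x v = does (x ≟ v)

card-singleton : (x : Fin n) → card (singleton x) ≡ 1
card-singleton = total-δ

nonvol-singleton : (G : Graph (Fin n)) → ∀ x → nonvol G (singleton x) ≡ 0
nonvol-singleton G x = trans (form-δ (non G) x (δ x))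
  (trans (sum-cong-≗ λ v → *-comm (δ x v) (non G x v)) (trans (sum-δ x (non G x)) (non-irrefl G x)))

-- The starting inequality for `prune` on the complement of A: a = |A|, w is the size of the
-- complement, c their common cut, M the nonadjacent pairs in the complement, and 2 + b the target
-- size. If w ≤ d + 1, the first equation gives M ≤ c, which is enough since 1 + b ≤ w - 1.
prune-start : ∀ b p a d c M → let w = 2 + (p + b) in
  c + w * w ≡ suc d * w + M → suc d * a ≤ c + a * a → a + w ≤ 2 * d + 1 → 0 < c → 2 + b ≤ a →
  (1 + b) * M < 2 * (1 + (p + b)) * c
prune-start b p a d c M eq-w le-a sum≤ c>0 b≤a = [ small , large ]′ (≤-<-connex w (suc d))
  where
  w = 2 + (p + b)
  open ≤-Reasoning
  M≤c⇒ : M ≤ c → (1 + b) * M < 2 * (1 + (p + b)) * c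
  M≤c⇒ M≤c = begin-strict
    (1 + b) * M                                     ≤⟨ *-monoʳ-≤ (1 + b) M≤c ⟩
    (1 + b) * c                                     ≤⟨ *-monoˡ-≤ c (s≤s (m≤n+m b p)) ⟩
    (1 + (p + b)) * c                               <⟨ m<m+n _ (*-mono-≤ {1} {1 + (p + b)} (s≤s z≤n) c>0) ⟩
    (1 + (p + b)) * c + (1 + (p + b)) * c           ≡⟨ double (1 + (p + b)) c ⟩
    2 * (1 + (p + b)) * c ∎
    where
    double : ∀ x c → x * c + x * c ≡ 2 * x * c
    double = solve-∀
  small : w ≤ suc d → (1 + b) * M < 2 * (1 + (p + b)) * c
  small w≤ = M≤c⇒ (+-cancelʳ-≤ (suc d * w) M c (begin
    M + suc d * w ≡⟨ +-comm M _ ⟩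
    suc d * w + M ≡⟨ eq-w ⟨
    c + w * w     ≤⟨ +-monoʳ-≤ c (*-monoˡ-≤ w w≤) ⟩
    c + suc d * w ∎))
  -- With w = d + 2 + m the equation gives M = c + w(1 + m). The excess is paid for by c ≥ a(2 + m),
  -- which follows from a + w ≤ 2d + 1; the gap between 1 + m and 2 + m supplies strictness.
  large : suc d < w → (1 + b) * M < 2 * (1 + (p + b)) * c
  large d<w = from-m (m≤n⇒∃[o]m+o≡n d<w)
    where
    from-m : ∃[ m ] 2 + d + m ≡ w → (1 + b) * M < 2 * (1 + (p + b)) * c
    from-m (m , d+m≡w) = begin-strict
      (1 + b) * M
        ≡⟨ cong ((1 + b) *_) M≡ ⟩
      (1 + b) * (c + w * (1 + m))
        ≡⟨ split (1 + b) c w m ⟩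
      (1 + b) * c + (1 + b) * w * (1 + m)
        ≤⟨ +-mono-≤ (*-monoˡ-≤ c (s≤s (m≤n+m b p))) (*-monoˡ-≤ (1 + m) bw≤) ⟩
      (1 + (p + b)) * c + (1 + (p + b)) * a * (1 + m)
        <⟨ +-monoʳ-< ((1 + (p + b)) * c) (*-monoʳ-< ((1 + (p + b)) * a) {{>-nonZero (*-mono-≤ {1} {1 + (p + b)} (s≤s z≤n) a>0)}} ≤-refl) ⟩
      (1 + (p + b)) * c + (1 + (p + b)) * a * (2 + m)
        ≡⟨ cong ((1 + (p + b)) * c +_) (*-assoc (1 + (p + b)) a (2 + m)) ⟩
      (1 + (p + b)) * c + (1 + (p + b)) * (a * (2 + m))
        ≤⟨ +-monoʳ-≤ ((1 + (p + b)) * c) (*-monoʳ-≤ (1 + (p + b)) c≥) ⟩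
      (1 + (p + b)) * c + (1 + (p + b)) * c
        ≡⟨ double (1 + (p + b)) c ⟩
      2 * (1 + (p + b)) * c ∎
      where
      double : ∀ x c → x * c + x * c ≡ 2 * x * c
      double = solve-∀
      split : ∀ β c w m → β * (c + w * (1 + m)) ≡ β * c + β * w * (1 + m)
      split = solve-∀
      a>0 : 0 < a
      a>0 = ≤-trans (s≤s z≤n) b≤a
      M≡ : M ≡ c + w * (1 + m)
      M≡ = +-cancelˡ-≡ (suc d * w) _ _ (begin-equality
        suc d * w + M                       ≡⟨ eq-w ⟨
        c + w * w                           ≡⟨ cong (λ x → c + x * w) (sym d+m≡w) ⟩
        c + (2 + d + m) * w                 ≡⟨ expand d m c w ⟩
        suc d * w + (c + w * (1 + m)) ∎)
        where
        expand : ∀ d m c w → c + (2 + d + m) * w ≡ suc d * w + (c + w * (1 + m))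
        expand = solve-∀
      -- For target size t = 2 + b this is (t - 1)w ≤ (w - 1)t ≤ (w - 1)a, where the first
      -- inequality is t ≤ w in disguise.
      bw≤ : (1 + b) * w ≤ (1 + (p + b)) * a
      bw≤ = begin
        (1 + b) * w                     ≤⟨ m≤m+n _ p ⟩
        (1 + b) * (2 + (p + b)) + p     ≡⟨ expand b p ⟩
        (1 + (p + b)) * (2 + b)         ≤⟨ *-monoʳ-≤ (1 + (p + b)) b≤a ⟩
        (1 + (p + b)) * a ∎
        where
        expand : ∀ b p → (1 + b) * (2 + (p + b)) + p ≡ (1 + (p + b)) * (2 + b)
        expand = solve-∀
      a+m<d : a + m + 1 ≤ d
      a+m<d = +-cancelʳ-≤ (suc d) _ _ (begin
        a + m + 1 + suc d     ≡⟨ expand a m d ⟩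
        a + (2 + d + m)       ≡⟨ cong (a +_) d+m≡w ⟩
        a + w                 ≤⟨ sum≤ ⟩
        2 * d + 1             ≡⟨ expand′ d ⟩
        d + suc d ∎)
        where
        expand : ∀ a m d → a + m + 1 + suc d ≡ a + (2 + d + m)
        expand = solve-∀
        expand′ : ∀ d → 2 * d + 1 ≡ d + suc d
        expand′ = solve-∀
      c≥ : a * (2 + m) ≤ c
      c≥ = +-cancelʳ-≤ (a * a) _ _ (begin
        a * (2 + m) + a * a   ≡⟨ expand a m ⟩
        suc (a + m + 1) * a   ≤⟨ *-monoˡ-≤ a (s≤s a+m<d) ⟩
        suc d * a             ≤⟨ le-a ⟩
        c + a * a ∎)
        where
        expand : ∀ a m → a * (2 + m) + a * a ≡ suc (a + m + 1) * a
        expand = solve-∀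

-- Strict subadditivity of cuts

module Cuts {n d : ℕ} (H : Graph (Fin n)) (reg : Regular d H) (n≤ : n ≤ 2 * d + 1) where

  cut≥ : ∀ P → suc d * card P ≤ cut H P + card P * card P
  cut≥ P = ≤-trans (m≤m+n _ _) (≤-reflexive (sym (cut+card² H reg P)))

  -- Either P or its complement has at most d vertices, and a nonempty set Q of that size has cut at
  -- least |Q|(d + 1 - |Q|). In other words, H is connected.
  cut-pos : ∀ P → 0 < card P → card P < n → 0 < cut H P
  cut-pos P p>0 p<n = [ direct P p>0 , (λ d<p → subst (0 <_) (cut-∁ H P) (direct (∁ P) q>0 (q≤d d<p))) ]′ (≤-<-connex (card P) d)
    where
    direct : ∀ Q → 0 < card Q → card Q ≤ d → 0 < cut H Q
    direct Q q>0 q≤d = +-cancelʳ-< (card Q * card Q) _ _ (begin-strict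
      card Q * card Q            <⟨ *-monoˡ-< (card Q) {{>-nonZero q>0}} (s≤s q≤d) ⟩
      suc d * card Q             ≤⟨ cut≥ Q ⟩
      cut H Q + card Q * card Q ∎)
      where open ≤-Reasoning
    q>0 : 0 < card (∁ P)
    q>0 = +-cancelˡ-< (card P) _ _ (subst₂ _<_ (sym (+-identityʳ _)) (sym (card+card∁ P)) p<n)
    q≤d : d < card P → card (∁ P) ≤ d
    q≤d d<p = +-cancelˡ-≤ (suc d) _ _ (begin
      suc d + card (∁ P)     ≤⟨ +-monoˡ-≤ (card (∁ P)) d<p ⟩
      card P + card (∁ P)    ≡⟨ card+card∁ P ⟩
      n                      ≤⟨ n≤ ⟩
      2 * d + 1              ≡⟨ expand d ⟩
      suc d + d ∎)
      where
      open ≤-Reasoning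
      expand : ∀ d → 2 * d + 1 ≡ suc d + d
      expand = solve-∀

  -- A single vertex spans no nonadjacent pair, so for b = 1 any vertex outside A with a neighbour
  -- in A will do. From two vertices on, X is cut down from the whole complement of A, whose edges
  -- to A are exactly the cut of A.
  grow : ∀ A b → 0 < b → b ≤ card A → card A + b ≤ n →
         ∃[ X ] card X ≡ b × (∀ v → X v ≡ true → A v ≡ false) × nonvol H X < 2 * E H (χ A) (χ X)
  grow A b b>0 b≤a a+b≤n = by-size b refl
    where
    open Prune H A
    a>0 : 0 < card A
    a>0 = ≤-trans b>0 b≤a
    cutA>0 : 0 < cut H A
    cutA>0 = cut-pos A a>0 (≤-trans (m<m+n (card A) b>0) a+b≤n)
    DW≡cut : D (∁ A) ≡ cut H A
    DW≡cut = form-sym (adjᵇ-sym H) (χ (∁ A)) (χ A)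
    ∁⇒false : ∀ {x} → not x ≡ true → x ≡ false
    ∁⇒false {false} _ = refl
    *-pos : ∀ {x y} → 0 < x * y → 0 < x × 0 < y
    *-pos {suc x} {suc y} _ = z<s , z<s
    *-pos {suc x} {zero} p = contradiction (subst (0 <_) (*-zeroʳ x) p) λ ()
    by-size : ∀ b′ → b ≡ b′ → ∃[ X ] card X ≡ b × (∀ v → X v ≡ true → A v ≡ false) × nonvol H X < 2 * E H (χ A) (χ X)
    by-size zero          eq = contradiction (subst (0 <_) eq b>0) λ ()
    by-size (suc zero)    eq =
      let x , p = sum-pos⇒∃ (subst (0 <_) (trans (sym DW≡cut) (form-rows _ (χ (∁ A)) (χ A))) cutA>0)
          x∉A , deg>0 = *-pos p
      in singleton x , trans (card-singleton x) (sym eq)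
         , (λ v x≡v → trans (cong A (sym (does-≟ x v x≡v))) (∁⇒false (χ-pos⇒true x∉A)))
         , subst₂ _<_ (sym (nonvol-singleton H x))
             (cong (2 *_) (sym (trans (form-sym (adjᵇ-sym H) (χ A) (δ x)) (form-δ _ x (χ A)))))
             (*-mono-≤ {1} {2} (s≤s z≤n) deg>0)
      where
      does-≟ : ∀ (x v : Fin n) → does (x ≟ v) ≡ true → x ≡ v
      does-≟ x v eq with x ≟ v
      ... | yes p = p
    by-size (suc (suc b′)) eq =
      let Y , sizeY , Y⊆ , lt = prune b′ p (∁ A) cardW start
      in Y , trans sizeY (sym eq) , (λ v → ∁⇒false ∘ Y⊆ v)
         , subst (nonvol H Y <_) (cong (2 *_) (form-sym (adjᵇ-sym H) (χ Y) (χ A))) lt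
      where
      2+b≤w : 2 + b′ ≤ card (∁ A)
      2+b≤w = +-cancelˡ-≤ (card A) _ _ (subst₂ _≤_ (cong (card A +_) eq) (sym (card+card∁ A)) a+b≤n)
      p : ℕ
      p = card (∁ A) ∸ (2 + b′)
      cardW : card (∁ A) ≡ 2 + (p + b′)
      cardW = trans (sym (m∸n+n≡m 2+b≤w)) (shift p b′)
        where
        shift : ∀ p b → p + (2 + b) ≡ 2 + (p + b)
        shift = solve-∀
      start : (1 + b′) * nonvol H (∁ A) < 2 * (1 + (p + b′)) * D (∁ A)
      start = subst (λ c → (1 + b′) * nonvol H (∁ A) < 2 * (1 + (p + b′)) * c) (sym DW≡cut)
        (prune-start b′ p (card A) d (cut H A) (nonvol H (∁ A))
          (subst (λ w → cut H A + w * w ≡ suc d * w + nonvol H (∁ A)) cardW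
            (subst (λ c → c + card (∁ A) * card (∁ A) ≡ suc d * card (∁ A) + nonvol H (∁ A)) (cut-∁ H A) (cut+card² H reg (∁ A))))
          (cut≥ A)
          (≤-trans (≤-reflexive (trans (cong (card A +_) (sym cardW)) (card+card∁ A))) n≤)
          cutA>0
          (subst (_≤ card A) eq b≤a))

  -- The cut of the union is cut(A) + cut(X) - 2e(A,X). Since X and B have equal size, cut(X)
  -- exceeds cut(B) by at most `nonvol H X`, which is less than 2e(A,X).
  cut-∪-< : ∀ A X B → card X ≡ card B → (∀ v → X v ≡ true → A v ≡ false) →
            nonvol H X < 2 * E H (χ A) (χ X) → cut H (A ∪ X) < cut H A + cut H B
  cut-∪-< A X B sizes disj lt =
    arith (vol H A) (vol H X) (card A) (card X) (cut H (A ∪ X)) (E H (χ A) (χ X)) (cut H A) (cut H B) (nonvol H X)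
      (trans (cong (_+ cut H (A ∪ X)) (sym (vol-∪ H A X disj))) (trans (vol+cut H reg (A ∪ X)) (cong (d *_) (card-∪ A X disj))))
      (vol+cut H reg A) (vol+nonvol H X) (subst (λ b → suc d * b ≤ cut H B + b * b) (sym sizes) (cut≥ B)) lt
    where
    arith : ∀ vA vX a b u D cA cB M → vA + 2 * D + vX + u ≡ d * (a + b) → vA + cA ≡ d * a →
            vX + M + b ≡ b * b → suc d * b ≤ cB + b * b → M < 2 * D → u < cA + cB
    arith vA vX a b u D cA cB M e∪ eA eX eB lt = +-cancelʳ-< (vA + 2 * D + b * b) _ _ (begin-strict
      u + (vA + 2 * D + b * b)                  ≡⟨ cong (λ x → u + (vA + 2 * D + x)) eX ⟨
      u + (vA + 2 * D + (vX + M + b))           ≡⟨ r1 u vA D vX M b ⟩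
      (vA + 2 * D + vX + u) + M + b             ≡⟨ cong (λ x → x + M + b) e∪ ⟩
      d * (a + b) + M + b                       ≡⟨ r2 d a b M ⟩
      d * a + suc d * b + M                     ≡⟨ cong (λ x → x + suc d * b + M) eA ⟨
      vA + cA + suc d * b + M                   <⟨ +-mono-≤-< (+-monoʳ-≤ (vA + cA) eB) lt ⟩
      vA + cA + (cB + b * b) + 2 * D            ≡⟨ r3 vA cA cB b D ⟩
      cA + cB + (vA + 2 * D + b * b) ∎)
      where
      open ≤-Reasoning
      r1 : ∀ u vA D vX M b → u + (vA + 2 * D + (vX + M + b)) ≡ (vA + 2 * D + vX + u) + M + b
      r1 = solve-∀
      r2 : ∀ d a b M → d * (a + b) + M + b ≡ d * a + suc d * b + M
      r2 = solve-∀
      r3 : ∀ vA cA cB b D → vA + cA + (cB + b * b) + 2 * D ≡ cA + cB + (vA + 2 * D + b * b)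
      r3 = solve-∀

  cut-subadditive : ∀ A B → 0 < card A → 0 < card B → card A + card B ≤ n →
                    ∃[ C ] card C ≡ card A + card B × cut H C < cut H A + cut H B
  cut-subadditive A B a>0 b>0 a+b≤n = [ (λ b≤a → core A B b>0 b≤a a+b≤n) , swapped ]′ (≤-total (card B) (card A))
    where
    core : ∀ A B → 0 < card B → card B ≤ card A → card A + card B ≤ n →
           ∃[ C ] card C ≡ card A + card B × cut H C < cut H A + cut H B
    core A B b>0 b≤a a+b≤n =
      let X , size , disj , lt = grow A (card B) b>0 b≤a a+b≤n
      in A ∪ X , trans (card-∪ A X disj) (cong (card A +_) size) , cut-∪-< A X B size disj lt
    swapped : card A ≤ card B → ∃[ C ] card C ≡ card A + card B × cut H C < cut H A + cut H B
    swapped a≤b =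
      let C , size , lt = core B A a>0 a≤b (subst (_≤ n) (+-comm (card A) (card B)) a+b≤n)
      in C , trans size (+-comm (card B) (card A)) , subst (cut H C <_) (+-comm (cut H B) (cut H A)) lt

  -- The number `s` is a guaranteed gain: 1 records strict subadditivity, 0 the weak form. Sizes
  -- matter only modulo n.
  Combined : ℕ → Sub n → Sub n → Set
  Combined s A B = ∃[ C ] card C < n × (∃[ j ] card A + card B ≡ j * n + card C) × s + cut H C ≤ cut H A + cut H B

  -- If the sizes add up to n or more, the complements are combined instead: their sizes add up to
  -- at most n, and complementation preserves cuts.
  combine-< : ∀ A B → 0 < card A → card A < n → 0 < card B → card B < n → Combined 1 A B
  combine-< A B a>0 a<n b>0 b<n = [ wrap , direct ]′ (≤-<-connex n (card A + card B))
    where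
    direct : card A + card B < n → Combined 1 A B
    direct a+b<n =
      let C , size , lt = cut-subadditive A B a>0 b>0 (<⇒≤ a+b<n)
      in C , subst (_< n) (sym size) a+b<n , (0 , sym size) , lt
    ∁-pos : ∀ P → card P < n → 0 < card (∁ P)
    ∁-pos P p<n = +-cancelˡ-< (card P) _ _ (subst₂ _<_ (sym (+-identityʳ _)) (sym (card+card∁ P)) p<n)
    wrap : n ≤ card A + card B → Combined 1 A B
    wrap n≤a+b =
      let C , size , lt = cut-subadditive (∁ A) (∁ B) (∁-pos A a<n) (∁-pos B b<n) ∁≤n
          n+C = total C size
      in ∁ C , +-cancelˡ-< n _ _ (subst (_< n + n) n+C (+-mono-< a<n b<n)) , (1 , trans n+C (cong (_+ card (∁ C)) (sym (+-identityʳ n))))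
         , subst₂ (λ x y → 1 + x ≤ y) (sym (cut-∁ H C)) (cong₂ _+_ (cut-∁ H A) (cut-∁ H B)) lt
      where
      exchange : ∀ a b x y → (a + b) + (x + y) ≡ (a + x) + (b + y)
      exchange = solve-∀
      sum≡ : (card A + card B) + (card (∁ A) + card (∁ B)) ≡ n + n
      sum≡ = trans (exchange (card A) (card B) _ _) (cong₂ _+_ (card+card∁ A) (card+card∁ B))
      ∁≤n : card (∁ A) + card (∁ B) ≤ n
      ∁≤n = +-cancelˡ-≤ n _ _ (≤-trans (+-monoˡ-≤ _ n≤a+b) (≤-reflexive sum≡))
      total : ∀ C → card C ≡ card (∁ A) + card (∁ B) → card A + card B ≡ n + card (∁ C)
      total C size = +-cancelʳ-≡ (card C) _ _ (trans (trans (cong (card A + card B +_) size) sum≡)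
        (trans (cong (n +_) (trans (sym (card+card∁ C)) (+-comm (card C) _))) (sym (+-assoc n _ _))))

  -- An empty or full set changes the total size by a multiple of n, so the other set can serve as
  -- C; no strict gain is available in these cases.
  combine : ∀ A B → card A < n → Combined 0 A B
  combine A B a<n = go (card A ≟ᴺ 0) (card B ≟ᴺ 0) (m≤n⇒m<n∨m≡n (card≤ B))
    where
    _≟ᴺ_ = ℕ._≟_
    go : Dec (card A ≡ 0) → Dec (card B ≡ 0) → card B < n ⊎ card B ≡ n → Combined 0 A B
    go (yes a≡0) _ (inj₁ b<n) = B , b<n , (0 , cong (_+ card B) a≡0) , m≤n+m _ _
    go _ (yes b≡0) _ = A , a<n , (0 , trans (cong (card A +_) b≡0) (+-identityʳ _)) , m≤m+n _ _
    go _ _ (inj₂ b≡n) = A , a<n , (1 , trans (+-comm (card A) (card B)) (cong (_+ card A) (trans b≡n (sym (+-identityʳ n))))) , m≤m+n _ _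
    go (no a≢0) (no b≢0) (inj₁ b<n) =
      let C , lt , eq , le = combine-< A B (n≢0⇒n>0 a≢0) a<n (n≢0⇒n>0 b≢0) b<n
      in C , lt , eq , ≤-trans (n≤1+n _) le

-- Adding one copy of H to a covered set

full : Sub n
full _ = true

card-full : card {n} full ≡ n
card-full {n} = sum-ones n

vol-full : (G : Graph (Fin n)) → ∀ U → card U ≡ n → vol G U ≡ vol G full
vol-full G U eq = form-cong {a = λ u v → [ adj G u v ]ᵇ} one one
  where
  one : ∀ v → χ U v ≡ 1
  one v = true⇒χ (card≡n⇒true {P = U} eq v)

insert : Sub N → (Fin n → Fin N) → Sub N
insert U φ v = U v ∨ does (image? φ v)

fresh : Sub N → (Fin n → Fin N) → Sub n
fresh U φ i = not (U (φ i))

insert-old : (U : Sub N) (φ : Fin n → Fin N) → ∀ {v} → U v ≡ true → insert U φ v ≡ true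
insert-old U φ Uv rewrite Uv = refl

insert-new : (U : Sub N) (φ : Fin n → Fin N) → ∀ i → insert U φ (φ i) ≡ true
insert-new U φ i with U (φ i)
... | true  = refl
... | false = dec-true (image? φ (φ i)) (i , refl)

insert-inv : (U : Sub N) (φ : Fin n → Fin N) → ∀ {v} → insert U φ v ≡ true → U v ≡ true ⊎ ∃[ i ] φ i ≡ v
insert-inv U φ {v} p with U v
... | true  = inj₁ refl
... | false with image? φ v
...   | yes im = inj₂ im

χ-insert : (U : Sub N) {φ : Fin n → Fin N} → Inj φ → ∀ v → χ (insert U φ) v ≡ χ U v + push φ (χ (fresh U φ)) v
χ-insert U {φ} inj v = by-cases (image? φ v)
  where
  old : ∀ b → [ b ∨ true ]ᵇ ≡ [ b ]ᵇ + [ not b ]ᵇ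
  old true  = refl
  old false = refl
  unchanged : ∀ b → [ b ∨ false ]ᵇ ≡ [ b ]ᵇ + 0
  unchanged true  = refl
  unchanged false = refl
  by-cases : (d : Dec (∃[ i ] φ i ≡ v)) → [ U v ∨ does d ]ᵇ ≡ χ U v + push φ (χ (fresh U φ)) v
  by-cases (yes (i , refl)) = trans (old (U (φ i))) (cong (χ U (φ i) +_) (sym (push-image inj (χ (fresh U φ)) i)))
  by-cases (no v∉) = trans (unchanged (U v)) (cong (χ U v +_) (sym (push-∉ φ (χ (fresh U φ)) λ i eq → v∉ (i , eq))))

card-insert : (U : Sub N) {φ : Fin n → Fin N} → Inj φ → card (insert U φ) ≡ card U + card (fresh U φ)
card-insert U {φ} inj = begin
  card (insert U φ)                                        ≡⟨ sum-cong-≗ (χ-insert U inj) ⟩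
  sum (λ v → χ U v + push φ (χ (fresh U φ)) v)             ≡⟨ ∑-distrib-+ (χ U) (push φ (χ (fresh U φ))) ⟩
  card U + sum (push φ (χ (fresh U φ)))                    ≡⟨ cong (card U +_) (sum-cong-≗ λ v → sym (*-identityʳ (push φ (χ (fresh U φ)) v))) ⟩
  card U + sum (λ v → push φ (χ (fresh U φ)) v * 1)        ≡⟨ cong (card U +_) (sum-push φ (χ (fresh U φ)) (λ _ → 1)) ⟩
  card U + sum (λ i → χ (fresh U φ) i * 1)                 ≡⟨ cong (card U +_) (sum-cong-≗ λ i → *-identityʳ (χ (fresh U φ) i)) ⟩
  card U + card (fresh U φ) ∎
  where open ≡-Reasoning

bool-mono : ∀ {a b : Bool} → (a ≡ true → b ≡ true) → [ a ]ᵇ ≤ [ b ]ᵇ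
bool-mono {true}  f = ≤-reflexive (sym (true⇒χ (f refl)))
bool-mono {false} f = z≤n

module Insert {d : ℕ} (H : Graph (Fin n)) (reg : Regular d H) (G : Graph (Fin N)) (U : Sub N)
              (φ : Fin n → Fin N) (inj : Inj φ) (hom : ∀ i j → adj H i j ≡ true → adj G (φ i) (φ j) ≡ true) where

  K : Sub n
  K = fresh U φ

  new : Fin N → ℕ
  new = push φ (χ K)

  adj≤ : ∀ i j → [ adj H i j ]ᵇ ≤ [ adj G (φ i) (φ j) ]ᵇ
  adj≤ i j = bool-mono (hom i j)

  inner : vol H K ≤ E G new new
  inner = ≤-trans (form-mono adj≤ (χ K) (χ K)) (≤-reflexive (sym (trans (form-pushˡ _ φ (χ K) new) (form-pushʳ _ φ (χ K) (χ K)))))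

  inner-< : ∀ {i j} → K i ≡ true → K j ≡ true → adj G (φ i) (φ j) ≡ true → adj H i j ≡ false → vol H K < E G new new
  inner-< {i} {j} Ki Kj Gij Hij = ≤-trans
    (form-mono-< adj≤ (χ K) (χ K) i j (true⇒χ Ki) (true⇒χ Kj) (subst₂ _<_ (sym (false⇒χ Hij)) (sym (true⇒χ Gij)) ≤-refl))
    (≤-reflexive (sym (trans (form-pushˡ _ φ (χ K) new) (form-pushʳ _ φ (χ K) (χ K)))))

  private
    into : Fin n → Fin N → ℕ
    into j u = χ U u * [ adj G (φ j) u ]ᵇ

    old-row : Fin n → ℕ
    old-row j = sum λ i → χ (∁ K) i * [ adj H j i ]ᵇ

    cross≡ : E G (χ U) new ≡ sum λ j → χ K j * sum (into j)
    cross≡ = trans (form-sym (adjᵇ-sym G) (χ U) new) (trans (form-pushˡ _ φ (χ K) (χ U)) (form-rows _ (χ K) (χ U)))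

    cut≡ : cut H K ≡ sum λ j → χ K j * old-row j
    cut≡ = form-rows _ (χ K) (χ (∁ K))

    old-part : ∀ j → old-row j ≤ sum λ i → into j (φ i)
    old-part j = sum-mono λ i → *-mono-≤ (≤-reflexive (cong [_]ᵇ (not-involutive (U (φ i))))) (adj≤ j i)

    rows≤ : ∀ j → old-row j ≤ sum (into j)
    rows≤ j = ≤-trans (old-part j) (sum-inj inj (into j))

  -- Vertices of H outside K are mapped into U, so each edge of H leaving K becomes an edge of G
  -- between U and the new vertices.
  cross : cut H K ≤ E G (χ U) new
  cross = subst₂ _≤_ (sym cut≡) (sym cross≡) (sum-mono λ j → *-monoʳ-≤ (χ K j) (rows≤ j))

  -- As x is not in the image of the copy, the edge to x is not among those that account for
  -- `cut H K`.
  cross-< : ∀ {x j} → U x ≡ true → (∀ i → φ i ≢ x) → K j ≡ true → adj G (φ j) x ≡ true → cut H K < E G (χ U) new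
  cross-< {x} {j} Ux x∉ Kj Gjx = subst₂ _<_ (sym cut≡) (sym cross≡)
    (sum-mono-< (λ j → *-monoʳ-≤ (χ K j) (rows≤ j)) j
      (subst (λ c → c * old-row j < c * sum (into j)) (sym (true⇒χ Kj)) (+-monoˡ-< 0 row<)))
    where
    open ≤-Reasoning
    row< : old-row j < sum (into j)
    row< = begin-strict
      old-row j    ≤⟨ old-part j ⟩
      sum (λ i → into j (φ i))                  <⟨ ≤-refl ⟩
      1 + sum (λ i → into j (φ i))              ≡⟨ cong (_+ sum (λ i → into j (φ i))) (cong₂ _*_ (true⇒χ Ux) (true⇒χ Gjx)) ⟨
      into j x + sum (λ i → into j (φ i))       ≤⟨ sum-inj-extra inj (into j) x∉ ⟩
      sum (into j) ∎

  -- The new volume is the old one plus twice the edges from U to the new vertices plus the volume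
  -- of the new part. The last two are at least 2cut(K) + vol(K) = d|K| + cut(K). Here `e` is the
  -- extra gain of this step, `s` the gain so far and `c` the cut already accounted for.
  vol-insert : ∀ e {s c} → e + (cut H K + (cut H K + vol H K)) ≤ E G (χ U) new + (E G (χ U) new + E G new new) →
               s + d * card U + c ≤ vol G U →
               e + s + d * card (insert U φ) + (c + cut H K) ≤ vol G (insert U φ)
  vol-insert e {s} {c} gain old = begin
    e + s + d * card (insert U φ) + (c + cut H K)
      ≡⟨ cong (λ x → e + s + d * x + (c + cut H K)) (card-insert U inj) ⟩
    e + s + d * (card U + card K) + (c + cut H K)
      ≡⟨ r1 e s d (card U) (card K) c (cut H K) ⟩
    (s + d * card U + c) + (e + (cut H K + d * card K))
      ≡⟨ cong (λ x → (s + d * card U + c) + (e + (cut H K + x))) (trans (+-comm (cut H K) _) (vol+cut H reg K)) ⟨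
    (s + d * card U + c) + (e + (cut H K + (cut H K + vol H K)))
      ≤⟨ +-mono-≤ old gain ⟩
    vol G U + (E G (χ U) new + (E G (χ U) new + E G new new))
      ≡⟨ r2 (vol G U) (E G (χ U) new) _ ⟩
    vol G U + 2 * E G (χ U) new + E G new new
      ≡⟨ form-quad (adjᵇ-sym G) (χ U) new ⟨
    E G (λ v → χ U v + new v) (λ v → χ U v + new v)
      ≡⟨ form-cong {a = λ u v → [ adj G u v ]ᵇ} (χ-insert U inj) (χ-insert U inj) ⟨
    vol G (insert U φ) ∎
    where
    open ≤-Reasoning
    r1 : ∀ e s d u k c x → e + s + d * (u + k) + (c + x) ≡ (s + d * u + c) + (e + (x + d * k))
    r1 = solve-∀
    r2 : ∀ v x y → v + (x + (x + y)) ≡ v + 2 * x + y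
    r2 = solve-∀

  vol-insert-≤ : ∀ {s c} → s + d * card U + c ≤ vol G U → s + d * card (insert U φ) + (c + cut H K) ≤ vol G (insert U φ)
  vol-insert-≤ {s} {c} = vol-insert 0 {s} {c} (+-mono-≤ cross (+-mono-≤ cross inner))

  vol-insert-inner : ∀ {s c i j} → K i ≡ true → K j ≡ true → adj G (φ i) (φ j) ≡ true → adj H i j ≡ false →
                     s + d * card U + c ≤ vol G U → 1 + s + d * card (insert U φ) + (c + cut H K) ≤ vol G (insert U φ)
  vol-insert-inner {s} {c} Ki Kj Gij Hij = vol-insert 1 {s} {c}
    (≤-trans (≤-reflexive (shift (cut H K) (vol H K))) (+-mono-≤ cross (+-mono-≤ cross (inner-< Ki Kj Gij Hij))))
    where
    shift : ∀ c v → 1 + (c + (c + v)) ≡ c + (c + (1 + v))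
    shift = solve-∀

  vol-insert-cross : ∀ {s c x j} → U x ≡ true → (∀ i → φ i ≢ x) → K j ≡ true → adj G (φ j) x ≡ true →
                     s + d * card U + c ≤ vol G U → 1 + s + d * card (insert U φ) + (c + cut H K) ≤ vol G (insert U φ)
  vol-insert-cross {s} {c} Ux x∉ Kj Gjx = vol-insert 1 {s} {c} (+-mono-≤ (cross-< Ux x∉ Kj Gjx) (+-mono-≤ cross inner))

-- Greedy covering and the lower bound on the degree sum

div-unique : ∀ {n} j q {c r} → c < n → r < n → j * n + c ≡ q * n + r → j ≡ q × c ≡ r
div-unique zero    zero    c<n r<n eq = refl , eq
div-unique {n} zero    (suc q) {r = r} c<n r<n eq = contradiction (subst (n ≤_) (sym eq) (≤-trans (m≤m+n n (q * n)) (m≤m+n _ r))) (<⇒≱ c<n)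
div-unique {n} (suc j) zero {c}   c<n r<n eq = contradiction (subst (n ≤_) eq (≤-trans (m≤m+n n (j * n)) (m≤m+n _ c))) (<⇒≱ r<n)
div-unique {n} (suc j) (suc q) {c} {r} c<n r<n eq =
  let j≡q , c≡r = div-unique j q c<n r<n (+-cancelˡ-≡ n _ _ (trans (sym (+-assoc n (j * n) c)) (trans eq (+-assoc n (q * n) r))))
  in cong suc j≡q , c≡r

record Copy (H : Graph (Fin n)) (G : Graph (Fin N)) : Set where
  field
    at  : Fin n → Fin N
    inj : Inj at
    hom : ∀ i j → adj H i j ≡ true → adj G (at i) (at j) ≡ true

open Copy

copy : {H : Graph (Fin n)} {G : Graph (Fin N)} → Covered H G → Fin N → Copy H G
copy cov v = let φ , _ = cov v in record
  { at  = Injection.to (_↪_.embed φ)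
  ; inj = Injection.injective (_↪_.embed φ)
  ; hom = _↪_.edge-map φ }

copy-∋ : {H : Graph (Fin n)} {G : Graph (Fin N)} (cov : Covered H G) → ∀ v → ∃[ i ] at (copy cov v) i ≡ v
copy-∋ cov v = proj₂ (cov v)

degree≥ : ∀ {d} (H : Graph (Fin n)) → Regular d H → {G : Graph (Fin N)} → Covered H G → ∀ v → d ≤ degree G v
degree≥ {d = d} H reg {G} cov v = at-copy (copy cov v) (copy-∋ cov v)
  where
  open ≤-Reasoning
  at-copy : (φ : Copy H G) → ∃[ i ] at φ i ≡ v → d ≤ degree G v
  at-copy φ (i , refl) = begin
    d                                             ≡⟨ reg i ⟨
    degree H i                                    ≤⟨ sum-mono (λ j → bool-mono (hom φ i j)) ⟩
    sum (λ j → [ adj G (at φ i) (at φ j) ]ᵇ)      ≤⟨ sum-inj (inj φ) (λ v → [ adj G (at φ i) v ]ᵇ) ⟩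
    degree G (at φ i) ∎

module Cover {d : ℕ} (H : Graph (Fin n)) (reg : Regular d H) (n≤ : n ≤ 2 * d + 1) {G : Graph (Fin N)} (cov : Covered H G) where

  open Cuts H reg n≤ public

  -- Invariant of the greedy covering: cut C bounds the excess of U from below,
  -- where only |C| modulo n is prescribed, and s records strict gains.
  record State (s : ℕ) (U : Sub N) : Set where
    field
      C     : Sub n
      C<n   : card C < n
      mod   : ∃[ j ] card U ≡ j * n + card C
      bound : s + d * card U + cut H C ≤ vol G U

  open State public

  module Ins (U : Sub N) (φ : Copy H G) = Insert H reg G U (at φ) (inj φ) (hom φ)

  -- The recorded set and the new part K are merged into one set, so the state always carries a
  -- single cut; the gain `e` of the merging is added to the slack.
  combined-state : ∀ {s s′ e U} (φ : Copy H G) (st : State s U) → Combined e (C st) (fresh U (at φ)) →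
                   s′ + d * card (insert U (at φ)) + (cut H (C st) + cut H (fresh U (at φ))) ≤ vol G (insert U (at φ)) →
                   State (e + s′) (insert U (at φ))
  combined-state {s} {s′} {e} {U} φ st (C′ , C′<n , (j′ , eq′) , le) gain = record
    { C     = C′
    ; C<n   = C′<n
    ; mod   = proj₁ (mod st) + j′ , (begin
        card (insert U (at φ))                               ≡⟨ card-insert U (inj φ) ⟩
        card U + card K                                      ≡⟨ cong (_+ card K) (proj₂ (mod st)) ⟩
        proj₁ (mod st) * n + card (C st) + card K            ≡⟨ +-assoc (proj₁ (mod st) * n) _ _ ⟩
        proj₁ (mod st) * n + (card (C st) + card K)          ≡⟨ cong (proj₁ (mod st) * n +_) eq′ ⟩
        proj₁ (mod st) * n + (j′ * n + card C′)              ≡⟨ +-assoc (proj₁ (mod st) * n) _ _ ⟨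
        proj₁ (mod st) * n + j′ * n + card C′                ≡⟨ cong (_+ card C′) (*-distribʳ-+ n (proj₁ (mod st)) j′) ⟨
        (proj₁ (mod st) + j′) * n + card C′ ∎)
    ; bound = ≤-trans (≤-reflexive (shift e s′ _ (cut H C′))) (≤-trans (+-monoʳ-≤ (s′ + d * card (insert U (at φ))) le) gain)
    }
    where
    open ≡-Reasoning
    K = fresh U (at φ)
    shift : ∀ e s x c → e + s + x + c ≡ s + x + (e + c)
    shift = solve-∀

  step : ∀ {s U} → State s U → (φ : Copy H G) → State s (insert U (at φ))
  step {s} {U} st φ = combined-state φ st (combine (C st) (fresh U (at φ)) (C<n st))
    (Ins.vol-insert-≤ U φ {s} (bound st))

  step-partial : ∀ {s U} (st : State s U) (φ : Copy H G) → 0 < card (C st) →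
                 0 < card (fresh U (at φ)) → card (fresh U (at φ)) < n → State (1 + s) (insert U (at φ))
  step-partial {s} {U} st φ C>0 K>0 K<n = combined-state φ st (combine-< (C st) (fresh U (at φ)) C>0 (C<n st) K>0 K<n)
    (Ins.vol-insert-≤ U φ {s} (bound st))

  empty-state : 0 < n → State 0 ∅
  empty-state n>0 = record
    { C     = ∅
    ; C<n   = subst (_< n) (sym (card-∅ {n})) n>0
    ; mod   = 0 , trans (card-∅ {N}) (sym (card-∅ {n}))
    ; bound = ≤-trans (≤-reflexive (trans (cong₂ (λ x y → d * x + y) (card-∅ {N}) (cut-none H ∅ (card-∅ {n}))) (trans (+-identityʳ _) (*-zeroʳ d)))) z≤n
    }

  -- The fuel bounds the number of uncovered vertices. Each round takes the copy through an
  -- uncovered vertex, so at least one more vertex gets covered.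
  fill : ∀ fuel {s} U → N ≤ fuel + card U → State s U → ∃[ V ] card V ≡ N × State s V
  fill fuel U enough st = by-card fuel enough (m≤n⇒m<n∨m≡n (card≤ U))
    where
    by-card : ∀ fuel → N ≤ fuel + card U → card U < N ⊎ card U ≡ N → _
    by-card fuel enough (inj₂ done) = U , done , st
    by-card zero enough (inj₁ U<N) = contradiction enough (<⇒≱ U<N)
    by-card (suc fuel) enough (inj₁ U<N) =
      let v , v∉U = card-pos⇒∃ {P = ∁ U} (+-cancelˡ-< (card U) _ _ (subst₂ _<_ (sym (+-identityʳ _)) (sym (card+card∁ U)) U<N))
          φ = copy cov v
          i , φi≡v = copy-∋ cov v
          K>0 = ∃⇒card-pos {P = fresh U (at φ)} i (trans (cong (∁ U) φi≡v) v∉U)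
      in fill fuel (insert U (at φ))
           (≤-trans enough (≤-trans (≤-reflexive (sym (+-suc fuel (card U))))
             (+-monoʳ-≤ fuel (≤-trans (m<m+n (card U) K>0) (≤-reflexive (sym (card-insert U (inj φ))))))))
           (step st φ)

  -- When all N vertices are covered, |C| is congruent to N modulo n and less than n, hence equal to
  -- r.
  excess : ∀ {q r s U} → N ≡ q * n + r → r < n → State s U → ∃[ C ] card C ≡ r × s + d * N + cut H C ≤ vol G full
  excess {q} {r} {s} {U} N≡ r<n st =
    let V , V≡N , st′ = fill N U (m≤m+n N _) st
        j , V≡ = mod st′
        _ , C≡r = div-unique j q (C<n st′) r<n (trans (sym V≡) (trans V≡N N≡))
    in C st′ , C≡r , subst₂ (λ x y → s + d * x + cut H (C st′) ≤ y) V≡N (vol-full G V V≡N) (bound st′)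

  -- Every vertex outside U has degree at least d, so an excess inside U survives in the whole
  -- graph. This serves remainder 0, where the excess is a positive cut and not a gain from
  -- combining two sets.
  vol-excess : ∀ U e → e + d * card U ≤ vol G U → e + d * N ≤ vol G full
  vol-excess U e le = begin
    e + d * N                                          ≡⟨ cong (λ x → e + d * x) (card+card∁ U) ⟨
    e + d * (card U + card (∁ U))                      ≡⟨ distr e d (card U) _ ⟩
    (e + d * card U) + card (∁ U) * d                  ≤⟨ +-mono-≤ le out ⟩
    vol G U + E G (χ (∁ U)) (λ _ → 1)                  ≤⟨ +-monoˡ-≤ _ in≤ ⟩
    E G (χ U) (λ _ → 1) + E G (χ (∁ U)) (λ _ → 1)      ≡⟨ form-+ˡ _ (χ U) (χ (∁ U)) (λ _ → 1) ⟨
    E G (λ v → χ U v + χ (∁ U) v) (λ _ → 1)            ≡⟨ form-congˡ _ (λ _ → 1) (χ+χ∁ U) ⟩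
    vol G full ∎
    where
    open ≤-Reasoning
    distr : ∀ e d x y → e + d * (x + y) ≡ (e + d * x) + y * d
    distr = solve-∀
    out : card (∁ U) * d ≤ E G (χ (∁ U)) (λ _ → 1)
    out = ≤-trans (≤-reflexive (*-distribʳ-sum d (χ (∁ U))))
      (≤-trans (sum-mono λ v → *-monoʳ-≤ (χ (∁ U) v) (degree≥ H reg cov v)) (≤-reflexive (sym (E-ones G (χ (∁ U))))))
    in≤ : vol G U ≤ E G (χ U) (λ _ → 1)
    in≤ = begin
      vol G U                                 ≤⟨ m≤m+n _ _ ⟩
      vol G U + E G (χ U) (χ (∁ U))           ≡⟨ form-+ʳ _ (χ U) (χ U) (χ (∁ U)) ⟨
      E G (χ U) (λ v → χ U v + χ (∁ U) v)     ≡⟨ form-congʳ _ (χ U) (χ+χ∁ U) ⟩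
      E G (χ U) (λ _ → 1) ∎

-- Sums over enumerated types

sum-reindex : (b : Fin N ↔ 𝒜) (b′ : Fin m ↔ 𝒜) (f : 𝒜 → ℕ) → sum (f ∘ to b) ≡ sum (f ∘ to b′)
sum-reindex b b′ f = trans (sum-cong-≗ λ i → cong f (sym (strictlyInverseˡ b′ (to b i))))
  (sym (sum-permute (f ∘ to b′) (↔-trans b (↔-sym b′))))

sum-splitAt : ∀ m {k} (f : Fin m ⊎ Fin k → ℕ) → sum (λ i → f (splitAt m i)) ≡ sum (f ∘ inj₁) + sum (f ∘ inj₂)
sum-splitAt zero    f = refl
sum-splitAt (suc m) f = trans (cong (f (inj₁ zero) +_) (trans (sum-cong-≗ λ i → shift (splitAt m i)) (sum-splitAt m f′)))
  (sym (+-assoc (f (inj₁ zero)) _ _))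
  where
  f′ : Fin m ⊎ _ → ℕ
  f′ (inj₁ i) = f (inj₁ (suc i))
  f′ (inj₂ j) = f (inj₂ j)
  shift : ∀ x → f (map₁ suc x) ≡ f′ x
  shift (inj₁ _) = refl
  shift (inj₂ _) = refl

sum-remQuot : ∀ k {n} (f : Fin k × Fin n → ℕ) → sum (λ i → f (remQuot {k} n i)) ≡ sum λ i → sum λ j → f (i , j)
sum-remQuot zero    f = refl
sum-remQuot (suc k) {n} f = trans (trans (sum-cong-≗ λ i → shift (splitAt n i)) (sum-splitAt n f′))
  (cong ((sum λ j → f (zero , j)) +_) (sum-remQuot k λ (i , j) → f (suc i , j)))
  where
  f′ : Fin n ⊎ Fin (k * n) → ℕ
  f′ (inj₁ j) = f (zero , j)
  f′ (inj₂ i) = let q , r = remQuot {k} n i in f (suc q , r)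
  shift : ∀ x → f (swap ([ (_, zero) , map₂ suc ∘ quotRem {k} n ]′ x)) ≡ f′ x
  shift (inj₁ _) = refl
  shift (inj₂ _) = refl

-- Volumes under isomorphism

total : Graph (Fin n) → ℕ
total G = sum (degree G)

vol-full≡total : (G : Graph (Fin n)) → vol G full ≡ total G
vol-full≡total G = trans (form-rows _ (λ _ → 1) (λ _ → 1))
  (sum-cong-≗ λ u → trans (*-identityˡ _) (sum-cong-≗ λ v → *-identityˡ [ adj G u v ]ᵇ))

handshake : (G : Graph (Fin n)) → 2 * edges G ≡ total G
handshake {n} G = begin
  edges G + (edges G + 0)
    ≡⟨ cong (edges G +_) (trans (+-identityʳ _) (∑-comm λ u v → up u v)) ⟩
  (sum λ u → sum λ v → up u v) + (sum λ u → sum λ v → up v u)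
    ≡⟨ ∑-distrib-+ (λ u → sum λ v → up u v) (λ u → sum λ v → up v u) ⟨
  sum (λ u → sum (λ v → up u v) + sum (λ v → up v u))
    ≡⟨ sum-cong-≗ (λ u → ∑-distrib-+ (λ v → up u v) (λ v → up v u)) ⟨
  sum (λ u → sum λ v → up u v + up v u)
    ≡⟨ sum-cong-≗ (λ u → sum-cong-≗ λ v → both u v) ⟩
  total G ∎
  where
  open ≡-Reasoning
  up : Fin n → Fin n → ℕ
  up u v = [ does (u F.<? v) ∧ adj G u v ]ᵇ
  both : ∀ u v → up u v + up v u ≡ [ adj G u v ]ᵇ
  both u v with F.<-cmp u v
  ... | tri< u<v _ v≮u rewrite dec-true (u F.<? v) u<v | dec-false (v F.<? u) v≮u = +-identityʳ _
  ... | tri≈ _ refl _  rewrite adj-irrefl G u | ∧-zeroʳ (does (u F.<? u)) = refl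
  ... | tri> u≮v _ v<u rewrite dec-false (u F.<? v) u≮v | dec-true (v F.<? u) v<u = cong [_]ᵇ (adj-sym G v u)

edges≤⇒total≤ : (G : Graph (Fin m)) (G′ : Graph (Fin n)) → edges G ≤ edges G′ → total G ≤ total G′
edges≤⇒total≤ G G′ le = subst₂ _≤_ (handshake G) (handshake G′) (*-monoʳ-≤ 2 le)

total≤⇒edges≤ : (G : Graph (Fin m)) (G′ : Graph (Fin n)) → total G ≤ total G′ → edges G ≤ edges G′
total≤⇒edges≤ G G′ le = *-cancelˡ-≤ 2 (subst₂ _≤_ (sym (handshake G)) (sym (handshake G′)) le)

total-iso : {G : Graph (Fin N)} {X : Graph 𝒜} → G ≅ X → (b : Fin m ↔ 𝒜) → total G ≡ total (pullback (to b) X)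
total-iso {G = G} {X} iso b = begin
  total G
    ≡⟨ sum-cong-≗ (λ i → sum-cong-≗ λ j → cong [_]ᵇ (adj-map i j)) ⟨
  sum (λ i → sum λ j → [ adj X (to bij i) (to bij j) ]ᵇ)
    ≡⟨ sum-cong-≗ (λ i → sum-reindex bij b λ y → [ adj X (to bij i) y ]ᵇ) ⟩
  sum (λ i → sum λ j → [ adj X (to bij i) (to b j) ]ᵇ)
    ≡⟨ sum-reindex bij b (λ x → sum λ j → [ adj X x (to b j) ]ᵇ) ⟩
  total (pullback (to b) X) ∎
  where
  open ≡-Reasoning
  open _≅_ iso

total-regular : ∀ {d} (H : Graph (Fin n)) → Regular d H → total H ≡ d * n
total-regular {n} {d} H reg = trans (sum-cong-≗ reg) (trans (sum-const n d) (*-comm n d))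

≅-sym : {G : Graph 𝒜} {X : Graph ℬ} → G ≅ X → X ≅ G
≅-sym {G = G} {X} iso = record
  { bij     = ↔-sym bij
  ; adj-map = λ x y → trans (sym (adj-map (from bij x) (from bij y)))
                            (cong₂ (adj X) (strictlyInverseˡ bij x) (strictlyInverseˡ bij y))
  }
  where open _≅_ iso

≅⇒↪ : {G : Graph 𝒜} {X : Graph ℬ} → G ≅ X → G ↪ X
≅⇒↪ iso = record { embed = ↔⇒↣ bij ; edge-map = λ u v uv → trans (adj-map u v) uv }
  where open _≅_ iso

↪-trans : {G : Graph 𝒜} {X : Graph ℬ} {Y : Graph 𝒞} → G ↪ X → X ↪ Y → G ↪ Y
↪-trans φ ψ = record
  { embed    = _↪_.embed ψ ↣-∘ _↪_.embed φ
  ; edge-map = λ u v uv → _↪_.edge-map ψ _ _ (_↪_.edge-map φ u v uv) }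

inj₁-inj : Inj {𝒜} {𝒜 ⊎ ℬ} inj₁
inj₁-inj refl = refl

inj₂-inj : Inj {ℬ} {𝒜 ⊎ ℬ} inj₂
inj₂-inj refl = refl

inj₁-↪ : {G : Graph 𝒜} {X : Graph ℬ} → G ↪ (G ⊔ᴳ X)
inj₁-↪ = record { embed = mk↣ inj₁-inj ; edge-map = λ _ _ uv → uv }

inj₂-↪ : {G : Graph 𝒜} {X : Graph ℬ} → X ↪ (G ⊔ᴳ X)
inj₂-↪ = record { embed = mk↣ inj₂-inj ; edge-map = λ _ _ uv → uv }

pullback-↪ : {f : 𝒜 → ℬ} → Inj f → (G : Graph ℬ) → pullback f G ↪ G
pullback-↪ inj G = record { embed = mk↣ inj ; edge-map = λ _ _ uv → uv }

copy-↪ : ∀ {k} {H : Graph 𝒜} (i : Fin k) → H ↪ copies k H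
copy-↪ {H = H} i = record
  { embed    = mk↣ {to = i ,_} λ { refl → refl }
  ; edge-map = λ u v uv → trans (cong (_∧ adj H u v) (dec-true (i ≟ i) refl)) uv }

Covered-≅ : {H : Graph 𝒞} {G : Graph 𝒜} {X : Graph ℬ} → G ≅ X → Covered H X → Covered H G
Covered-≅ iso cov v =
  let φ , u , φu≡ = cov (to (_≅_.bij iso) v)
  in ↪-trans φ (≅⇒↪ (≅-sym iso)) , u , trans (cong (from (_≅_.bij iso)) φu≡) (strictlyInverseʳ (_≅_.bij iso) v)

-- Images and enumerations

image : (Fin m → Fin n) → Sub n
image f v = does (image? f v)

χ-image : {f : Fin m → Fin n} → Inj f → ∀ v → χ (image f) v ≡ push f (λ _ → 1) v
χ-image {f = f} inj v = by-cases (image? f v)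
  where
  by-cases : (d : Dec (∃[ i ] f i ≡ v)) → [ does d ]ᵇ ≡ push f (λ _ → 1) v
  by-cases (yes (i , refl)) = sym (push-image inj (λ _ → 1) i)
  by-cases (no v∉)          = sym (push-∉ f (λ _ → 1) λ i eq → v∉ (i , eq))

card-image : {f : Fin m → Fin n} → Inj f → card (image f) ≡ m
card-image {m} {f = f} inj = begin
  card (image f)                          ≡⟨ sum-cong-≗ (χ-image inj) ⟩
  sum (push f (λ _ → 1))                  ≡⟨ sum-cong-≗ (λ v → *-identityʳ (push f (λ _ → 1) v)) ⟨
  sum (λ v → push f (λ _ → 1) v * 1)      ≡⟨ sum-push f (λ _ → 1) (λ _ → 1) ⟩
  sum {m} (λ _ → 1)                       ≡⟨ sum-ones m ⟩
  m ∎
  where open ≡-Reasoning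

vol-image : (G : Graph (Fin n)) {f : Fin m → Fin n} → Inj f → vol G (image f) ≡ total (pullback f G)
vol-image G {f} inj = begin
  vol G (image f)                                              ≡⟨ form-cong {a = λ u v → [ adj G u v ]ᵇ} (χ-image inj) (χ-image inj) ⟩
  E G (push f (λ _ → 1)) (push f (λ _ → 1))                    ≡⟨ form-pushˡ _ f (λ _ → 1) (push f λ _ → 1) ⟩
  form (λ i v → [ adj G (f i) v ]ᵇ) (λ _ → 1) (push f λ _ → 1) ≡⟨ form-pushʳ _ f (λ _ → 1) (λ _ → 1) ⟩
  vol (pullback f G) full                                      ≡⟨ vol-full≡total (pullback f G) ⟩
  total (pullback f G) ∎
  where open ≡-Reasoning

record Enum (P : Sub n) (m : ℕ) : Set where
  field
    at-index : Fin m → Fin n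
    index-inj : Inj at-index
    index-∈ : ∀ i → P (at-index i) ≡ true
    index-of : ∀ v → P v ≡ true → ∃[ i ] at-index i ≡ v

enumerate : (P : Sub n) → Enum P (card P)
enumerate {zero}  P = record { at-index = λ () ; index-inj = λ {} ; index-∈ = λ () ; index-of = λ () }
enumerate {suc n} P = prepend (P zero) refl
  where
  open Enum (enumerate (P ∘ suc)) renaming (at-index to tail; index-inj to tail-inj; index-∈ to tail-∈; index-of to tail-of)
  prepend : ∀ b → P zero ≡ b → Enum P ([ b ]ᵇ + card (P ∘ suc))
  prepend true P0 = record
    { at-index = at′ ; index-inj = inj′ ; index-∈ = in′
    ; index-of = λ { zero _ → zero , refl ; (suc v) Pv → let i , eq = tail-of v Pv in suc i , cong suc eq } }
    where
    at′ : Fin (suc (card (P ∘ suc))) → Fin (suc n)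
    at′ zero    = zero
    at′ (suc i) = suc (tail i)
    inj′ : Inj at′
    inj′ {zero}  {zero}  _  = refl
    inj′ {suc i} {suc j} eq = cong suc (tail-inj (F.suc-injective eq))
    in′ : ∀ i → P (at′ i) ≡ true
    in′ zero    = P0
    in′ (suc i) = tail-∈ i
  prepend false P0 = record
    { at-index = suc ∘ tail ; index-inj = tail-inj ∘ F.suc-injective ; index-∈ = tail-∈
    ; index-of = λ { zero P0′ → contradiction (trans (sym P0′) P0) λ () ; (suc v) Pv → let i , eq = tail-of v Pv in i , cong suc eq } }

χ-enum : {P : Sub n} (e : Enum P m) → ∀ v → χ P v ≡ χ (image (Enum.at-index e)) v
χ-enum {P = P} e v = by-cases (image? at-index v)
  where
  open Enum e
  by-cases : (d : Dec (∃[ i ] at-index i ≡ v)) → χ P v ≡ [ does d ]ᵇ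
  by-cases (yes (i , refl)) = true⇒χ (index-∈ i)
  by-cases (no v∉) with P v in Pv
  ... | true  = contradiction (index-of v Pv) v∉
  ... | false = refl

same-image : {f : 𝒜 → 𝒞} {g : ℬ → 𝒞} → Inj f → Inj g → (∀ a → ∃[ b ] g b ≡ f a) → (∀ b → ∃[ a ] f a ≡ g b) →
             Σ[ e ∈ 𝒜 ↔ ℬ ] (∀ a → g (to e a) ≡ f a)
same-image f-inj g-inj f⊆g g⊆f =
  mk↔ₛ′ (proj₁ ∘ f⊆g) (proj₁ ∘ g⊆f)
    (λ b → g-inj (trans (proj₂ (f⊆g _)) (proj₂ (g⊆f b))))
    (λ a → f-inj (trans (proj₂ (g⊆f _)) (proj₂ (f⊆g a))))
  , proj₂ ∘ f⊆g

copies-row : ∀ {n k} (H : Graph (Fin n)) (i : Fin k) u → (sum λ j → sum λ v → [ adj (copies k H) (i , u) (j , v) ]ᵇ) ≡ degree H u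
copies-row H i u = begin
  (sum λ j → sum λ v → [ does (i ≟ j) ∧ adj H u v ]ᵇ)
    ≡⟨ sum-cong-≗ (λ j → trans (sum-cong-≗ λ v → ∧-χ (does (i ≟ j)) (adj H u v)) (sym (*-distribʳ-sum (δ i j) (λ v → [ adj H u v ]ᵇ)))) ⟩
  (sum λ j → degree H u * δ i j)
    ≡⟨ sum-δ i (λ _ → degree H u) ⟩
  degree H u ∎
  where
  open ≡-Reasoning
  ∧-χ : ∀ a b → [ a ∧ b ]ᵇ ≡ [ b ]ᵇ * [ a ]ᵇ
  ∧-χ true  b = sym (*-identityʳ [ b ]ᵇ)
  ∧-χ false b = sym (*-zeroʳ [ b ]ᵇ)

-- Two copies of H glued along V

record Glued {n} (H : Graph (Fin n)) (r : ℕ) (L : Graph (LVertex n r)) : Set where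
  field
    no-V₁V₂-edge : ∀ x y → adj L (inV₁ {n} r x) (inV₂ {n} r y) ≡ false
    V∪V₁-copy    : pullback (V∪V₁ {n} r) L ≅ H
    V∪V₂-copy    : pullback (V∪V₂ {n} r) L ≅ H

-- Maximality of V is split off because the degree sum depends only on the gluing; maximality is
-- then shown equivalent to edge-minimality of the whole graph.
In𝓛⇒Glued : ∀ {n r} {H : Graph (Fin n)} {L} → In𝓛 H r L → Glued H r L
In𝓛⇒Glued l = record { no-V₁V₂-edge = no-V₁V₂-edge ; V∪V₁-copy = V∪V₁-copy ; V∪V₂-copy = V∪V₂-copy }
  where open In𝓛 l

V∪V₁-inj : ∀ n r → Inj (V∪V₁ {n} r)
V∪V₁-inj n r {inj₁ _} {inj₁ _} refl = refl
V∪V₁-inj n r {inj₂ _} {inj₂ _} refl = refl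

V∪V₂-inj : ∀ n r → Inj (V∪V₂ {n} r)
V∪V₂-inj n r {inj₁ _} {inj₁ _} refl = refl
V∪V₂-inj n r {inj₂ _} {inj₂ _} refl = refl

module Gluing {n d r : ℕ} (r<n : r < n) (H : Graph (Fin n)) (reg : Regular d H) where

  private
    s = n ∸ r

  s+r≡n : s + r ≡ n
  s+r≡n = m∸n+n≡m (<⇒≤ r<n)

  r≡ : (P : Sub n) → card P ≡ s → card (∁ P) ≡ r
  r≡ P size = +-cancelˡ-≡ s _ _ (trans (cong (_+ card (∁ P)) (sym size)) (trans (card+card∁ P) (sym s+r≡n)))

  s≡ : (P : Sub n) → card P ≡ r → card (∁ P) ≡ s
  s≡ P size = +-cancelˡ-≡ r _ _ (trans (cong (_+ card (∁ P)) (sym size)) (trans (card+card∁ P) (trans (sym s+r≡n) (+-comm s r))))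

  -- Among induced subgraphs on s vertices, having more edges is thus the same as omitting an r-set
  -- of smaller cut.
  total+cut : {f : Fin s → Fin n} → Inj f → total (pullback f H) + cut H (∁ (image f)) ≡ d * s
  total+cut {f} inj = begin
    total (pullback f H) + cut H (∁ (image f))      ≡⟨ cong₂ _+_ (sym (vol-image H inj)) (cut-∁ H (image f)) ⟩
    vol H (image f) + cut H (image f)               ≡⟨ vol+cut H reg (image f) ⟩
    d * card (image f)                              ≡⟨ cong (d *_) (card-image inj) ⟩
    d * s ∎
    where open ≡-Reasoning

  -- A subgraph that is not induced has no more edges than the subgraph induced on its image, hence
  -- only an inequality.
  subgraph-cut : (Y : Graph (Fin s)) → Y ↪ H → ∃[ C ] card C ≡ r × total Y + cut H C ≤ d * s
  subgraph-cut Y φ = ∁ (image f) , r≡ (image f) (card-image f-inj)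
    , ≤-trans (+-monoˡ-≤ _ (sum-mono λ u → sum-mono λ v → bool-mono (_↪_.edge-map φ u v))) (≤-reflexive (total+cut f-inj))
    where
    f : Fin s → Fin n
    f = Injection.to (_↪_.embed φ)
    f-inj : Inj f
    f-inj = Injection.injective (_↪_.embed φ)

  enum-cut : ∀ {C} (en : Enum (∁ C) s) → total (pullback (Enum.at-index en) H) + cut H C ≡ d * s
  enum-cut {C} en = trans (cong (total (pullback e H) +_) cut≡) (total+cut e-inj)
    where
    open Enum en renaming (at-index to e; index-inj to e-inj)
    χ-injective : ∀ {a b : Bool} → [ a ]ᵇ ≡ [ b ]ᵇ → a ≡ b
    χ-injective {true}  {true}  _ = refl
    χ-injective {false} {false} _ = refl
    cut≡ : cut H C ≡ cut H (∁ (image e))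
    cut≡ = begin
      cut H C                 ≡⟨ cut-∁ H C ⟨
      cut H (∁ C)             ≡⟨ form-cong {a = λ u v → [ adj H u v ]ᵇ} (χ-enum en)
                                   (λ v → cong (λ b → [ not b ]ᵇ) (χ-injective (χ-enum en v))) ⟩
      cut H (image e)         ≡⟨ cut-∁ H (image e) ⟨
      cut H (∁ (image e)) ∎
      where open ≡-Reasoning

  enumerate-∁ : ∀ C → card C ≡ r → Enum (∁ C) s
  enumerate-∁ C size = subst (Enum (∁ C)) (s≡ C size) (enumerate (∁ C))

  module _ {L : Graph (LVertex n r)} (gl : Glued H r L) where

    open Glued gl

    X : Graph (Fin s)
    X = pullback (inV {n} r) L

    X-↪ : X ↪ H
    X-↪ = ↪-trans (record { embed = mk↣ inj₁-inj ; edge-map = λ _ _ uv → uv }) (≅⇒↪ V∪V₁-copy)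

    X-cut : ∃[ C ] card C ≡ r × total X + cut H C ≡ d * s
    X-cut = ∁ (image f) , r≡ (image f) (card-image f-inj)
      , trans (cong (_+ cut H (∁ (image f))) (sum-cong-≗ λ u → sum-cong-≗ λ v → cong [_]ᵇ (sym (_≅_.adj-map V∪V₁-copy (inj₁ u) (inj₁ v))))) (total+cut f-inj)
      where
      f : Fin s → Fin n
      f = Injection.to (_↪_.embed X-↪)
      f-inj : Inj f
      f-inj = Injection.injective (_↪_.embed X-↪)

    private
      block : {k l : ℕ} → (Fin k → LVertex n r) → (Fin l → LVertex n r) → ℕ
      block f g = sum λ i → sum λ j → [ adj L (f i) (g j) ]ᵇ
      V : Fin s → LVertex n r
      V = inV {n} r
      V₁ V₂ : Fin r → LVertex n r
      V₁ = inV₁ {n} r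
      V₂ = inV₂ {n} r

      split-total : (W : Fin r → LVertex n r) (ι : Fin s ⊎ Fin r → LVertex n r) → (∀ x → ι (inj₁ x) ≡ V x) → (∀ y → ι (inj₂ y) ≡ W y) →
                    pullback ι L ≅ H → block V V + block V W + (block W V + block W W) ≡ d * n
      split-total W ι ι₁ ι₂ iso = sym (begin
        d * n
          ≡⟨ total-regular H reg ⟨
        total H
          ≡⟨ total-iso (≅-sym iso) F.+↔⊎ ⟩
        (sum λ i → sum λ j → [ adj L (ι (splitAt s i)) (ι (splitAt s j)) ]ᵇ)
          ≡⟨ sum-cong-≗ (λ i → sum-splitAt s λ y → [ adj L (ι (splitAt s i)) (ι y) ]ᵇ) ⟩
        (sum λ i → row (ι (splitAt s i)))
          ≡⟨ sum-splitAt s (λ x → row (ι x)) ⟩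
        (sum λ i → row (ι (inj₁ i))) + (sum λ i → row (ι (inj₂ i)))
          ≡⟨ cong₂ _+_ (∑-distrib-+ (λ i → sum λ j → [ adj L (ι (inj₁ i)) (ι (inj₁ j)) ]ᵇ) (λ i → sum λ j → [ adj L (ι (inj₁ i)) (ι (inj₂ j)) ]ᵇ))
                       (∑-distrib-+ (λ i → sum λ j → [ adj L (ι (inj₂ i)) (ι (inj₁ j)) ]ᵇ) (λ i → sum λ j → [ adj L (ι (inj₂ i)) (ι (inj₂ j)) ]ᵇ)) ⟩
        block (ι ∘ inj₁) (ι ∘ inj₁) + block (ι ∘ inj₁) (ι ∘ inj₂) + (block (ι ∘ inj₂) (ι ∘ inj₁) + block (ι ∘ inj₂) (ι ∘ inj₂))
          ≡⟨ cong₂ _+_ (cong₂ _+_ (block≡ ι₁ ι₁) (block≡ ι₁ ι₂)) (cong₂ _+_ (block≡ ι₂ ι₁) (block≡ ι₂ ι₂)) ⟩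
        block V V + block V W + (block W V + block W W) ∎)
        where
        open ≡-Reasoning
        row : LVertex n r → ℕ
        row x = (sum λ j → [ adj L x (ι (inj₁ j)) ]ᵇ) + (sum λ j → [ adj L x (ι (inj₂ j)) ]ᵇ)
        block≡ : {k l : ℕ} {f f′ : Fin k → LVertex n r} {g g′ : Fin l → LVertex n r} →
                 (∀ i → f i ≡ f′ i) → (∀ j → g j ≡ g′ j) → block f g ≡ block f′ g′
        block≡ ff gg = sum-cong-≗ λ i → sum-cong-≗ λ j → cong₂ (λ x y → [ adj L x y ]ᵇ) (ff i) (gg j)

    LV : Fin (s + (r + r)) ↔ LVertex n r
    LV = ↔-trans F.+↔⊎ (↔-refl ⊎-↔ F.+↔⊎)

    sum-LV : (f : LVertex n r → ℕ) → sum (f ∘ to LV) ≡ sum (f ∘ V) + (sum (f ∘ V₁) + sum (f ∘ V₂))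
    sum-LV f = trans (sum-cong-≗ λ i → shift (splitAt s i)) (trans (sum-splitAt s g) (cong (sum (f ∘ V) +_) (sum-splitAt r (f ∘ inj₂))))
      where
      g : Fin s ⊎ Fin (r + r) → ℕ
      g (inj₁ i) = f (inj₁ i)
      g (inj₂ i) = f (inj₂ (splitAt r i))
      shift : ∀ x → f (to (↔-refl ⊎-↔ F.+↔⊎ {r} {r}) x) ≡ g x
      shift (inj₁ _) = refl
      shift (inj₂ _) = refl

    -- The two copies of H together contain every adjacent pair of L once, except that pairs inside
    -- V are counted twice; nothing is missed, since no edge joins V₁ to V₂.
    total-L : total (pullback (to LV) L) + total X ≡ 2 * (d * n)
    total-L = begin
      (sum λ i → sum λ j → [ adj L (to LV i) (to LV j) ]ᵇ) + block V V
        ≡⟨ cong (_+ block V V) (trans (sum-cong-≗ λ i → sum-LV λ y → [ adj L (to LV i) y ]ᵇ) (sum-LV row)) ⟩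
      sum (row ∘ V) + (sum (row ∘ V₁) + sum (row ∘ V₂)) + block V V
        ≡⟨ cong (_+ block V V) (cong₂ _+_ (rows V) (cong₂ _+_ (rows V₁) (rows V₂))) ⟩
      (block V V + (block V V₁ + block V V₂)) + ((block V₁ V + (block V₁ V₁ + block V₁ V₂)) + (block V₂ V + (block V₂ V₁ + block V₂ V₂))) + block V V
        ≡⟨ cong₂ (λ p q → (block V V + (block V V₁ + block V V₂)) + ((block V₁ V + (block V₁ V₁ + p)) + (block V₂ V + (q + block V₂ V₂))) + block V V) zero₁ zero₂ ⟩
      (block V V + (block V V₁ + block V V₂)) + ((block V₁ V + (block V₁ V₁ + 0)) + (block V₂ V + (0 + block V₂ V₂))) + block V V
        ≡⟨ rearr (block V V) (block V V₁) (block V V₂) (block V₁ V) (block V₁ V₁) (block V₂ V) (block V₂ V₂) ⟩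
      (block V V + block V V₁ + (block V₁ V + block V₁ V₁)) + (block V V + block V V₂ + (block V₂ V + block V₂ V₂))
        ≡⟨ cong₂ _+_ (split-total V₁ (V∪V₁ {n} r) (λ _ → refl) (λ _ → refl) V∪V₁-copy)
                     (split-total V₂ (V∪V₂ {n} r) (λ _ → refl) (λ _ → refl) V∪V₂-copy) ⟩
      d * n + d * n
        ≡⟨ cong (d * n +_) (+-identityʳ (d * n)) ⟨
      2 * (d * n) ∎
      where
      open ≡-Reasoning
      row : LVertex n r → ℕ
      row x = (sum λ j → [ adj L x (V j) ]ᵇ) + ((sum λ j → [ adj L x (V₁ j) ]ᵇ) + (sum λ j → [ adj L x (V₂ j) ]ᵇ))
      rows : {k : ℕ} (W : Fin k → LVertex n r) → sum (row ∘ W) ≡ block W V + (block W V₁ + block W V₂)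
      rows W = trans (∑-distrib-+ (λ i → sum λ j → [ adj L (W i) (V j) ]ᵇ) (λ i → (sum λ j → [ adj L (W i) (V₁ j) ]ᵇ) + (sum λ j → [ adj L (W i) (V₂ j) ]ᵇ)))
        (cong (block W V +_) (∑-distrib-+ (λ i → sum λ j → [ adj L (W i) (V₁ j) ]ᵇ) (λ i → sum λ j → [ adj L (W i) (V₂ j) ]ᵇ)))
      zero₁ : block V₁ V₂ ≡ 0
      zero₁ = sum-0 λ i → sum-0 λ j → cong [_]ᵇ (no-V₁V₂-edge i j)
      zero₂ : block V₂ V₁ ≡ 0
      zero₂ = sum-0 λ i → sum-0 λ j → cong [_]ᵇ (trans (adj-sym L (V₂ i) (V₁ j)) (no-V₁V₂-edge j i))
      rearr : ∀ vv v1 v2 a b c e → (vv + (v1 + v2)) + ((a + (b + 0)) + (c + (0 + e))) + vv ≡ (vv + v1 + (a + b)) + (vv + v2 + (c + e))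
      rearr = solve-∀

    module _ (k : ℕ) where

      LC : Fin ((s + (r + r)) + k * n) ↔ (LVertex n r ⊎ (Fin k × Fin n))
      LC = ↔-trans F.+↔⊎ (LV ⊎-↔ F.*↔×)

      sum-LC : (f : LVertex n r ⊎ (Fin k × Fin n) → ℕ) →
               sum (f ∘ to LC) ≡ sum (f ∘ inj₁ ∘ to LV) + sum λ i → sum λ u → f (inj₂ (i , u))
      sum-LC f = trans (sum-cong-≗ λ i → shift (splitAt (s + (r + r)) i))
        (trans (sum-splitAt (s + (r + r)) g) (cong (sum (f ∘ inj₁ ∘ to LV) +_) (sum-remQuot k (f ∘ inj₂))))
        where
        g : Fin (s + (r + r)) ⊎ Fin (k * n) → ℕ
        g (inj₁ i) = f (inj₁ (to LV i))
        g (inj₂ i) = f (inj₂ (remQuot n i))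
        shift : ∀ x → f (to (LV ⊎-↔ F.*↔× {k} {n}) x) ≡ g x
        shift (inj₁ _) = refl
        shift (inj₂ _) = refl

      total-LC : total (pullback (to LC) (L ⊔ᴳ copies k H)) ≡ total (pullback (to LV) L) + k * (d * n)
      total-LC = begin
        total (pullback (to LC) (L ⊔ᴳ copies k H))
          ≡⟨ trans (sum-cong-≗ λ i → sum-LC λ y → [ adj (L ⊔ᴳ copies k H) (to LC i) y ]ᵇ) (sum-LC row) ⟩
        sum (row ∘ inj₁ ∘ to LV) + (sum λ i → sum λ u → row (inj₂ (i , u)))
          ≡⟨ cong₂ _+_ (sum-cong-≗ λ i → trans (cong ((sum λ j → [ adj L (to LV i) (to LV j) ]ᵇ) +_) (sum-0 {k} λ _ → sum-0 {n} λ _ → refl)) (+-identityʳ _))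
                       (sum-cong-≗ λ i → sum-cong-≗ λ u → cong₂ _+_ (sum-0 {s + (r + r)} λ _ → refl) (trans (copies-row {k = k} H i u) (reg u))) ⟩
        total (pullback (to LV) L) + (sum λ (i : Fin k) → sum λ (u : Fin n) → d)
          ≡⟨ cong (total (pullback (to LV) L) +_) (trans (sum-cong-≗ {k} λ i → trans (sum-const n d) (*-comm n d)) (sum-const k (d * n))) ⟩
        total (pullback (to LV) L) + k * (d * n) ∎
        where
        open ≡-Reasoning
        row : LVertex n r ⊎ (Fin k × Fin n) → ℕ
        row x = (sum λ j → [ adj (L ⊔ᴳ copies k H) x (inj₁ (to LV j)) ]ᵇ) + (sum λ j → sum λ v → [ adj (L ⊔ᴳ copies k H) x (inj₂ (j , v)) ]ᵇ)

      module _ {N : ℕ} (N≡ : N ≡ suc k * n + r) {G : Graph (Fin N)} (iso : G ≅ (L ⊔ᴳ copies k H)) where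

        -- By `total-L` the part L has degree sum 2dn - `total X`, and `total X` = d(n - r) - cut(C)
        -- for the r-set C of H omitted by V. The k further copies contribute dn each.
        total-G : ∃[ C ] card C ≡ r × total X + cut H C ≡ d * s × total G ≡ d * N + cut H C
        total-G = C , proj₁ (proj₂ X-cut) , proj₂ (proj₂ X-cut) , +-cancelʳ-≡ (d * s) _ _ (begin
          total G + d * s
            ≡⟨ cong₂ _+_ (trans (total-iso iso LC) total-LC) (sym (proj₂ (proj₂ X-cut))) ⟩
          (total (pullback (to LV) L) + k * (d * n)) + (total X + cut H C)
            ≡⟨ r1 (total (pullback (to LV) L)) (k * (d * n)) (total X) (cut H C) ⟩
          (total (pullback (to LV) L) + total X) + k * (d * n) + cut H C
            ≡⟨ cong (λ x → x + k * (d * n) + cut H C) total-L ⟩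
          2 * (d * n) + k * (d * n) + cut H C
            ≡⟨ cong (_+ cut H C) (r2 k d n) ⟩
          d * (suc k * n) + d * n + cut H C
            ≡⟨ cong (λ x → d * (suc k * n) + d * x + cut H C) s+r≡n ⟨
          d * (suc k * n) + d * (s + r) + cut H C
            ≡⟨ r3 d (suc k * n) s r (cut H C) ⟩
          d * (suc k * n + r) + cut H C + d * s
            ≡⟨ cong (λ x → d * x + cut H C + d * s) N≡ ⟨
          d * N + cut H C + d * s ∎)
          where
          open ≡-Reasoning
          C = proj₁ X-cut
          r1 : ∀ a b c e → (a + b) + (c + e) ≡ (a + c) + b + e
          r1 = solve-∀
          r2 : ∀ k d n → 2 * (d * n) + k * (d * n) ≡ d * (suc k * n) + d * n
          r2 = solve-∀
          r3 : ∀ d m s r c → d * m + d * (s + r) + c ≡ d * (m + r) + c + d * s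
          r3 = solve-∀

        glued-covered : Covered H G
        glued-covered = Covered-≅ iso cov
          where
          via : ∀ {ι : Fin s ⊎ Fin r → LVertex n r} → Inj ι → pullback ι L ≅ H →
                ∀ x → Σ[ φ ∈ H ↪ (L ⊔ᴳ copies k H) ] ∃[ u ] Injection.to (_↪_.embed φ) u ≡ inj₁ (ι x)
          via {ι} inj α x = ↪-trans (≅⇒↪ (≅-sym α)) (↪-trans (pullback-↪ inj L) inj₁-↪)
            , to (_≅_.bij α) x , cong (inj₁ ∘ ι) (strictlyInverseʳ (_≅_.bij α) x)
          cov : Covered H (L ⊔ᴳ copies k H)
          cov (inj₁ (inj₁ x))        = via (V∪V₁-inj n r) V∪V₁-copy (inj₁ x)
          cov (inj₁ (inj₂ (inj₁ x))) = via (V∪V₁-inj n r) V∪V₁-copy (inj₂ x)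
          cov (inj₁ (inj₂ (inj₂ x))) = via (V∪V₂-inj n r) V∪V₂-copy (inj₂ x)
          cov (inj₂ (i , u))         = ↪-trans (copy-↪ i) inj₂-↪ , u , refl

-- Covered graphs attaining the bound

module Double {n r : ℕ} (r<n : r < n) (H : Graph (Fin n)) (C : Sub n)
              (outside : Enum (∁ C) (n ∸ r)) (inside : Enum C r) where

  open Enum outside renaming (at-index to e₀; index-inj to e₀-inj; index-∈ to e₀-∉; index-of to index₀)
  open Enum inside  renaming (at-index to e₁; index-inj to e₁-inj; index-∈ to e₁-∈; index-of to index₁)

  place : Fin (n ∸ r) ⊎ Fin r → Fin n
  place = [ e₀ , e₁ ]′

  clash : ∀ {x y} → e₀ x ≢ e₁ y
  clash {x} {y} eq = contradiction (trans (sym (e₀-∉ x)) (cong not (trans (cong C eq) (e₁-∈ y)))) λ ()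

  place-inj : Inj place
  place-inj {inj₁ _} {inj₁ _} eq = cong inj₁ (e₀-inj eq)
  place-inj {inj₁ _} {inj₂ _} eq = contradiction eq clash
  place-inj {inj₂ _} {inj₁ _} eq = contradiction (sym eq) clash
  place-inj {inj₂ _} {inj₂ _} eq = cong inj₂ (e₁-inj eq)

  place-onto : ∀ v → ∃[ x ] place x ≡ v
  place-onto v with C v in Cv
  ... | true  = let y , eq = index₁ v Cv in inj₂ y , eq
  ... | false = let x , eq = index₀ v (cong not Cv) in inj₁ x , eq

  placement : Σ[ e ∈ (Fin (n ∸ r) ⊎ Fin r) ↔ Fin n ] (∀ x → to e x ≡ place x)
  placement = same-image place-inj id (λ x → place x , refl) place-onto

  double : Graph (LVertex n r)
  double = record { adj = a ; adj-sym = a-sym ; adj-irrefl = a-irrefl }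
    where
    a : LVertex n r → LVertex n r → Bool
    a (inj₁ x)        (inj₁ y)        = adj H (e₀ x) (e₀ y)
    a (inj₁ x)        (inj₂ (inj₁ y)) = adj H (e₀ x) (e₁ y)
    a (inj₁ x)        (inj₂ (inj₂ y)) = adj H (e₀ x) (e₁ y)
    a (inj₂ (inj₁ x)) (inj₁ y)        = adj H (e₁ x) (e₀ y)
    a (inj₂ (inj₂ x)) (inj₁ y)        = adj H (e₁ x) (e₀ y)
    a (inj₂ (inj₁ x)) (inj₂ (inj₁ y)) = adj H (e₁ x) (e₁ y)
    a (inj₂ (inj₂ x)) (inj₂ (inj₂ y)) = adj H (e₁ x) (e₁ y)
    a (inj₂ (inj₁ x)) (inj₂ (inj₂ y)) = false
    a (inj₂ (inj₂ x)) (inj₂ (inj₁ y)) = false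
    a-sym : ∀ x y → a x y ≡ a y x
    a-sym (inj₁ x)        (inj₁ y)        = adj-sym H _ _
    a-sym (inj₁ x)        (inj₂ (inj₁ y)) = adj-sym H _ _
    a-sym (inj₁ x)        (inj₂ (inj₂ y)) = adj-sym H _ _
    a-sym (inj₂ (inj₁ x)) (inj₁ y)        = adj-sym H _ _
    a-sym (inj₂ (inj₂ x)) (inj₁ y)        = adj-sym H _ _
    a-sym (inj₂ (inj₁ x)) (inj₂ (inj₁ y)) = adj-sym H _ _
    a-sym (inj₂ (inj₂ x)) (inj₂ (inj₂ y)) = adj-sym H _ _
    a-sym (inj₂ (inj₁ x)) (inj₂ (inj₂ y)) = refl
    a-sym (inj₂ (inj₂ x)) (inj₂ (inj₁ y)) = refl
    a-irrefl : ∀ x → a x x ≡ false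
    a-irrefl (inj₁ x)        = adj-irrefl H _
    a-irrefl (inj₂ (inj₁ x)) = adj-irrefl H _
    a-irrefl (inj₂ (inj₂ x)) = adj-irrefl H _

  double-glued : Glued H r double
  double-glued = record
    { no-V₁V₂-edge = λ _ _ → refl
    ; V∪V₁-copy    = record { bij = e ; adj-map = λ x y → trans (cong₂ (adj H) (e≡ x) (e≡ y)) (first x y) }
    ; V∪V₂-copy    = record { bij = e ; adj-map = λ x y → trans (cong₂ (adj H) (e≡ x) (e≡ y)) (second x y) }
    }
    where
    e = proj₁ placement
    e≡ = proj₂ placement
    first : ∀ x y → adj H (place x) (place y) ≡ adj double (V∪V₁ {n} r x) (V∪V₁ {n} r y)
    first (inj₁ _) (inj₁ _) = refl
    first (inj₁ _) (inj₂ _) = refl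
    first (inj₂ _) (inj₁ _) = refl
    first (inj₂ _) (inj₂ _) = refl
    second : ∀ x y → adj H (place x) (place y) ≡ adj double (V∪V₂ {n} r x) (V∪V₂ {n} r y)
    second (inj₁ _) (inj₁ _) = refl
    second (inj₁ _) (inj₂ _) = refl
    second (inj₂ _) (inj₁ _) = refl
    second (inj₂ _) (inj₂ _) = refl

module InClass {n d r : ℕ} (r<n : r < n) (H : Graph (Fin n)) (reg : Regular d H) (n≤ : n ≤ 2 * d + 1)
               {N k : ℕ} (N≡ : N ≡ suc k * n + r) where

  open Gluing {n} {d} {r} r<n H reg

  -- Needed for every r-set and not just for one of least cut: `excess` supplies some C beyond
  -- control, and minimal graphs are compared with the graph doubled along that very C.
  attained : ∀ C → card C ≡ r → Σ[ G ∈ Graph (Fin N) ] Covered H G × total G ≡ d * N + cut H C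
  attained C size =
    let C′ , _ , X+cut′ , total≡ = total-G double-glued k N≡ iso
    in G , glued-covered double-glued k N≡ iso
       , trans total≡ (cong (d * N +_) (+-cancelˡ-≡ (total (pullback (Enum.at-index outside) H)) _ _ (trans X+cut′ (sym (enum-cut outside)))))
    where
    outside = enumerate-∁ C size
    open Double r<n H C outside (subst (Enum C) size (enumerate C))
    s = n ∸ r
    N≡size : N ≡ (s + (r + r)) + k * n
    N≡size = trans N≡ (trans (cong (λ x → x + k * n + r) (sym s+r≡n)) (shift s r (k * n)))
      where
      shift : ∀ s r m → s + r + m + r ≡ s + (r + r) + m
      shift = solve-∀
    b : Fin N ↔ (LVertex n r ⊎ (Fin k × Fin n))
    b = subst (λ m → Fin m ↔ (LVertex n r ⊎ (Fin k × Fin n))) (sym N≡size) (LC double-glued k)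
    G : Graph (Fin N)
    G = pullback (to b) (double ⊔ᴳ copies k H)
    iso : G ≅ (double ⊔ᴳ copies k H)
    iso = record { bij = b ; adj-map = λ _ _ → refl }

  minimal-total : {G : Graph (Fin N)} → EdgeMinimal H G → ∀ C → card C ≡ r → total G ≤ d * N + cut H C
  minimal-total {G} (_ , min) C size =
    let G′ , cov′ , total≡ = attained C size
    in ≤-trans (edges≤⇒total≤ G G′ (min G′ cov′)) (≤-reflexive total≡)

  module _ {L : Graph (LVertex n r)} (gl : Glued H r L) {G : Graph (Fin N)} (iso : G ≅ (L ⊔ᴳ copies k H)) where

    -- The lower bound for a rival G′ comes with an r-set C′. The subgraph induced on the complement
    -- of C′ competes with V, so maximality of V yields cut(C) ≤ cut(C′).
    V-max⇒minimal : MaxSubgraph H (pullback (inV {n} r) L) → EdgeMinimal H G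
    V-max⇒minimal (_ , V-max) = glued-covered gl k N≡ iso , minimal
      where
      open ≤-Reasoning
      minimal : (G′ : Graph (Fin N)) → Covered H G′ → edges G ≤ edges G′
      minimal G′ cov′ = total≤⇒edges≤ G G′ (begin
        total G                   ≡⟨ total≡ ⟩
        d * N + cut H C           ≤⟨ +-monoʳ-≤ (d * N) cut≤ ⟩
        d * N + cut H C′          ≤⟨ lower ⟩
        vol G′ full               ≡⟨ vol-full≡total G′ ⟩
        total G′ ∎)
        where
        open Cover H reg n≤ {G′} cov′ hiding (C)
        tG = total-G gl k N≡ iso
        C = proj₁ tG
        X+cut = proj₁ (proj₂ (proj₂ tG))
        total≡ = proj₂ (proj₂ (proj₂ tG))
        ex = excess {suc k} N≡ r<n (empty-state (≤-trans z<s r<n))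
        C′ = proj₁ ex
        lower = proj₂ (proj₂ ex)
        outside = enumerate-∁ C′ (proj₁ (proj₂ ex))
        Y : Graph (Fin (n ∸ r))
        Y = pullback (Enum.at-index outside) H
        cut≤ : cut H C ≤ cut H C′
        cut≤ = +-cancelˡ-≤ (total Y) _ _ (begin
          total Y + cut H C             ≤⟨ +-monoˡ-≤ (cut H C) (edges≤⇒total≤ Y (X gl) (V-max Y (pullback-↪ (Enum.index-inj outside) H))) ⟩
          total (X gl) + cut H C        ≡⟨ X+cut ⟩
          d * (n ∸ r)                   ≡⟨ enum-cut outside ⟨
          total Y + cut H C′ ∎)

    -- A subgraph Y with more edges would omit an r-set of smaller cut, and doubling H along that
    -- set would give a covered graph with fewer edges than G.
    minimal⇒V-max : EdgeMinimal H G → MaxSubgraph H (pullback (inV {n} r) L)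
    minimal⇒V-max min = X-↪ gl , λ Y Y↪H → total≤⇒edges≤ Y (X gl) (bound Y Y↪H)
      where
      open ≤-Reasoning
      tG = total-G gl k N≡ iso
      C = proj₁ tG
      X+cut = proj₁ (proj₂ (proj₂ tG))
      total≡ = proj₂ (proj₂ (proj₂ tG))
      bound : ∀ Y → Y ↪ H → total Y ≤ total (X gl)
      bound Y Y↪H =
        let C′ , size , Y+cut = subgraph-cut Y Y↪H
            cut≤ = +-cancelˡ-≤ (d * N) _ _ (≤-trans (≤-reflexive (sym total≡)) (minimal-total min C′ size))
        in +-cancelʳ-≤ (cut H C) _ _ (≤-trans (+-monoʳ-≤ (total Y) cut≤) (≤-trans Y+cut (≤-reflexive (sym X+cut))))

-- Partitioning the uncovered vertices into copies

≢true⇒false : ∀ {b} → b ≢ true → b ≡ false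
≢true⇒false {true}  ≢ = contradiction refl ≢
≢true⇒false {false} ≢ = refl

not-true⇒false : ∀ {b} → not b ≡ true → b ≡ false
not-true⇒false {false} _ = refl

not-false⇒true : ∀ {b} → not b ≡ false → b ≡ true
not-false⇒true {true} _ = refl

true≢false : ∀ {b : Bool} → b ≡ true → b ≢ false
true≢false refl ()

insert-∉ : (U : Sub N) (φ : Fin n → Fin N) → ∀ {v} → insert U φ v ≡ false → U v ≡ false × (∀ i → φ i ≢ v)
insert-∉ U φ {v} v∉ = ≢true⇒false (λ Uv → true≢false (insert-old U φ Uv) v∉) , λ { i refl → true≢false (insert-new U φ i) v∉ }

module Blocks {n N : ℕ} (block : Fin N → Fin n → Fin N) (block-inj : ∀ v → Inj (block v)) (block-∋ : ∀ v → ∃[ i ] block v i ≡ v) where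

  Avoids : Sub N → Fin N → Set
  Avoids U v = ∀ i → U (block v i) ≡ false

  -- `nested` puts the block of w inside the block of v; exchanging v and w gives the reverse
  -- inclusion. Two blocks that meet are therefore equal as sets, though possibly different as maps.
  record Separated (U : Sub N) : Set where
    field
      avoids : ∀ v → U v ≡ false → Avoids U v
      nested : ∀ v w → U v ≡ false → U w ≡ false → ∀ i j → block v i ≡ block w j → ∀ j′ → ∃[ i′ ] block v i′ ≡ block w j′

  record Partition (U : Sub N) : Set where
    field
      size     : ℕ
      rep      : Fin size → Fin N
      rep∉     : ∀ i → U (rep i) ≡ false
      disjoint : ∀ i j a b → block (rep i) a ≡ block (rep j) b → i ≡ j
      covers   : ∀ v → U v ≡ true ⊎ ∃[ i ] ∃[ a ] block (rep i) a ≡ v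
      count    : N ≡ card U + size * n

  private
    cons : {A : Set} {k : ℕ} → A → (Fin k → A) → Fin (suc k) → A
    cons x f zero    = x
    cons x f (suc i) = f i

  -- If the block of w met the block of v it would lie inside it, and w, being in its own block,
  -- would already be covered.
  add-block : ∀ U v → Separated U → U v ≡ false → Separated (insert U (block v))
  add-block U v sep v∉ = record
    { avoids = λ w w∉ i → ≢true⇒false λ in′ → escape w w∉ i (insert-inv U (block v) in′)
    ; nested = λ x y x∉ y∉ → nested x y (proj₁ (insert-∉ U (block v) x∉)) (proj₁ (insert-∉ U (block v) y∉))
    }
    where
    open Separated sep
    escape : ∀ w → insert U (block v) w ≡ false → ∀ i → ¬ (U (block w i) ≡ true ⊎ ∃[ a ] block v a ≡ block w i)
    escape w w∉ i (inj₁ Uwi) = true≢false Uwi (avoids w (proj₁ (insert-∉ U (block v) w∉)) i)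
    escape w w∉ i (inj₂ (a , eq)) =
      let j , wj≡w = block-∋ w
          i′ , eq′ = nested v w v∉ (proj₁ (insert-∉ U (block v) w∉)) a i eq j
      in proj₂ (insert-∉ U (block v) w∉) i′ (trans eq′ wj≡w)

  extend-partition : ∀ U v → Separated U → U v ≡ false → Partition (insert U (block v)) → Partition U
  extend-partition U v sep v∉ P = record
    { size     = suc size
    ; rep      = cons v rep
    ; rep∉     = λ { zero → v∉ ; (suc i) → proj₁ (insert-∉ U (block v) (rep∉ i)) }
    ; disjoint = disj
    ; covers   = λ x → split (covers x)
    ; count    = trans count (trans (cong (_+ size * n) (trans (card-insert U (block-inj v)) (cong (card U +_) new)))
                   (+-assoc (card U) n (size * n)))
    }
    where
    open Partition P
    open Separated (add-block U v sep v∉)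
    new : card (fresh U (block v)) ≡ n
    new = trans (sum-cong-≗ λ i → cong (λ b → [ not b ]ᵇ) (Separated.avoids sep v v∉ i)) (card-full {n})
    apart : ∀ j a b → block v a ≢ block (rep j) b
    apart j a b eq = true≢false (insert-new U (block v) a) (trans (cong (insert U (block v)) eq) (avoids (rep j) (rep∉ j) b))
    disj : ∀ i j a b → block (cons v rep i) a ≡ block (cons v rep j) b → i ≡ j
    disj zero    zero    a b eq = refl
    disj zero    (suc j) a b eq = contradiction eq (apart j a b)
    disj (suc i) zero    a b eq = contradiction (sym eq) (apart i b a)
    disj (suc i) (suc j) a b eq = cong suc (disjoint i j a b eq)
    split : ∀ {x} → insert U (block v) x ≡ true ⊎ ∃[ i ] ∃[ a ] block (rep i) a ≡ x →
            U x ≡ true ⊎ ∃[ i ] ∃[ a ] block (cons v rep i) a ≡ x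
    split (inj₂ (i , a , eq)) = inj₂ (suc i , a , eq)
    split (inj₁ in′) with insert-inv U (block v) in′
    ... | inj₁ Ux       = inj₁ Ux
    ... | inj₂ (a , eq) = inj₂ (zero , a , eq)

  partition : ∀ U → Separated U → Partition U
  partition U sep = go N U (m≤m+n N _) sep
    where
    go : ∀ fuel U → N ≤ fuel + card U → Separated U → Partition U
    go fuel U enough sep = by-card fuel enough (m≤n⇒m<n∨m≡n (card≤ U))
      where
      by-card : ∀ fuel → N ≤ fuel + card U → card U < N ⊎ card U ≡ N → Partition U
      by-card fuel enough (inj₂ done) = record
        { size = 0 ; rep = λ () ; rep∉ = λ () ; disjoint = λ ()
        ; covers = λ v → inj₁ (card≡n⇒true {P = U} done v) ; count = trans (sym done) (sym (+-identityʳ _)) }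
      by-card zero enough (inj₁ U<N) = contradiction enough (<⇒≱ U<N)
      by-card (suc fuel) enough (inj₁ U<N) =
        let v , v∈∁U = card-pos⇒∃ {P = ∁ U} (+-cancelˡ-< (card U) _ _ (subst₂ _<_ (sym (+-identityʳ _)) (sym (card+card∁ U)) U<N))
            v∉U = not-true⇒false v∈∁U
            i , eq = block-∋ v
            K>0 = ∃⇒card-pos {P = fresh U (block v)} i (trans (cong (∁ U) eq) v∈∁U)
        in extend-partition U v sep v∉U (go fuel (insert U (block v))
             (≤-trans enough (≤-trans (≤-reflexive (sym (+-suc fuel (card U))))
               (+-monoʳ-≤ fuel (≤-trans (m<m+n (card U) K>0) (≤-reflexive (sym (card-insert U (block-inj v))))))))
             (add-block U v sep v∉U))

-- Structure of edge-minimal graphs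

module Structure {n d r : ℕ} (r<n : r < n) (H : Graph (Fin n)) (reg : Regular d H) (n≤ : n ≤ 2 * d + 1)
                 {N k : ℕ} (N≡ : N ≡ suc k * n + r) {G : Graph (Fin N)} (min : EdgeMinimal H G) where

  open InClass {n} {d} {r} r<n H reg n≤ {N} {k} N≡
  private
    cov : Covered H G
    cov = proj₁ min

  open Cover H reg n≤ {G} cov

  n>0 : 0 < n
  n>0 = ≤-trans z<s r<n

  -- The r-set found by `excess` is also the one at which the upper bound is taken, so the cuts
  -- cancel and only the slack 1 remains.
  no-excess : ∀ {U} → ¬ State 1 U
  no-excess st =
    let C′ , size , lower = excess {suc k} N≡ r<n st
    in <⇒≱ lower (≤-trans (≤-reflexive (vol-full≡total G)) (minimal-total min C′ size))

  no-excess₀ : r ≡ 0 → ∀ U → ¬ (1 + d * card U ≤ vol G U)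
  no-excess₀ r≡0 U le = <⇒≱ (vol-excess U 1 le) (begin
    vol G full         ≡⟨ vol-full≡total G ⟩
    total G            ≤⟨ minimal-total min ∅ (trans (card-∅ {n}) (sym r≡0)) ⟩
    d * N + cut H ∅    ≡⟨ cong (d * N +_) (cut-none H ∅ (card-∅ {n})) ⟩
    d * N + 0          ≡⟨ +-identityʳ _ ⟩
    d * N ∎)
    where open ≤-Reasoning

  -- A partially new copy has a proper nonempty K. If the recorded set is nonempty, combining it
  -- with K is strict; if r = 0, the positive cut of K alone exceeds the minimum dN.
  no-partial : ∀ {U} (st : State 0 U) → 0 < card (State.C st) ⊎ r ≡ 0 → (φ : Copy H G) →
               card (fresh U (at φ)) ≡ 0 ⊎ card (fresh U (at φ)) ≡ n
  no-partial {U} st nontriv φ = decide (card K ℕ.≟ 0) (m≤n⇒m<n∨m≡n (card≤ K))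
    where
    K = fresh U (at φ)
    impossible : 0 < card (State.C st) ⊎ r ≡ 0 → 0 < card K → card K < n → ¬ (card K ≤ n)
    impossible (inj₁ C>0) K>0 K<n _ = no-excess (step-partial st φ C>0 K>0 K<n)
    impossible (inj₂ r≡0) K>0 K<n _ = no-excess₀ r≡0 (insert U (at φ)) (begin
      1 + d * card (insert U (at φ))                                          ≡⟨ +-comm 1 _ ⟩
      d * card (insert U (at φ)) + 1                                          ≤⟨ +-monoʳ-≤ _ (≤-trans (cut-pos K K>0 K<n) (m≤n+m _ _)) ⟩
      d * card (insert U (at φ)) + (cut H (State.C st) + cut H K)             ≤⟨ Ins.vol-insert-≤ U φ {0} (State.bound st) ⟩
      vol G (insert U (at φ)) ∎)
      where open ≤-Reasoning
    decide : Dec (card K ≡ 0) → card K < n ⊎ card K ≡ n → card K ≡ 0 ⊎ card K ≡ n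
    decide _         (inj₂ K≡n) = inj₂ K≡n
    decide (yes K≡0) (inj₁ K<n) = inj₁ K≡0
    decide (no K≢0)  (inj₁ K<n) = contradiction (card≤ K) (impossible nontriv (n≢0⇒n>0 K≢0) K<n)

  -- Stated with the same `C`, so that a proof of its nonemptiness carries over to the enlarged set.
  step-full : ∀ {s U} → State s U → (φ : Copy H G) → card (fresh U (at φ)) ≡ n → State s (insert U (at φ))
  step-full {s} {U} st φ new = record
    { C     = State.C st
    ; C<n   = State.C<n st
    ; mod   = suc (proj₁ (State.mod st)) , trans (card-insert U (inj φ)) (trans (cong₂ _+_ (proj₂ (State.mod st)) new)
                (trans (+-comm _ n) (sym (+-assoc n _ _))))
    ; bound = ≤-trans (+-monoʳ-≤ (s + d * card (insert U (at φ))) (m≤m+n _ _)) (Ins.vol-insert-≤ U φ {s} (State.bound st))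
    }

  single : Copy H G → Sub N
  single φ = insert ∅ (at φ)

  single-state : ∀ φ → State 0 (single φ)
  single-state φ = step-full (empty-state n>0) φ (card-full {n})

  single-inv : ∀ φ {v} → single φ v ≡ true → ∃[ i ] at φ i ≡ v
  single-inv φ v∈ with insert-inv ∅ (at φ) v∈
  ... | inj₂ im = im

  -- A covering may start with any copy; an edge inside it that H lacks would give slack 1 in the
  -- very first step.
  induced : (φ : Copy H G) → ∀ i j → adj H i j ≡ adj G (at φ i) (at φ j)
  induced φ i j with adj H i j in Hij | adj G (at φ i) (at φ j) in Gij
  ... | true  | true  = refl
  ... | false | false = refl
  ... | true  | false = contradiction (hom φ i j Hij) (λ p → true≢false p Gij)
  ... | false | true  = contradiction extra no-excess
    where
    extra : State 1 (single φ)
    extra = record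
      { C     = ∅
      ; C<n   = subst (_< n) (sym (card-∅ {n})) n>0
      ; mod   = State.mod (single-state φ)
      ; bound = ≤-trans (+-monoʳ-≤ (1 + d * card (single φ)) (m≤m+n _ _))
                  (Ins.vol-insert-inner ∅ φ {0} {cut H ∅} refl refl Gij Hij (State.bound (empty-state n>0)))
      }

  disjoint-nonadj : ∀ {U} → State 0 U → (φ : Copy H G) → (∀ i → U (at φ i) ≡ false) → ∀ {x} j → U x ≡ true →
                    adj G (at φ j) x ≡ false
  disjoint-nonadj {U} st φ avoid {x} j Ux = ≢true⇒false λ Gjx → no-excess (record
    { C     = State.C st
    ; C<n   = State.C<n st
    ; mod   = State.mod (step-full st φ new)
    ; bound = ≤-trans (+-monoʳ-≤ (1 + d * card (insert U (at φ))) (m≤m+n _ _))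
                (Ins.vol-insert-cross U φ {0} Ux (λ { i refl → true≢false Ux (avoid i) }) (cong not (avoid j)) Gjx (State.bound st))
    })
    where
    new : card (fresh U (at φ)) ≡ n
    new = trans (sum-cong-≗ λ i → cong (λ b → [ not b ]ᵇ) (avoid i)) (card-full {n})

  blocks : Fin N → Fin n → Fin N
  blocks v = at (copy cov v)

  open Blocks blocks (λ v → inj (copy cov v)) (copy-∋ cov)

  -- For nesting, the block of v is added first. The block of w meets it, hence is not wholly new,
  -- hence contributes nothing new; as it avoids U, it lies in the block of v.
  separated : ∀ {U} (st : State 0 U) → 0 < card (State.C st) ⊎ r ≡ 0 → Separated U
  separated {U} st nontriv = record { avoids = avoids ; nested = nested }
    where
    avoids : ∀ v → U v ≡ false → Avoids U v
    avoids v v∉ i with no-partial st nontriv (copy cov v)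
    ... | inj₂ all-new = not-true⇒false (card≡n⇒true {P = fresh U (blocks v)} all-new i)
    ... | inj₁ none    = let j , eq = copy-∋ cov v in
      contradiction (card≡0⇒false {P = fresh U (blocks v)} none j) (true≢false (cong not (trans (cong U eq) v∉)))
    nested : ∀ v w → U v ≡ false → U w ≡ false → ∀ i j → blocks v i ≡ blocks w j → ∀ j′ → ∃[ i′ ] blocks v i′ ≡ blocks w j′
    nested v w v∉ w∉ i j eq j′ = by-cases (no-partial st′ nontriv (copy cov w))
      where
      U′ = insert U (blocks v)
      st′ : State 0 U′
      st′ = step-full st (copy cov v) (trans (sum-cong-≗ λ i → cong (λ b → [ not b ]ᵇ) (avoids v v∉ i)) (card-full {n}))
      by-cases : card (fresh U′ (blocks w)) ≡ 0 ⊎ card (fresh U′ (blocks w)) ≡ n → ∃[ i′ ] blocks v i′ ≡ blocks w j′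
      by-cases (inj₂ all-new) = contradiction (not-true⇒false (card≡n⇒true {P = fresh U′ (blocks w)} all-new j))
        (true≢false (trans (cong U′ (sym eq)) (insert-new U (blocks v) i)))
      by-cases (inj₁ none) with insert-inv U (blocks v) (not-false⇒true (card≡0⇒false {P = fresh U′ (blocks w)} none j′))
      ... | inj₁ Uw = contradiction (avoids w w∉ j′) (true≢false Uw)
      ... | inj₂ im = im

  -- The first alternative of `nontriv` says that ψ adds a vertex to φ, so that the remainder set
  -- starts nonempty. For r = 0 the two copies may coincide, which makes L a single copy of H.
  record OverlappingPair : Set where
    field
      φ ψ   : Copy H G
      i₀ j₀ : Fin n
      meet  : at φ i₀ ≡ at ψ j₀
      nontriv : 0 < card (fresh (single φ) (at ψ)) ⊎ r ≡ 0

  -- If chosen copies that meet always had equal vertex sets, they would partition the vertices of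
  -- G, so n would divide N and r would be 0.
  overlapping-pair : OverlappingPair
  overlapping-pair = by-class (r ℕ.≟ 0)
    where
    N>0 : 0 < N
    N>0 = ≤-trans n>0 (≤-trans (m≤m+n n (k * n)) (≤-trans (m≤m+n _ r) (≤-reflexive (sym N≡))))
    Overlap : Fin N → Fin N → Set
    Overlap v w = (∃[ i ] ∃[ j ] blocks v i ≡ blocks w j) × (∃[ j′ ] ¬ (∃[ i ] blocks v i ≡ blocks w j′))
    overlap? : ∀ v w → Dec (Overlap v w)
    overlap? v w = any? (λ i → any? λ j → blocks v i ≟ blocks w j) ×-dec any? λ j′ → ¬? (image? (blocks v) (blocks w j′))
    by-class : Dec (r ≡ 0) → OverlappingPair
    by-class (yes r≡0) = record { φ = copy cov v ; ψ = copy cov v ; i₀ = proj₁ (copy-∋ cov v) ; j₀ = proj₁ (copy-∋ cov v) ; meet = refl ; nontriv = inj₂ r≡0 }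
      where
      v : Fin N
      v = fromℕ< N>0
    by-class (no r≢0) = found (any? λ v → any? λ w → overlap? v w)
      where
      found : Dec (∃[ v ] ∃[ w ] Overlap v w) → OverlappingPair
      found (yes (v , w , (i , j , eq) , (j′ , ∉v))) = record
        { φ = copy cov v ; ψ = copy cov w ; i₀ = i ; j₀ = j ; meet = eq
        ; nontriv = inj₁ (∃⇒card-pos {P = fresh (single (copy cov v)) (blocks w)} j′
            (cong not (≢true⇒false (∉v ∘ single-inv (copy cov v))))) }
      found (no none) = contradiction r≡0 r≢0
        where
        P : Partition ∅
        P = partition ∅ (record
          { avoids = λ _ _ _ → refl
          ; nested = λ v w _ _ i j eq j′ → decidable-stable (image? (blocks v) (blocks w j′)) λ ∉v → none (v , w , (i , j , eq) , (j′ , ∉v)) })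
        open Partition P
        r≡0 : r ≡ 0
        r≡0 = sym (proj₂ (div-unique size (suc k) n>0 r<n (trans (+-identityʳ _)
          (trans (cong (_+ size * n) (sym (card-∅ {N}))) (trans (sym count) N≡)))))

  module FromPair (pair : OverlappingPair) where

    open OverlappingPair pair

    K₁ K₂ : Sub n
    K₁ = fresh (single ψ) (at φ)
    K₂ = fresh (single φ) (at ψ)

    U₀ : Sub N
    U₀ = insert (single φ) (at ψ)

    K₂<n : card K₂ < n
    K₂<n = ≤∧≢⇒< (card≤ K₂) λ all-new → true≢false (card≡n⇒true {P = K₂} all-new j₀)
      (cong not (trans (cong (single φ) (sym meet)) (insert-new ∅ (at φ) i₀)))

    card-single : ∀ χ → card (single χ) ≡ n
    card-single χ = trans (card-insert ∅ (inj χ)) (cong₂ _+_ (card-∅ {N}) (card-full {n}))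

    card-U₀ : card U₀ ≡ n + card K₂
    card-U₀ = trans (card-insert (single φ) (inj ψ)) (cong (_+ card K₂) (card-single φ))

    U₀-mod : ∃[ j ] card U₀ ≡ j * n + card K₂
    U₀-mod = 1 , trans card-U₀ (cong (_+ card K₂) (sym (+-identityʳ n)))

    -- The first copy is recorded with cut 0, so K₂ itself can be the remainder set and no
    -- combination takes place.
    U₀-state : State 0 U₀
    U₀-state = record { C = K₂ ; C<n = K₂<n ; mod = U₀-mod
      ; bound = Ins.vol-insert-≤ (single φ) ψ {0} {0} (≤-trans (+-monoʳ-≤ (d * card (single φ)) z≤n) (State.bound (single-state φ))) }

    -- Such an edge joins a vertex new in ψ to a covered vertex outside the image of ψ, so it comes
    -- on top of the edges counted by `cut H K₂`.
    only-φ-ψ-nonadj : ∀ {i j} → K₁ i ≡ true → K₂ j ≡ true → adj G (at φ i) (at ψ j) ≡ false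
    only-φ-ψ-nonadj {i} {j} K₁i K₂j = ≢true⇒false λ Gij → no-excess (record { C = K₂ ; C<n = K₂<n ; mod = U₀-mod
      ; bound = Ins.vol-insert-cross (single φ) ψ {0} {0} (insert-new ∅ (at φ) i)
          (λ j′ eq → true≢false (trans (cong (single ψ) (sym eq)) (insert-new ∅ (at ψ) j′)) (not-true⇒false K₁i))
          K₂j (trans (adj-sym G _ _) Gij) (≤-trans (+-monoʳ-≤ (d * card (single φ)) z≤n) (State.bound (single-state φ))) })

    -- Inserting the two copies in either order gives the same union, with n vertices from the first
    -- copy and the rest from the second.
    card-K₁ : card K₁ ≡ card K₂
    card-K₁ = +-cancelˡ-≡ n _ _ (begin
      n + card K₁                         ≡⟨ cong (_+ card K₁) (card-single ψ) ⟨
      card (single ψ) + card K₁           ≡⟨ card-insert (single ψ) (inj φ) ⟨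
      card (insert (single ψ) (at φ))     ≡⟨ sum-cong-≗ (λ v → cong [_]ᵇ (∨-comm (does (image? (at ψ) v)) _)) ⟩
      card U₀                             ≡⟨ card-U₀ ⟩
      n + card K₂ ∎)
      where open ≡-Reasoning

    module Assemble (P : Partition U₀) where

      open Partition P

      -- The blocks and U₀ together have (1 + `size`)n + |K₂| vertices with |K₂| < n, and division
      -- with remainder is unique.
      sizes : size ≡ k × card K₂ ≡ r
      sizes =
        let q≡ , r≡ = div-unique (suc size) (suc k) K₂<n r<n (trans (sym total-count) N≡)
        in suc-injective q≡ , r≡
        where
        total-count : N ≡ suc size * n + card K₂
        total-count = trans count (trans (cong (_+ size * n) card-U₀) (shift n (card K₂) (size * n)))
          where
          shift : ∀ n c m → n + c + m ≡ n + m + c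
          shift = solve-∀

      shared : Enum (∁ K₂) (n ∸ r)
      shared = Gluing.enumerate-∁ {d = d} r<n H reg K₂ (proj₂ sizes)

      only-φ : Enum K₁ r
      only-φ = subst (Enum K₁) (trans card-K₁ (proj₂ sizes)) (enumerate K₁)

      only-ψ : Enum K₂ r
      only-ψ = subst (Enum K₂) (proj₂ sizes) (enumerate K₂)

      open Enum shared renaming (at-index to e₀; index-inj to e₀-inj; index-∈ to e₀-∈; index-of to index₀)
      open Enum only-φ renaming (at-index to e₁; index-inj to e₁-inj; index-∈ to e₁-∈; index-of to index₁)
      open Enum only-ψ renaming (at-index to e₂; index-inj to e₂-inj; index-∈ to e₂-∈; index-of to index₂)

      place : LVertex n r → Fin N
      place (inj₁ x)        = at ψ (e₀ x)
      place (inj₂ (inj₁ y)) = at φ (e₁ y)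
      place (inj₂ (inj₂ z)) = at ψ (e₂ z)

      K₁-∉ψ : ∀ {i j} → K₁ i ≡ true → at ψ j ≢ at φ i
      K₁-∉ψ {i} {j} K₁i eq = true≢false (trans (cong (single ψ) (sym eq)) (insert-new ∅ (at ψ) j)) (not-true⇒false K₁i)

      K₂-disjoint : ∀ {x z} → e₀ x ≢ e₂ z
      K₂-disjoint {x} {z} eq = true≢false (trans (cong K₂ eq) (e₂-∈ z)) (not-true⇒false (e₀-∈ x))

      place-inj : Inj place
      place-inj {inj₁ _}        {inj₁ _}        eq = cong inj₁ (e₀-inj (inj ψ eq))
      place-inj {inj₁ _}        {inj₂ (inj₁ y)} eq = contradiction eq (K₁-∉ψ (e₁-∈ y))
      place-inj {inj₁ _}        {inj₂ (inj₂ _)} eq = contradiction (inj ψ eq) K₂-disjoint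
      place-inj {inj₂ (inj₁ y)} {inj₁ _}        eq = contradiction (sym eq) (K₁-∉ψ (e₁-∈ y))
      place-inj {inj₂ (inj₁ _)} {inj₂ (inj₁ _)} eq = cong (inj₂ ∘ inj₁) (e₁-inj (inj φ eq))
      place-inj {inj₂ (inj₁ y)} {inj₂ (inj₂ _)} eq = contradiction (sym eq) (K₁-∉ψ (e₁-∈ y))
      place-inj {inj₂ (inj₂ _)} {inj₁ _}        eq = contradiction (sym (inj ψ eq)) K₂-disjoint
      place-inj {inj₂ (inj₂ _)} {inj₂ (inj₁ y)} eq = contradiction eq (K₁-∉ψ (e₁-∈ y))
      place-inj {inj₂ (inj₂ _)} {inj₂ (inj₂ _)} eq = cong (inj₂ ∘ inj₂) (e₂-inj (inj ψ eq))

      φ⊆ : ∀ i → ∃[ x ] place (V∪V₁ {n} r x) ≡ at φ i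
      φ⊆ i with K₁ i in K₁i
      ... | true  = let y , eq = index₁ i K₁i in inj₂ y , cong (at φ) eq
      ... | false =
        let j , eq = single-inv ψ (not-false⇒true K₁i)
            x , eq′ = index₀ j (cong (not ∘ not) (trans (cong (single φ) eq) (insert-new ∅ (at φ) i)))
        in inj₁ x , trans (cong (at ψ) eq′) eq

      ψ⊆ : ∀ j → ∃[ x ] place (V∪V₂ {n} r x) ≡ at ψ j
      ψ⊆ j with K₂ j in K₂j
      ... | true  = let z , eq = index₂ j K₂j in inj₂ z , cong (at ψ) eq
      ... | false = let x , eq = index₀ j (cong not K₂j) in inj₁ x , cong (at ψ) eq

      ⊆φ : ∀ x → ∃[ i ] at φ i ≡ place (V∪V₁ {n} r x)
      ⊆φ (inj₁ x) = single-inv φ (not-false⇒true (not-true⇒false (e₀-∈ x)))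
      ⊆φ (inj₂ y) = e₁ y , refl

      ⊆ψ : ∀ x → ∃[ j ] at ψ j ≡ place (V∪V₂ {n} r x)
      ⊆ψ (inj₁ x) = e₀ x , refl
      ⊆ψ (inj₂ z) = e₂ z , refl

      copy-≅ : ∀ {𝒜 : Set} (χ : Copy H G) {f : 𝒜 → Fin N} → Inj f → (∀ x → ∃[ i ] at χ i ≡ f x) → (∀ i → ∃[ x ] f x ≡ at χ i) →
               pullback f G ≅ H
      copy-≅ χ f-inj f⊆ ⊆f =
        let e , e≡ = same-image f-inj (inj χ) f⊆ ⊆f
        in record { bij = e ; adj-map = λ u v → trans (induced χ (to e u) (to e v)) (cong₂ (adj G) (e≡ u) (e≡ v)) }

      L : Graph (LVertex n r)
      L = pullback place G

      L-glued : Glued H r L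
      L-glued = record
        { no-V₁V₂-edge = λ y z → only-φ-ψ-nonadj (e₁-∈ y) (e₂-∈ z)
        ; V∪V₁-copy    = copy-≅ φ (V∪V₁-inj n r ∘ place-inj) ⊆φ φ⊆
        ; V∪V₂-copy    = copy-≅ ψ (V∪V₂-inj n r ∘ place-inj) ⊆ψ ψ⊆
        }

      place-∈ : ∀ x → U₀ (place x) ≡ true
      place-∈ (inj₁ x)        = insert-new (single φ) (at ψ) (e₀ x)
      place-∈ (inj₂ (inj₁ y)) = insert-old (single φ) (at ψ) (insert-new ∅ (at φ) (e₁ y))
      place-∈ (inj₂ (inj₂ z)) = insert-new (single φ) (at ψ) (e₂ z)

      blocks-avoid : ∀ i → Avoids U₀ (rep i)
      blocks-avoid i = Separated.avoids (separated U₀-state nontriv) (rep i) (rep∉ i)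

      whole : LVertex n r ⊎ (Fin size × Fin n) → Fin N
      whole (inj₁ x)       = place x
      whole (inj₂ (i , a)) = blocks (rep i) a

      whole-inj : Inj whole
      whole-inj {inj₁ _}       {inj₁ _}       eq = cong inj₁ (place-inj eq)
      whole-inj {inj₁ x}       {inj₂ (i , a)} eq = contradiction (trans (cong U₀ (sym eq)) (place-∈ x)) (λ p → true≢false p (blocks-avoid i a))
      whole-inj {inj₂ (i , a)} {inj₁ x}       eq = contradiction (trans (cong U₀ eq) (place-∈ x)) (λ p → true≢false p (blocks-avoid i a))
      whole-inj {inj₂ (i , a)} {inj₂ (j , b)} eq = same-block (disjoint i j a b eq) eq
        where
        same-block : ∀ {i j a b} → i ≡ j → blocks (rep i) a ≡ blocks (rep j) b → inj₂ (i , a) ≡ inj₂ (j , b)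
        same-block {i} refl eq = cong (λ c → inj₂ (i , c)) (inj (copy cov (rep i)) eq)

      whole-onto : ∀ v → ∃[ x ] whole x ≡ v
      whole-onto v with covers v
      ... | inj₂ (i , a , eq) = inj₂ (i , a) , eq
      ... | inj₁ U₀v with insert-inv (single φ) (at ψ) U₀v
      ...   | inj₂ (j , eq) = let x , eq′ = ψ⊆ j in inj₁ (V∪V₂ {n} r x) , trans eq′ eq
      ...   | inj₁ Sv = let i , eq = single-inv φ Sv ; x , eq′ = φ⊆ i in inj₁ (V∪V₁ {n} r x) , trans eq′ eq

      whole-adj : ∀ x y → adj (L ⊔ᴳ copies size H) x y ≡ adj G (whole x) (whole y)
      whole-adj (inj₁ x)       (inj₁ y)       = refl
      whole-adj (inj₁ x)       (inj₂ (j , b)) =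
        sym (trans (adj-sym G _ _) (disjoint-nonadj U₀-state (copy cov (rep j)) (blocks-avoid j) b (place-∈ x)))
      whole-adj (inj₂ (i , a)) (inj₁ y)       = sym (disjoint-nonadj U₀-state (copy cov (rep i)) (blocks-avoid i) a (place-∈ y))
      whole-adj (inj₂ (i , a)) (inj₂ (j , b)) with i ≟ j
      ... | yes refl = induced (copy cov (rep i)) a b
      -- Both blocks lie outside U₀, so a covering started from block j alone is used to exclude
      -- edges to block i.
      ... | no i≢j   = sym (disjoint-nonadj (single-state (copy cov (rep j))) (copy cov (rep i))
        (λ a′ → ≢true⇒false λ p → let b′ , eq = single-inv (copy cov (rep j)) p in i≢j (sym (disjoint j i b′ a′ eq)))
        a (insert-new ∅ (blocks (rep j)) b))

      G-≅ : G ≅ (L ⊔ᴳ copies size H)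
      G-≅ = let e , e≡ = same-image {f = id} id whole-inj whole-onto (λ x → whole x , refl) in record
        { bij = e ; adj-map = λ u v → trans (whole-adj (to e u) (to e v)) (cong₂ (adj G) (e≡ u) (e≡ v)) }

      pair⇒𝓛 : Σ[ L ∈ Graph (LVertex n r) ] In𝓛 H r L × G ≅ (L ⊔ᴳ copies k H)
      pair⇒𝓛 = L , record
        { no-V₁V₂-edge = no-V₁V₂-edge ; V-max = minimal⇒V-max L-glued iso min
        ; V∪V₁-copy = V∪V₁-copy ; V∪V₂-copy = V∪V₂-copy } , iso
        where
        open Glued L-glued
        iso : G ≅ (L ⊔ᴳ copies k H)
        iso = subst (λ s → G ≅ (L ⊔ᴳ copies s H)) (proj₁ sizes) G-≅

  minimal⇒𝓛 : Σ[ L ∈ Graph (LVertex n r) ] In𝓛 H r L × G ≅ (L ⊔ᴳ copies k H)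
  minimal⇒𝓛 = build overlapping-pair
    where
    build : OverlappingPair → Σ[ L ∈ Graph (LVertex n r) ] In𝓛 H r L × G ≅ (L ⊔ᴳ copies k H)
    build pair = FromPair.Assemble.pair⇒𝓛 pair
      (partition (FromPair.U₀ pair) (separated (FromPair.U₀-state pair) (OverlappingPair.nontriv pair)))

ideal : ∀ n d (H : Graph (Fin n)) → Regular d H → n ≤ 2 * d + 1 → Ideal H
ideal n d H reg n≤ r r<n N (suc k) _ N≡ G = mk⇔
  (Structure.minimal⇒𝓛 r<n H reg n≤ N≡)
  (λ (L , l , iso) → InClass.V-max⇒minimal r<n H reg n≤ N≡ (In𝓛⇒Glued l) iso (In𝓛.V-max l))

-- Vertices whose neighbourhood is not a clique

Open : Graph 𝒜 → 𝒜 → Set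
Open G v = ∃[ x ] ∃[ y ] adj G v x ≡ true × adj G v y ≡ true × x ≢ y × adj G x y ≡ false

Open-map : {G : Graph 𝒜} {X : Graph ℬ} {f : 𝒜 → ℬ} → Inj f → (∀ u v → adj X (f u) (f v) ≡ adj G u v) →
           ∀ {v} → Open G v → Open X (f v)
Open-map {f = f} inj adj≡ (x , y , vx , vy , x≢y , xy) =
  f x , f y , trans (adj≡ _ x) vx , trans (adj≡ _ y) vy , x≢y ∘ inj , trans (adj≡ x y) xy

open? : (G : Graph (Fin n)) → ∀ v → Dec (Open G v)
open? G v = any? λ x → any? λ y →
  (adj G v x Bool.≟ true) ×-dec (adj G v y Bool.≟ true) ×-dec ¬? (x ≟ y) ×-dec (adj G x y Bool.≟ false)

-- The number c counts the vertices not adjacent to v, including v. Unlike the degree, it is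
-- unchanged when two graphs with the same c are joined completely.
CoRegular : ℕ → Graph (Fin n) → Set
CoRegular {n} c G = ∀ v → degree G v + c ≡ n

-- Dense regular graphs in which no neighbourhood is a clique

record OpenGraph (c n : ℕ) : Set where
  field
    graph     : Graph (Fin n)
    coregular : CoRegular c graph
    all-open  : ∀ v → Open graph v

distance-graph : ∀ n (ds : List ℕ) → any (λ s → does (s ℕ.≟ 0)) ds ≡ false → Graph (Fin n)
distance-graph n ds 0∉ds = record
  { adj        = λ u v → has ∣ toℕ u - toℕ v ∣
  ; adj-sym    = λ u v → cong has (∣-∣-comm (toℕ u) (toℕ v))
  ; adj-irrefl = λ v → trans (cong has (∣n-n∣≡0 (toℕ v))) 0∉ds }
  where
  has : ℕ → Bool
  has t = any (λ s → does (s ℕ.≟ t)) ds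

coregular? : ∀ c (G : Graph (Fin n)) → Dec (CoRegular c G)
coregular? {n} c G = all? λ v → degree G v + c ℕ.≟ n

joinᴳ : Graph 𝒜 → Graph ℬ → Graph (𝒜 ⊎ ℬ)
joinᴳ {𝒜} {ℬ} G X = record { adj = a ; adj-sym = a-sym ; adj-irrefl = a-irrefl }
  where
  a : 𝒜 ⊎ ℬ → 𝒜 ⊎ ℬ → Bool
  a (inj₁ u) (inj₁ v) = adj G u v
  a (inj₂ u) (inj₂ v) = adj X u v
  a (inj₁ _) (inj₂ _) = true
  a (inj₂ _) (inj₁ _) = true
  a-sym : ∀ u v → a u v ≡ a v u
  a-sym (inj₁ u) (inj₁ v) = adj-sym G u v
  a-sym (inj₂ u) (inj₂ v) = adj-sym X u v
  a-sym (inj₁ _) (inj₂ _) = refl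
  a-sym (inj₂ _) (inj₁ _) = refl
  a-irrefl : ∀ v → a v v ≡ false
  a-irrefl (inj₁ v) = adj-irrefl G v
  a-irrefl (inj₂ v) = adj-irrefl X v

-- A vertex of P is adjacent to all of F, in particular to two distinct nonadjacent vertices there,
-- so P may be any graph with the same c. Writing the order of F as `suc m` provides the vertex
-- whose neighbours are taken.
join-open : ∀ {c m k} → OpenGraph c (suc m) → (P : Graph (Fin k)) → CoRegular c P → OpenGraph c (suc m + k)
join-open {c} {m} {k} F P P-co = record { graph = pullback (splitAt (suc m)) GP ; coregular = co ; all-open = λ v → opened v }
  where
  open OpenGraph F
  GP : Graph (Fin (suc m) ⊎ Fin k)
  GP = joinᴳ graph P
  co-at : ∀ x → sum (λ j → [ adj GP x (splitAt (suc m) j) ]ᵇ) + c ≡ suc m + k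
  co-at (inj₁ u) = begin
    sum (λ j → [ adj GP (inj₁ u) (splitAt (suc m) j) ]ᵇ) + c
      ≡⟨ cong (_+ c) (sum-splitAt (suc m) λ y → [ adj GP (inj₁ u) y ]ᵇ) ⟩
    degree graph u + sum {k} (λ _ → 1) + c     ≡⟨ cong (λ x → degree graph u + x + c) (sum-ones k) ⟩
    degree graph u + k + c                     ≡⟨ rearr (degree graph u) k c ⟩
    degree graph u + c + k                     ≡⟨ cong (_+ k) (coregular u) ⟩
    suc m + k ∎
    where
    open ≡-Reasoning
    rearr : ∀ a b c → a + b + c ≡ a + c + b
    rearr = solve-∀
  co-at (inj₂ u) = begin
    sum (λ j → [ adj GP (inj₂ u) (splitAt (suc m) j) ]ᵇ) + c
      ≡⟨ cong (_+ c) (sum-splitAt (suc m) λ y → [ adj GP (inj₂ u) y ]ᵇ) ⟩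
    sum {suc m} (λ _ → 1) + degree P u + c     ≡⟨ cong (λ x → x + degree P u + c) (sum-ones (suc m)) ⟩
    suc m + degree P u + c                     ≡⟨ +-assoc (suc m) (degree P u) c ⟩
    suc m + (degree P u + c)                   ≡⟨ cong (suc m +_) (P-co u) ⟩
    suc m + k ∎
    where open ≡-Reasoning
  co : CoRegular c (pullback (splitAt (suc m)) GP)
  co v = co-at (splitAt (suc m) v)
  GP-open : ∀ x → Open GP x
  GP-open (inj₁ u) = Open-map {G = graph} {GP} inj₁-inj (λ _ _ → refl) (all-open u)
  GP-open (inj₂ u) = let x , y , _ , _ , x≢y , xy = all-open zero in inj₁ x , inj₁ y , refl , refl , x≢y ∘ inj₁-inj , xy
  opened : ∀ v → Open (pullback (splitAt (suc m)) GP) v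
  opened v = subst (Open (pullback (splitAt (suc m)) GP)) (F.join-splitAt (suc m) k v)
    (Open-map {G = GP} {pullback (splitAt (suc m)) GP} {join (suc m) k} join-inj
      (λ x y → cong₂ (adj GP) (F.splitAt-join (suc m) k x) (F.splitAt-join (suc m) k y)) {splitAt (suc m) v} (GP-open (splitAt (suc m) v)))
    where
    join-inj : Inj (join (suc m) k)
    join-inj eq = trans (sym (F.splitAt-join (suc m) k _)) (trans (cong (splitAt (suc m)) eq) (F.splitAt-join (suc m) k _))

module _ (n : ℕ) (ds : List ℕ) (0∉ds : any (λ s → does (s ℕ.≟ 0)) ds ≡ false) (c : ℕ) where

  distance-open : True (coregular? c (distance-graph n ds 0∉ds)) → True (all? (open? (distance-graph n ds 0∉ds))) → OpenGraph c n
  distance-open co op = record { graph = distance-graph n ds 0∉ds ; coregular = toWitness co ; all-open = toWitness op }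

-- The base cases are circulant graphs: ds is closed under s ↦ n ∸ s.
open₂ : ∀ m → OpenGraph 2 (4 + m * 2)
open₂ zero    = distance-open 4 (1 ∷ 3 ∷ []) refl 2 _ _
open₂ (suc m) = subst (OpenGraph 2) (shift m) (join-open (open₂ m) (distance-graph 2 [] refl) (toWitness {a? = coregular? 2 (distance-graph 2 [] refl)} _))
  where
  shift : ∀ m → 4 + m * 2 + 2 ≡ 4 + (suc m) * 2
  shift = solve-∀

-- Each join adds two disjoint edges, a graph on four vertices with c = 3. Steps of four vertices
-- need two base cases: the 5-cycle and the square of the 7-cycle.
open₃ : ∀ m → OpenGraph 3 (5 + m * 2)
open₃ zero          = distance-open 5 (1 ∷ 4 ∷ []) refl 3 _ _
open₃ (suc zero)    = distance-open 7 (1 ∷ 2 ∷ 5 ∷ 6 ∷ []) refl 3 _ _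
open₃ (suc (suc m)) = subst (OpenGraph 3) (shift m) (join-open (open₃ m) (distance-graph 4 (2 ∷ []) refl) (toWitness {a? = coregular? 3 (distance-graph 4 (2 ∷ []) refl)} _))
  where
  shift : ∀ m → 5 + m * 2 + 4 ≡ 5 + (suc (suc m)) * 2
  shift = solve-∀

-- Each join adds four isolated vertices; the base cases are the 6-cycle and the square of the
-- 8-cycle.
open₄ : ∀ m → OpenGraph 4 (6 + m * 2)
open₄ zero          = distance-open 6 (1 ∷ 5 ∷ []) refl 4 _ _
open₄ (suc zero)    = distance-open 8 (1 ∷ 2 ∷ 6 ∷ 7 ∷ []) refl 4 _ _
open₄ (suc (suc m)) = subst (OpenGraph 4) (shift m) (join-open (open₄ m) (distance-graph 4 [] refl) (toWitness {a? = coregular? 4 (distance-graph 4 [] refl)} _))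
  where
  shift : ∀ m → 6 + m * 2 + 4 ≡ 6 + (suc (suc m)) * 2
  shift = solve-∀

complete : ∀ n → Graph (Fin n)
complete n = record
  { adj        = λ u v → not (does (u ≟ v))
  ; adj-sym    = λ u v → cong not (does-≟-comm u v)
  ; adj-irrefl = λ v → cong not (dec-true (v ≟ v) refl) }

complete-regular : ∀ d → Regular d (complete (suc d))
complete-regular d v = +-cancelʳ-≡ 1 _ _ (begin
  degree (complete (suc d)) v + 1            ≡⟨ cong (degree (complete (suc d)) v +_) (total-δ v) ⟨
  degree (complete (suc d)) v + sum (δ v)    ≡⟨ ∑-distrib-+ (λ w → [ not (does (v ≟ w)) ]ᵇ) (δ v) ⟨
  sum (λ w → [ not (does (v ≟ w)) ]ᵇ + δ v w) ≡⟨ sum-cong-≗ (λ w → either (does (v ≟ w))) ⟩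
  sum {suc d} (λ _ → 1)                      ≡⟨ sum-ones (suc d) ⟩
  suc d                                      ≡⟨ +-comm 1 d ⟩
  d + 1 ∎)
  where
  open ≡-Reasoning
  either : ∀ b → [ not b ]ᵇ + [ b ]ᵇ ≡ 1
  either true  = refl
  either false = refl

-- H = F ⊔ K_{d+1}. Trading d + 1 copies of F for as many copies of K_{d+1} as
-- have the same number of vertices keeps the graph H-covered and d-regular.
module Counterexample {d f : ℕ} (F : Graph (Fin f)) (F-reg : Regular d F) (F-open : ∀ v → Open F v) (d>0 : 0 < d) (f>0 : 0 < f) where

  K : Graph (Fin (suc d))
  K = complete (suc d)

  n₀ = f + suc d

  H : Graph (Fin n₀)
  H = pullback (splitAt f) (F ⊔ᴳ K)

  H-iso : H ≅ (F ⊔ᴳ K)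
  H-iso = record { bij = F.+↔⊎ ; adj-map = λ _ _ → refl }

  H-reg : Regular d H
  H-reg v = row-sum (splitAt f v)
    where
    row-sum : ∀ x → sum (λ j → [ adj (F ⊔ᴳ K) x (splitAt f j) ]ᵇ) ≡ d
    row-sum (inj₁ u) = trans (sum-splitAt f λ y → [ adj (F ⊔ᴳ K) (inj₁ u) y ]ᵇ)
      (trans (cong (degree F u +_) (sum-0 {suc d} λ _ → refl)) (trans (+-identityʳ _) (F-reg u)))
    row-sum (inj₂ u) = trans (sum-splitAt f λ y → [ adj (F ⊔ᴳ K) (inj₂ u) y ]ᵇ)
      (trans (cong (_+ degree K u) (sum-0 {f} λ _ → refl)) (complete-regular d u))

  -- The 2 + d copies of H contain 2 + d cliques, and the (d + 1)f vertices of the removed copies of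
  -- F make room for f more.
  M = 2 + d + f

  X : Graph (Fin f ⊎ (Fin M × Fin (suc d)))
  X = F ⊔ᴳ copies M K

  N₀ = (2 + d) * n₀ + 0

  b₀ : Fin (f + M * suc d) ↔ (Fin f ⊎ (Fin M × Fin (suc d)))
  b₀ = ↔-trans F.+↔⊎ (↔-refl ⊎-↔ F.*↔×)

  b : Fin N₀ ↔ (Fin f ⊎ (Fin M × Fin (suc d)))
  b = subst (λ m → Fin m ↔ (Fin f ⊎ (Fin M × Fin (suc d)))) (sizes d f) b₀
    where
    sizes : ∀ d f → f + (2 + d + f) * suc d ≡ (2 + d) * (f + suc d) + 0
    sizes = solve-∀

  G : Graph (Fin N₀)
  G = pullback (to b) X

  G-iso : G ≅ X
  G-iso = record { bij = b ; adj-map = λ _ _ → refl }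

  G-reg : Regular d G
  G-reg v = trans (sum-reindex b b₀ (λ y → [ adj X (to b v) y ]ᵇ)) (trans (sum-b₀ (λ y → [ adj X (to b v) y ]ᵇ)) (row-sum (to b v)))
    where
    sum-b₀ : (g : Fin f ⊎ (Fin M × Fin (suc d)) → ℕ) →
             sum (g ∘ to b₀) ≡ sum (g ∘ inj₁) + sum λ i → sum λ u → g (inj₂ (i , u))
    sum-b₀ g = trans (sum-cong-≗ λ i → shift (splitAt f i)) (trans (sum-splitAt f g′) (cong (sum (g ∘ inj₁) +_) (sum-remQuot M (g ∘ inj₂))))
      where
      g′ : Fin f ⊎ Fin (M * suc d) → ℕ
      g′ (inj₁ i) = g (inj₁ i)
      g′ (inj₂ i) = g (inj₂ (remQuot (suc d) i))
      shift : ∀ x → g (to (↔-refl ⊎-↔ F.*↔× {M} {suc d}) x) ≡ g′ x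
      shift (inj₁ _) = refl
      shift (inj₂ _) = refl
    row-sum : ∀ x → (sum λ u → [ adj X x (inj₁ u) ]ᵇ) + (sum λ i → sum λ u → [ adj X x (inj₂ (i , u)) ]ᵇ) ≡ d
    row-sum (inj₁ u) = trans (cong (degree F u +_) (sum-0 {M} λ _ → sum-0 {suc d} λ _ → refl)) (trans (+-identityʳ _) (F-reg u))
    row-sum (inj₂ (i , u)) = cong₂ _+_ (sum-0 {f} λ _ → refl) (trans (copies-row {k = M} K i u) (complete-regular d u))

  G-covered : Covered H G
  G-covered = Covered-≅ G-iso cov
    where
    with-copy : (i : Fin M) → (F ⊔ᴳ K) ↪ X
    with-copy i = record
      { embed    = mk↣ {to = λ { (inj₁ u) → inj₁ u ; (inj₂ v) → inj₂ (i , v) }}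
                       λ { {inj₁ _} {inj₁ _} refl → refl ; {inj₂ _} {inj₂ _} refl → refl }
      ; edge-map = λ { (inj₁ _) (inj₁ _) uv → uv
                     ; (inj₂ u) (inj₂ v) uv → trans (cong (_∧ adj K u v) (dec-true (i ≟ i) refl)) uv } }
    cov : Covered H X
    cov (inj₁ u)       = ↪-trans (≅⇒↪ H-iso) (with-copy zero) , join f (suc d) (inj₁ u)
                       , cong (Injection.to (_↪_.embed (with-copy zero))) (F.splitAt-join f (suc d) (inj₁ u))
    cov (inj₂ (i , v)) = ↪-trans (≅⇒↪ H-iso) (with-copy i) , join f (suc d) (inj₂ v)
                       , cong (Injection.to (_↪_.embed (with-copy i))) (F.splitAt-join f (suc d) (inj₂ v))

  -- In an H-covered graph every vertex has degree at least d, and G has degree d everywhere.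
  G-minimal : EdgeMinimal H G
  G-minimal = G-covered , λ G′ cov′ → total≤⇒edges≤ G G′
    (sum-mono λ v → ≤-trans (≤-reflexive (G-reg v)) (degree≥ H H-reg cov′ v))

  -- In a disjoint union of cliques, any two distinct neighbours of a vertex are adjacent.
  X-open⇒F : ∀ x → Open X x → ∃[ u ] inj₁ u ≡ x
  X-open⇒F (inj₁ u)       _ = u , refl
  X-open⇒F (inj₂ (i , u)) (inj₂ (j , v) , inj₂ (k , w) , uv , uw , v≢w , vw) = contradiction vw (true≢false (same (∧-yes i j uv) (∧-yes i k uw) v≢w))
    where
    ∧-yes : ∀ (i j : Fin M) {c} → does (i ≟ j) ∧ c ≡ true → i ≡ j
    ∧-yes i j eq with i ≟ j
    ... | yes p = p
    same : ∀ {j k v w} → i ≡ j → i ≡ k → inj₂ {A = Fin f} (j , v) ≢ inj₂ (k , w) → does (j ≟ k) ∧ adj K v w ≡ true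
    same {v = v} {w} refl refl ≢ = cong₂ _∧_ (dec-true (i ≟ i) refl) (cong not (dec-false (v ≟ w) λ { refl → ≢ refl }))

  -- Ideality would give G at least d + 1 ≥ 2 disjoint induced copies of H. Two of them already
  -- contain 2f open vertices, while all open vertices of G lie in its one copy of F.
  not-ideal : ¬ Ideal H
  not-ideal ideal = contradiction (F.injective⇒≤ {f = z} z-inj) (<⇒≱ (m<m+n f f>0))
    where
    structured = Equivalence.to (ideal 0 (≤-trans f>0 (m≤m+n f (suc d))) N₀ (2 + d) (s≤s z≤n) refl G) G-minimal
    L = proj₁ structured
    iso = _≅_.bij (proj₂ (proj₂ structured))
    σ : Fin (suc d) → Fin f → Fin n₀
    σ _ x = join f (suc d) (inj₁ x)
    place : Fin (suc d) → Fin f → Fin f ⊎ (Fin M × Fin (suc d))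
    place i x = to b (from iso (inj₂ (i , σ i x)))
    place-inj : ∀ {i j x y} → place i x ≡ place j y → i ≡ j × x ≡ y
    place-inj {i} {j} {x} {y} eq = pair (inj₂-inj (Injection.injective (↔⇒↣ (↔-sym iso)) (Injection.injective (↔⇒↣ b) eq)))
      where
      pair : (i , σ i x) ≡ (j , σ j y) → i ≡ j × x ≡ y
      pair eq = cong proj₁ eq , inj₁-inj (trans (sym (F.splitAt-join f (suc d) (inj₁ x)))
        (trans (cong (splitAt f ∘ proj₂) eq) (F.splitAt-join f (suc d) (inj₁ y))))
    place-adj : ∀ i x y → adj X (place i x) (place i y) ≡ adj F x y
    place-adj i x y = begin
      adj X (place i x) (place i y)
        ≡⟨ _≅_.adj-map (≅-sym (proj₂ (proj₂ structured))) (inj₂ (i , σ i x)) (inj₂ (i , σ i y)) ⟩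
      does (i ≟ i) ∧ adj H (σ i x) (σ i y)
        ≡⟨ cong (_∧ adj H (σ i x) (σ i y)) (dec-true (i ≟ i) refl) ⟩
      adj (F ⊔ᴳ K) (splitAt f (σ i x)) (splitAt f (σ i y))
        ≡⟨ cong₂ (adj (F ⊔ᴳ K)) (F.splitAt-join f (suc d) (inj₁ x)) (F.splitAt-join f (suc d) (inj₁ y)) ⟩
      adj F x y ∎
      where open ≡-Reasoning
    in-F : ∀ i x → ∃[ u ] inj₁ u ≡ place i x
    in-F i x = X-open⇒F (place i x) (Open-map {G = F} {X} {place i} (proj₂ ∘ place-inj {i} {i}) (place-adj i) (F-open x))
    one : Fin (suc d)
    one = fromℕ< (s≤s d>0)
    one≢zero : one ≢ zero
    one≢zero eq = contradiction (trans (sym (F.toℕ-fromℕ< (s≤s d>0))) (cong toℕ eq)) λ ()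
    side : Fin f ⊎ Fin f → Fin (suc d) × Fin f
    side (inj₁ x) = zero , x
    side (inj₂ x) = one , x
    side-inj : Inj side
    side-inj {inj₁ _} {inj₁ _} refl = refl
    side-inj {inj₁ _} {inj₂ _} eq   = contradiction (sym (cong proj₁ eq)) one≢zero
    side-inj {inj₂ _} {inj₁ _} eq   = contradiction (cong proj₁ eq) one≢zero
    side-inj {inj₂ _} {inj₂ _} eq   = cong inj₂ (cong proj₂ eq)
    z : Fin (f + f) → Fin f
    z v = let i , x = side (splitAt f v) in proj₁ (in-F i x)
    z-inj : ∀ {v w} → z v ≡ z w → v ≡ w
    z-inj {v} {w} eq =
      let i , x = side (splitAt f v)
          j , y = side (splitAt f w)
          i≡j , x≡y = place-inj {i} {j} {x} {y} (trans (sym (proj₂ (in-F i x))) (trans (cong inj₁ eq) (proj₂ (in-F j y))))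
      in Injection.injective (↔⇒↣ (F.+↔⊎ {f} {f})) (side-inj (cong₂ _,_ i≡j x≡y))

-- Non-ideal graphs of every order covered by the tightness claim

nonideal : ∀ {c} m → OpenGraph c (suc m * 2 + c) → 0 < c →
           Σ[ H ∈ Graph (Fin (suc m * 2 + c + suc (suc m * 2))) ] (Regular (suc m * 2) H × ¬ Ideal H)
nonideal {c} m F c>0 = H , H-reg , not-ideal
  where
  open OpenGraph F
  open Counterexample {suc m * 2} graph (λ v → +-cancelʳ-≡ c _ _ (coregular v)) all-open z<s z<s

-- With n = 2d + 2 + o, the graph F has n - d - 1 = d + c vertices for c = o + 1. For o = 0 it could
-- only be the complete graph, which has no open vertex, and o ≥ 4 contradicts the choice of d. For
-- o = 1, 2, 3 the even degree d matches the orders available from `open₂`, `open₃` and `open₄`.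
tight : ∀ n d → LargestEvenBelowHalf n d → 0 < d → n ≢ 2 * d + 2 → Σ[ H ∈ Graph (Fin n) ] (Regular d H × ¬ Ideal H)
tight n d (divides zero eq , _) d>0 _ = contradiction (subst (0 <_) eq d>0) λ ()
tight n .(suc m * 2) (divides (suc m) refl , below , largest) d>0 n≢ = by-offset (m≤n⇒∃[o]m+o≡n below)
  where
  d = suc m * 2
  Goal = Σ[ H ∈ Graph (Fin n) ] (Regular d H × ¬ Ideal H)
  build : ∀ c → OpenGraph c (d + c) → 0 < c → d + c + suc d ≡ n → Goal
  build c F c>0 refl = nonideal m F c>0
  size : ∀ o d → d + (1 + o) + suc d ≡ suc (2 * d + 1) + o
  size = solve-∀
  by-offset : ∃[ o ] suc (2 * d + 1) + o ≡ n → Goal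
  by-offset (0 , eq) = contradiction (trans (sym eq) (trans (+-identityʳ _) (+-comm 1 (2 * d + 1)))) (λ e → n≢ (trans e (+-assoc (2 * d) 1 1)))
  by-offset (1 , eq) = build 2 (subst (OpenGraph 2) (shift m) (open₂ m)) z<s (trans (size 1 d) eq)
    where
    shift : ∀ m → 4 + m * 2 ≡ suc m * 2 + 2
    shift = solve-∀
  by-offset (2 , eq) = build 3 (subst (OpenGraph 3) (shift m) (open₃ m)) z<s (trans (size 2 d) eq)
    where
    shift : ∀ m → 5 + m * 2 ≡ suc m * 2 + 3
    shift = solve-∀
  by-offset (3 , eq) = build 4 (subst (OpenGraph 4) (shift m) (open₄ m)) z<s (trans (size 3 d) eq)
    where
    shift : ∀ m → 6 + m * 2 ≡ suc m * 2 + 4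
    shift = solve-∀
  -- Here d + 2 is a larger even number that still lies below (n - 1)/2.
  by-offset (suc (suc (suc (suc o))) , eq) = contradiction (largest (d + 2) (∣m∣n⇒∣m+n (divides (suc m) refl) ∣-refl) bound) (<⇒≱ (m<m+n d z<s))
    where
    bound : 2 * (d + 2) + 1 < n
    bound = ≤-trans (≤-reflexive (shift d)) (≤-trans (m≤m+n _ o) (≤-reflexive (trans (shift′ d o) eq)))
      where
      shift : ∀ d → suc (2 * (d + 2) + 1) ≡ suc (2 * d + 1) + 4
      shift = solve-∀
      shift′ : ∀ d o → suc (2 * d + 1) + 4 + o ≡ suc (2 * d + 1) + suc (suc (suc (suc o)))
      shift′ = solve-∀

theorem1p2 : (∀ n d (H : Graph (Fin n)) → Regular d H → n ≤ 2 * d + 1 → Ideal H)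
    ×
    (∀ n d → LargestEvenBelowHalf n d → 0 < d → n ≢ 2 * d + 2 →
    Σ[ H ∈ Graph (Fin n) ] (Regular d H × ¬ Ideal H))
theorem1p2 = ideal , tight
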